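{- There are constants $\alpha>0$ and $\beta>0$ such that for every positive integer $n$ the following holds. Let $m=2n-1$ if $n$ is even and $m=2n$ if $n$ is odd. If $\varphi$ is an $\alpha$-dense $m$-edge precoloring of the complete graph $K_{2n}$, $L$ is a $\beta$-sparse list assignment for $K_{2n}$ from the color set $\{1,\dots,m\}$, and $\varphi(e)\notin L(e)$ for every edge $e\in E(K_{2n})$ that is colored under $\varphi$, then there is a proper $m$-edge coloring $f$ of $K_{2n}$ such that $f(e)=\varphi(e)$ for every edge $e$ colored under $\varphi$, and $f(e)\notin L(e)$ for every edge $e$ of $K_{2n}$.
   Context: An $m$-edge precoloring (partial edge coloring) of a graph $G$ is a proper edge coloring, with colors from $\{1,\dots,m\}$, of some subset $E'\subseteq E(G)$ (adjacent colored edges receive distinct colors). A partial edge coloring of $K_{2n}$ with colors $1,\dots,m$ is $\alpha$-dense if (i) every color appears on at most $\alpha m$ edges, and (ii) for every vertex $v$, at most $\alpha m$ edges incident to $v$ are colored. A list assignment $L$ assigns to each edge $e$ a set $L(e)\subseteq\{1,\dots,m\}$ (of forbidden colors); it is $\beta$-sparse if (i) $|L(e)|\le \beta m$ for every edge $e$, and (ii) for every vertex $v$ and every color $c$, $c$ belongs to $L(e)$ for at most $\beta m$ edges $e$ incident to $v$. -}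

module Defs where

open import Data.Nat using (ℕ; zero; suc; _+_; _*_; _∸_; _≤_; _<_; _%_)
open import Data.Fin using (Fin; toℕ) renaming (zero to fzero; suc to fsuc)
open import Data.Fin.Subset using (Subset; _∈_; _∉_; ∣_∣)
open import Data.Fin.Subset.Properties using (_∈?_)
open import Data.Maybe using (Maybe; just; nothing)
open import Data.Bool using (Bool; true; false; if_then_else_; _∧_; not)
open import Data.Product using (_×_; Σ; ∃; ∃-syntax; _,_)
open import Relation.Nullary using (¬_)
open import Data.Empty using (⊥)
open import Relation.Nullary.Decidable using (⌊_⌋)
open import Relation.Binary.PropositionalEquality using (_≡_; _≢_)
import Data.Nat as ℕ
import Data.Fin as F
open import Data.Maybe.Properties using (≡-dec)

count : ∀ {k} → (Fin k → Bool) → ℕ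
count {zero}  p = 0
count {suc k} p = (if p fzero then 1 else 0) + count (λ i → p (fsuc i))

numColors : ℕ → ℕ
numColors n with n % 2
... | zero = 2 * n ∸ 1
... | suc _ = 2 * n

-- Vertices of K_N are Fin N; an edge is an unordered pair {u,v} with u ≢ v.
-- An edge-indexed object is represented by a function on ordered pairs,
-- required to be symmetric; values on the diagonal are irrelevant / forced.

PartialColoring : ℕ → ℕ → Set
PartialColoring N m = Fin N → Fin N → Maybe (Fin m)

IsPrecoloring : ∀ {N m} → PartialColoring N m → Set
IsPrecoloring {N} {m} φ =
  (∀ u v → φ u v ≡ φ v u) ×
  (∀ u → φ u u ≡ nothing) ×                                   -- loops are not edges
  (∀ u v w (c : Fin m) → v ≢ w → φ u v ≡ just c → φ u w ≡ just c → ⊥)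

_≟M_ : ∀ {m} → (x y : Maybe (Fin m)) → _
_≟M_ = ≡-dec F._≟_

-- number of edges of K_N colored c under φ (each unordered edge counted once, as u < v)
colorCount : ∀ {N m} → PartialColoring N m → Fin m → ℕ
colorCount {N} φ c =
  sumF (λ u → count (λ v → ⌊ toℕ u ℕ.<? toℕ v ⌋ ∧ ⌊ φ u v ≟M just c ⌋))
  where
    sumF : ∀ {k} → (Fin k → ℕ) → ℕ
    sumF {zero}  f = 0
    sumF {suc k} f = f fzero + sumF (λ i → f (fsuc i))

coloredDegree : ∀ {N m} → PartialColoring N m → Fin N → ℕ
coloredDegree φ v = count (λ u → not ⌊ φ v u ≟M nothing ⌋)

-- α-dense with α = a / b (b > 0): every count x must satisfy x ≤ α m, i.e. b * x ≤ a * m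
IsDense : ∀ {N m} → (a b : ℕ) → PartialColoring N m → Set
IsDense {N} {m} a b φ =
  (∀ (c : Fin m) → b * colorCount φ c ≤ a * m) ×
  (∀ (v : Fin N) → b * coloredDegree φ v ≤ a * m)

-- list assignment (of forbidden colors) on edges of K_N
ListAssignment : ℕ → ℕ → Set
ListAssignment N m = Fin N → Fin N → Subset m

IsListAssignment : ∀ {N m} → ListAssignment N m → Set
IsListAssignment L = ∀ u v → L u v ≡ L v u

-- β-sparse with β = a / b (b > 0)
IsSparse : ∀ {N m} → (a b : ℕ) → ListAssignment N m → Set
IsSparse {N} {m} a b L =
  (∀ (u v : Fin N) → u ≢ v → b * ∣ L u v ∣ ≤ a * m) ×
  (∀ (v : Fin N) (c : Fin m) →
     b * count (λ u → not ⌊ u F.≟ v ⌋ ∧ ⌊ c ∈? L v u ⌋) ≤ a * m)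

IsProperColoring : ∀ {N m} → (Fin N → Fin N → Fin m) → Set
IsProperColoring {N} f =
  (∀ u v → f u v ≡ f v u) ×
  (∀ u v w → u ≢ v → u ≢ w → v ≢ w → f u v ≢ f u w)

-- Only 1-factorizations of K_N with N − 1 colours are built; for odd n the additional colour is used on the
-- edges precoloured with it and nowhere else. The start is a 1-factorization following a pattern of four
-- parts in which every edge between different parts lies in linearly many two-coloured 4-cycles, the colours
-- being shifted cyclically so that few edges have a forbidden colour. The pattern exists for N divisible by
-- 8; the other N are reached by adding two vertices at a time along a rainbow Hamiltonian path, which is
-- itself obtained by extending a precoloring.
--
-- Precoloured edges are then given their colours, and afterwards conflicts with L are removed, one edge at a
-- time by a bounded number of swaps on two-coloured 4-cycles. Only few edges in total are ever disturbed, so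
-- all but few vertices and colours still mostly follow the pattern. Nothing is assumed about the edge to be
-- recoloured, its ends and its colours: they may be among the exceptions. Every other vertex and colour
-- involved is a free parameter of the swaps, and each requirement on it rules out few values.
module Submission where

open import Defs
open import Data.Nat using (ℕ; zero; suc; _+_; _*_; _∸_; _≤_; _<_; _%_; _/_; z≤n; s≤s; NonZero)
import Data.Nat as ℕ
import Data.Nat.Properties as ℕₚ
import Data.Nat.DivMod as DM
open import Data.Fin using (Fin; toℕ) renaming (zero to fzero; suc to fsuc)
import Data.Fin as F
import Data.Fin.Properties as Fₚ
open import Data.Fin.Subset using (Subset; ∣_∣; _∉_) renaming (_∈_ to _∈ˢ_)
open import Data.List using (List; []; _∷_; _++_; length; map; concatMap; allFin)
import Data.List.Properties as Lₚ
open import Data.List.Membership.Propositional renaming (_∈_ to _∈ˡ_; _∉_ to _∉ˡ_)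
import Data.List.Membership.Propositional.Properties as Mₚ
open import Data.List.Relation.Unary.Any using (here; there; index)
open import Data.List.Relation.Unary.All using (All; []; _∷_)
open import Data.Maybe as Maybe using (Maybe; just; nothing)
open import Data.Product using (_×_; ∃; ∃-syntax; _,_; proj₁; proj₂)
open import Data.Sum using (_⊎_; inj₁; inj₂; [_,_]′)
open import Data.Empty using (⊥; ⊥-elim)
open import Data.Bool using (Bool; true; false; _∧_; _∨_; not; if_then_else_)
import Data.Bool.Properties as Boolₚ
open import Data.Unit using (⊤; tt)
open import Function using (_∘_; id; case_of_)
open import Relation.Nullary using (¬_; Dec; yes; no)
open import Relation.Nullary.Decidable using (⌊_⌋; does; decidable-stable; from-yes; _→-dec_; _×-dec_; ¬?; True; toWitness)
open import Relation.Binary.PropositionalEquality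
open import Relation.Binary.Definitions using (tri<; tri≈; tri>)
import Data.List.Membership.DecPropositional as Dec∈
import Data.Fin.Subset.Properties as Sₚ
import Data.Vec as Vec
open import Algebra.Bundles using (AbelianGroup)
import Algebra.Properties.AbelianGroup as AbGroup
open import Level using (0ℓ)
open import Data.List.Membership.Setoid.Properties using (index-injective)
open import Data.Maybe.Properties using (just-injective)
open import Data.Nat.Tactic.RingSolver using (solve-∀)

-- Covers of sparse predicates

-- The Klein four-group is what keeps the free choices alive. An auxiliary vertex has to avoid the
-- parts of two vertices and of their partners, an auxiliary colour has to avoid two types besides
-- `o`, and one part or type is always left. Prescribing it discards about 3/4 of all candidates, so
-- about a quarter remains for the other requirements.
--
-- These others are paid for by averaging twice. With r = ⌊m / B⌋ only O(n r) pairs (vertex, colour)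
-- are ever disturbed. If T² exceeds this number, all but T vertices and all but T colours lie in
-- fewer than T disturbed pairs; then only O(n T) pairs (vertex, colour) fail to have enough usable
-- 4-cycles. If U² exceeds this second number, every colour outside a set of size U fails at no more
-- than U vertices. Two square roots are lost on the way, and since U must stay far below n this
-- decides how large B has to be. Each alteration recolours a fixed number of ordered pairs, so the
-- same thresholds serve until the end.

infix 4 _∈?_
_∈?_ : ∀ {n} (i : Fin n) (xs : List (Fin n)) → Dec (i ∈ˡ xs)
_∈?_ = Dec∈._∈?_ F._≟_

record Cover {n : ℕ} (b : ℕ) (P : Fin n → Set) : Set where
  constructor cover
  field
    elems : List (Fin n)
    bound : length elems ≤ b
    covers : ∀ {i} → P i → i ∈ˡ elems

Cover-mono : ∀ {n a b} {P Q : Fin n → Set} → a ≤ b → (∀ {i} → Q i → P i) → Cover a P → Cover b Q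
Cover-mono a≤b Q⇒P (cover xs l c) = cover xs (ℕₚ.≤-trans l a≤b) (c ∘ Q⇒P)

Cover-⊎ : ∀ {n a b} {P Q : Fin n → Set} → Cover a P → Cover b Q → Cover (a + b) (λ i → P i ⊎ Q i)
Cover-⊎ {a = a} {b} (cover xs l c) (cover ys m d) = cover (xs ++ ys)
  (subst (_≤ a + b) (sym (Lₚ.length-++ xs)) (ℕₚ.+-mono-≤ l m))
  [ Mₚ.∈-++⁺ˡ ∘ c , Mₚ.∈-++⁺ʳ xs ∘ d ]′

Cover-image : ∀ {n k b} {P : Fin n → Set} {Q : Fin k → Set} (g : Fin n → Fin k) →
  (∀ {j} → Q j → ∃ λ i → P i × g i ≡ j) → Cover b P → Cover b Q
Cover-image {b = b} g h (cover xs l c) = cover (map g xs)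
  (subst (_≤ b) (sym (Lₚ.length-map g xs)) l)
  λ q → let (i , p , e) = h q in subst (_∈ˡ map g xs) e (Mₚ.∈-map⁺ g (c p))

Cover-≡ : ∀ {n} (v : Fin n) → Cover 1 (_≡ v)
Cover-≡ v = cover (v ∷ []) (s≤s z≤n) here

Cover-list : ∀ {n} (xs : List (Fin n)) → Cover (length xs) (_∈ˡ xs)
Cover-list xs = cover xs ℕₚ.≤-refl id

Cover-⊥ : ∀ {n b} → Cover {n} b (λ _ → ⊥)
Cover-⊥ = cover [] z≤n ⊥-elim

-- Pigeonhole: the position in the list determines the element, so `index` embeds `Fin n` into the
-- positions.
covering-list-long : ∀ {n} (xs : List (Fin n)) → (∀ i → i ∈ˡ xs) → n ≤ length xs
covering-list-long xs all∈ = Fₚ.injective⇒≤ {f = λ i → index (all∈ i)} inj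
  where
  inj : ∀ {i j} → index (all∈ i) ≡ index (all∈ j) → i ≡ j
  inj {i} {j} e = index-injective (setoid _) (all∈ i) (all∈ j) e

missing : ∀ {n} (xs : List (Fin n)) → length xs < n → ∃ λ i → i ∉ˡ xs
missing {n} xs l = Fₚ.¬∀⟶∃¬ n (_∈ˡ xs) (_∈? xs)
  λ h → ℕₚ.<⇒≱ l (covering-list-long xs h)

AvoidsAll : ∀ {n} → List (Fin n → Set) → Fin n → Set
AvoidsAll [] i = ⊤
AvoidsAll (P ∷ Ps) i = ¬ P i × AvoidsAll Ps i

Cover-All : ∀ {n b} {Ps : List (Fin n → Set)} → All (Cover b) Ps →
  ∃ λ xs → length xs ≤ length Ps * b × (∀ {i} → i ∉ˡ xs → AvoidsAll Ps i)
Cover-All [] = [] , z≤n , λ _ → tt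
Cover-All {b = b} {Ps = P ∷ Ps} (cover xs l c ∷ cs) with Cover-All cs
... | ys , m , d = xs ++ ys
  , subst (_≤ b + length Ps * b) (sym (Lₚ.length-++ xs)) (ℕₚ.+-mono-≤ l m)
  , λ i∉ → (λ p → i∉ (Mₚ.∈-++⁺ˡ (c p))) , d (λ i∈ → i∉ (Mₚ.∈-++⁺ʳ xs i∈))

-- The union bound behind every free choice. Two scales are kept apart: a `big` condition excludes a
-- whole part or type, a `small` one only exceptional values.
avoid : ∀ {n k U} {big small : List (Fin n → Set)} → All (Cover k) big → All (Cover U) small →
  length big * k + length small * U < n →
  ∃ λ i → AvoidsAll big i × AvoidsAll small i
avoid {n} cs ds l with Cover-All cs | Cover-All ds
... | xs , lx , fx | ys , ly , fy =
  let i , i∉ = missing (xs ++ ys) (ℕₚ.≤-<-trans (subst (_≤ _) (sym (Lₚ.length-++ xs)) (ℕₚ.+-mono-≤ lx ly)) l)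
  in i , fx (i∉ ∘ Mₚ.∈-++⁺ˡ) , fy (i∉ ∘ Mₚ.∈-++⁺ʳ xs)

-- Averaging over lists of keyed entries

module _ {A : Set} {n : ℕ} where

  withKey : Fin n → List (A × Fin n) → List A
  withKey c [] = []
  withKey c ((a , d) ∷ zs) with d F.≟ c
  ... | yes _ = a ∷ withKey c zs
  ... | no _ = withKey c zs

  withoutKey : Fin n → List (A × Fin n) → List (A × Fin n)
  withoutKey c [] = []
  withoutKey c ((a , d) ∷ zs) with d F.≟ c
  ... | yes _ = withoutKey c zs
  ... | no _ = (a , d) ∷ withoutKey c zs

  length-split : ∀ c zs → length (withKey c zs) + length (withoutKey c zs) ≡ length zs
  length-split c [] = refl
  length-split c ((a , d) ∷ zs) with d F.≟ c
  ... | yes _ = cong suc (length-split c zs)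
  ... | no _ = trans (ℕₚ.+-suc _ _) (cong suc (length-split c zs))

  ∈-withKey : ∀ {a c} zs → (a , c) ∈ˡ zs → a ∈ˡ withKey c zs
  ∈-withKey {a} {c} ((b , d) ∷ zs) z∈ with d F.≟ c | z∈
  ... | yes _ | here refl = here refl
  ... | yes _ | there z = there (∈-withKey zs z)
  ... | no d≢c | here refl = ⊥-elim (d≢c refl)
  ... | no _ | there z = ∈-withKey zs z

  ∈-withoutKey : ∀ {a c e} zs → e ≢ c → (a , e) ∈ˡ zs → (a , e) ∈ˡ withoutKey c zs
  ∈-withoutKey {a} {c} ((b , d) ∷ zs) e≢c z∈ with d F.≟ c | z∈
  ... | yes d≡c | here refl = ⊥-elim (e≢c d≡c)
  ... | yes _ | there z = ∈-withoutKey zs e≢c z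
  ... | no _ | here refl = here refl
  ... | no _ | there z = there (∈-withoutKey zs e≢c z)

  private
    -- The entries of a treated key are removed before going on, so different bad keys are charged
    -- to disjoint blocks of at least `T` entries.
    heavy-among : (T : ℕ) (cs : List (Fin n)) (zs : List (A × Fin n)) → ∃ λ (bad : List (Fin n)) →
      length bad * T ≤ length zs ×
      (∀ c → c ∈ˡ cs → c ∉ˡ bad → ∃ λ (as : List A) → length as ≤ T × (∀ {a} → (a , c) ∈ˡ zs → a ∈ˡ as))
    heavy-among T [] zs = [] , z≤n , λ _ ()
    heavy-among T (d ∷ cs) zs with T ℕ.≤? length (withKey d zs) | heavy-among T cs (withoutKey d zs)
    ... | yes T≤ | bad , l , h = d ∷ bad
      , ℕₚ.≤-trans (ℕₚ.+-mono-≤ T≤ l) (ℕₚ.≤-reflexive (length-split d zs))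
      , λ { c (here refl) c∉ → ⊥-elim (c∉ (here refl))
          ; c (there c∈) c∉ → let (as , la , ha) = h c c∈ (c∉ ∘ there)
              in as , la , λ z∈ → ha (∈-withoutKey zs (λ c≡d → c∉ (here c≡d)) z∈) }
    ... | no T≰ | bad , l , h = bad
      , ℕₚ.≤-trans l (subst (length (withoutKey d zs) ≤_) (length-split d zs) (ℕₚ.m≤n+m _ _))
      , g
      where
      g : ∀ c → c ∈ˡ (d ∷ cs) → c ∉ˡ bad → ∃ λ (as : List A) → length as ≤ T × (∀ {a} → (a , c) ∈ˡ zs → a ∈ˡ as)
      g c c∈ c∉ with c F.≟ d | c∈
      ... | yes refl | _ = withKey d zs , ℕₚ.<⇒≤ (ℕₚ.≰⇒> T≰) , ∈-withKey zs
      ... | no c≢d | here c≡d = ⊥-elim (c≢d c≡d)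
      ... | no c≢d | there c∈' = let (as , la , ha) = h c c∈' c∉ in as , la , λ z∈ → ha (∈-withoutKey zs c≢d z∈)

  -- Markov's inequality. A key that is not bad comes with a short list of its entries, ready to
  -- serve as a `Cover`.
  heavy-keys : (T : ℕ) (zs : List (A × Fin n)) → ∃ λ (bad : List (Fin n)) →
    length bad * T ≤ length zs ×
    (∀ c → c ∉ˡ bad → ∃ λ (as : List A) → length as ≤ T × (∀ {a} → (a , c) ∈ˡ zs → a ∈ˡ as))
  heavy-keys T zs = let (bad , l , h) = heavy-among T (allFin n) zs in bad , l , λ c → h c (Mₚ.∈-allFin c)

-- 1-factorizations and Kempe changes

-- A 1-factorization of the complete graph; `nb` holds its perfect matchings as data, so that a
-- colour can be followed without a search. The diagonal values `f u u` are arbitrary, whence the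
-- inequalities of vertices carried along everywhere.
record Col (n m : ℕ) : Set where
  field
    f : Fin n → Fin n → Fin m
    nb : Fin m → Fin n → Fin n
    f-sym : ∀ u v → f u v ≡ f v u
    f-nb : ∀ c u → f u (nb c u) ≡ c
    nb-≢ : ∀ c u → nb c u ≢ u
    nb-f : ∀ u v → u ≢ v → nb (f u v) u ≡ v

  nb-unique : ∀ {u v c} → u ≢ v → f u v ≡ c → nb c u ≡ v
  nb-unique {u} {v} u≢v refl = nb-f u v u≢v

  nb-nb : ∀ c u → nb c (nb c u) ≡ u
  nb-nb c u = nb-unique (nb-≢ c u) (trans (f-sym _ _) (f-nb c u))

  f-inj : ∀ {u v w} → u ≢ v → u ≢ w → f u v ≡ f u w → v ≡ w
  f-inj u≢v u≢w e = trans (sym (nb-unique u≢v e)) (nb-f _ _ u≢w)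

module Kempe {n m : ℕ} (K : Col n m) (c h : Fin m) (S : List (Fin n))
  (closed-c : ∀ {u} → u ∈ˡ S → Col.nb K c u ∈ˡ S) (closed-h : ∀ {u} → u ∈ˡ S → Col.nb K h u ∈ˡ S) where
  open Col K

  τ : Fin m → Fin m
  τ x with x F.≟ c | x F.≟ h
  ... | yes _ | _ = h
  ... | no _ | yes _ = c
  ... | no _ | no _ = x

  τ-c : τ c ≡ h
  τ-c with c F.≟ c | c F.≟ h
  ... | yes _ | _ = refl
  ... | no ¬p | _ = ⊥-elim (¬p refl)

  τ-h : τ h ≡ c
  τ-h with h F.≟ c | h F.≟ h
  ... | yes h≡c | _ = h≡c
  ... | no _ | yes _ = refl
  ... | no _ | no ¬p = ⊥-elim (¬p refl)

  τ-other : ∀ {x} → x ≢ c → x ≢ h → τ x ≡ x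
  τ-other {x} x≢c x≢h with x F.≟ c | x F.≟ h
  ... | yes e | _ = ⊥-elim (x≢c e)
  ... | no _ | yes e = ⊥-elim (x≢h e)
  ... | no _ | no _ = refl

  ττ : ∀ x → τ (τ x) ≡ x
  ττ x with x F.≟ c | x F.≟ h
  ... | yes e | _ = trans τ-h (sym e)
  ... | no _ | yes e = trans τ-c (sym e)
  ... | no p | no q = τ-other p q

  -- An edge leaving `S` has neither colour because `S` is closed under both matchings. Hence
  -- recolouring only the edges inside `S` amounts to applying `τ` to all edges that meet `S`, and
  -- every vertex still sees each colour once.
  τ-leaves : ∀ {u v} → u ∈ˡ S → v ∉ˡ S → u ≢ v → τ (f u v) ≡ f u v
  τ-leaves {u} {v} u∈ v∉ u≢v = τ-other
    (λ e → v∉ (subst (_∈ˡ S) (nb-unique u≢v e) (closed-c u∈)))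
    (λ e → v∉ (subst (_∈ˡ S) (nb-unique u≢v e) (closed-h u∈)))

  f′ : Fin n → Fin n → Fin m
  f′ u v with u ∈? S | v ∈? S
  ... | yes _ | yes _ = τ (f u v)
  ... | yes _ | no _ = f u v
  ... | no _ | _ = f u v

  nb′ : Fin m → Fin n → Fin n
  nb′ x u with u ∈? S
  ... | yes _ = nb (τ x) u
  ... | no _ = nb x u

  f′-in : ∀ {u v} → u ∈ˡ S → v ∈ˡ S → f′ u v ≡ τ (f u v)
  f′-in {u} {v} u∈ v∈ with u ∈? S | v ∈? S
  ... | yes _ | yes _ = refl
  ... | yes _ | no v∉ = ⊥-elim (v∉ v∈)
  ... | no u∉ | _ = ⊥-elim (u∉ u∈)

  f′-out : ∀ {u v} → u ∉ˡ S → f′ u v ≡ f u v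
  f′-out {u} {v} u∉ with u ∈? S | v ∈? S
  ... | yes u∈ | _ = ⊥-elim (u∉ u∈)
  ... | no _ | _ = refl

  f′-sym : ∀ u v → f′ u v ≡ f′ v u
  f′-sym u v with u ∈? S | v ∈? S
  ... | yes _ | yes _ = cong τ (f-sym u v)
  ... | yes _ | no _ = f-sym u v
  ... | no _ | yes _ = f-sym u v
  ... | no _ | no _ = f-sym u v

  nb-in : ∀ x {u} → u ∈ˡ S → nb x u ∈ˡ S ⊎ τ x ≡ x
  nb-in x {u} u∈ with nb x u ∈? S
  ... | yes v∈ = inj₁ v∈
  ... | no v∉ = inj₂ (subst (λ y → τ y ≡ y) (f-nb x u) (τ-leaves u∈ v∉ (nb-≢ x u ∘ sym)))

  f′-nb′ : ∀ x u → f′ u (nb′ x u) ≡ x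
  f′-nb′ x u with u ∈? S
  ... | no _ = f-nb x u
  ... | yes u∈ with nb (τ x) u ∈? S
  ...   | yes _ = trans (cong τ (f-nb (τ x) u)) (ττ x)
  ...   | no v∉ with nb-in (τ x) u∈
  ...     | inj₁ v∈ = ⊥-elim (v∉ v∈)
  ...     | inj₂ e = trans (f-nb (τ x) u) (trans (sym e) (ττ x))

  nb′-≢ : ∀ x u → nb′ x u ≢ u
  nb′-≢ x u with u ∈? S
  ... | yes _ = nb-≢ (τ x) u
  ... | no _ = nb-≢ x u

  nb′-f′ : ∀ u v → u ≢ v → nb′ (f′ u v) u ≡ v
  nb′-f′ u v u≢v with u ∈? S
  ... | no _ = nb-f u v u≢v
  ... | yes u∈ with v ∈? S
  ...   | yes _ = trans (cong (λ x → nb x u) (ττ (f u v))) (nb-f u v u≢v)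
  ...   | no v∉ = trans (cong (λ x → nb x u) (τ-leaves u∈ v∉ u≢v)) (nb-f u v u≢v)

  f′-changed : ∀ {u v} → f′ u v ≢ f u v → u ∈ˡ S × v ∈ˡ S × (f u v ≡ c ⊎ f u v ≡ h)
  f′-changed {u} {v} d with u ∈? S | v ∈? S
  ... | no _ | _ = ⊥-elim (d refl)
  ... | yes _ | no _ = ⊥-elim (d refl)
  ... | yes u∈ | yes v∈ with f u v F.≟ c | f u v F.≟ h
  ...   | yes e | _ = u∈ , v∈ , inj₁ e
  ...   | no _ | yes e = u∈ , v∈ , inj₂ e
  ...   | no p | no q = ⊥-elim (d refl)

  K′ : Col n m
  K′ = record { f = f′ ; nb = nb′ ; f-sym = f′-sym ; f-nb = f′-nb′ ; nb-≢ = nb′-≢ ; nb-f = nb′-f′ }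

open Col

-- Recolouring steps and swaps on two-coloured 4-cycles

Forbid : ℕ → ℕ → Set₁
Forbid n m = Fin n → Fin n → Fin m → Set

record Symm {n m} (X : Forbid n m) : Set where
  field
    flip : ∀ {u v c} → X u v c → X v u c
open Symm

-- Only newly placed colours have to be allowed; an untouched edge may keep a forbidden one. One
-- relation thus serves both to protect an edge, by forbidding it all colours, and to avoid lists
-- without creating conflicts. `ch` collects ordered pairs, eight for each 4-cycle.
record Step {n m} (X : Forbid n m) (ch : List (Fin n × Fin n)) (K K′ : Col n m) : Set where
  constructor mkStep
  field
    at : ∀ u v → u ≢ v → f K′ u v ≡ f K u v ⊎ ((u , v) ∈ˡ ch × ¬ X u v (f K′ u v))

Step-refl : ∀ {n m} {X : Forbid n m} {ch} {K : Col n m} → Step X ch K K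
Step-refl = mkStep λ u v _ → inj₁ refl

Step-trans : ∀ {n m} {X : Forbid n m} {ch ch′} {K K′ K″ : Col n m} →
  Step X ch K K′ → Step X ch′ K′ K″ → Step X (ch ++ ch′) K K″
Step-trans {X = X} {ch} {ch′} {K} {K′} {K″} (mkStep s) (mkStep t) = mkStep λ u v u≢v → join (t u v u≢v) (s u v u≢v)
  where
  join : ∀ {u v} → f K″ u v ≡ f K′ u v ⊎ ((u , v) ∈ˡ ch′ × ¬ X u v (f K″ u v)) →
    f K′ u v ≡ f K u v ⊎ ((u , v) ∈ˡ ch × ¬ X u v (f K′ u v)) →
    f K″ u v ≡ f K u v ⊎ ((u , v) ∈ˡ ch ++ ch′ × ¬ X u v (f K″ u v))
  join (inj₂ (c∈ , ok)) _ = inj₂ (Mₚ.∈-++⁺ʳ ch c∈ , ok)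
  join (inj₁ e) (inj₁ e′) = inj₁ (trans e e′)
  join {u} {v} (inj₁ e) (inj₂ (c∈ , ok)) = inj₂ (Mₚ.∈-++⁺ˡ c∈ , λ x → ok (subst (X u v) e x))

Step-mono : ∀ {n m} {X Y : Forbid n m} {ch} {K K′ : Col n m} →
  (∀ {u v c} → Y u v c → X u v c) → Step X ch K K′ → Step Y ch K K′
Step-mono {X = X} {Y} Y⇒X (mkStep s) = mkStep λ u v u≢v →
  [ inj₁ , (λ (c∈ , ok) → inj₂ (c∈ , λ y → ok (Y⇒X y))) ]′ (s u v u≢v)

cycle : ∀ {n} → (a b q p : Fin n) → List (Fin n × Fin n)
cycle a b q p = (a , b) ∷ (b , a) ∷ (b , q) ∷ (q , b) ∷ (q , p) ∷ (p , q) ∷ (p , a) ∷ (a , p) ∷ []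

record Swapped {n m} (K : Col n m) (X : Forbid n m) (c h : Fin m) (a b q p : Fin n) : Set where
  field
    K⁺ : Col n m
    ab : f K⁺ a b ≡ h
    bq : f K⁺ b q ≡ c
    qp : f K⁺ q p ≡ h
    pa : f K⁺ p a ≡ c
    step : Step X (cycle a b q p) K K⁺
    colour : ∀ {u v} → f K u v ≢ c → f K u v ≢ h → f K⁺ u v ≡ f K u v
    vertex : ∀ {u v} → u ≢ a → u ≢ b → u ≢ q → u ≢ p → f K⁺ u v ≡ f K u v

record Square {n m} (K : Col n m) (X : Forbid n m) (c h : Fin m) (a b q p : Fin n) : Set where
  field
    a≢b : a ≢ b
    b≢q : b ≢ q
    q≢p : q ≢ p
    p≢a : p ≢ a
    c≢h : c ≢ h
    ab : f K a b ≡ c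
    bq : f K b q ≡ h
    qp : f K q p ≡ c
    pa : f K p a ≡ h
    Xab : ¬ X a b h
    Xbq : ¬ X b q c
    Xqp : ¬ X q p h
    Xpa : ¬ X p a c

Square-mono : ∀ {n m} {K K′ : Col n m} {X c h a b q p} → Square K X c h a b q p →
  (∀ {u v} → f K u v ≡ c → f K′ u v ≡ c) → (∀ {u v} → f K u v ≡ h → f K′ u v ≡ h) → Square K′ X c h a b q p
Square-mono s keep-c keep-h = record
  { a≢b = a≢b ; b≢q = b≢q ; q≢p = q≢p ; p≢a = p≢a ; c≢h = c≢h
  ; ab = keep-c ab ; bq = keep-h bq ; qp = keep-c qp ; pa = keep-h pa
  ; Xab = Xab ; Xbq = Xbq ; Xqp = Xqp ; Xpa = Xpa }
  where open Square s

opaque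
  swap : ∀ {n m} {K : Col n m} {X : Forbid n m} → Symm X → ∀ {c h a b q p} →
    Square K X c h a b q p → Swapped K X c h a b q p
  swap {n} {m} {K} {X} X-sym {c} {h} {a} {b} {q} {p} square = record
    { K⁺ = K′
    ; ab = to-h a∈ b∈ ab
    ; bq = to-c b∈ q∈ bq
    ; qp = to-h q∈ p∈ qp
    ; pa = to-c p∈ a∈ pa
    ; step = mkStep λ u v u≢v → decide u v u≢v (f′ u v F.≟ f K u v)
    ; colour = λ {u} {v} ≢c ≢h → decidable-stable (f′ u v F.≟ f K u v)
        λ d → [ ≢c , ≢h ]′ (proj₂ (proj₂ (f′-changed d)))
    ; vertex = λ ua ub uq up → f′-out λ { (here e) → ua e ; (there (here e)) → ub e
        ; (there (there (here e))) → uq e ; (there (there (there (here e)))) → up e }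
    }
    where
    open Square square
    S : List (Fin n)
    S = a ∷ b ∷ q ∷ p ∷ []
    a∈ : a ∈ˡ S
    a∈ = here refl
    b∈ : b ∈ˡ S
    b∈ = there (here refl)
    q∈ : q ∈ˡ S
    q∈ = there (there (here refl))
    p∈ : p ∈ˡ S
    p∈ = there (there (there (here refl)))
    ba : f K b a ≡ c
    ba = trans (f-sym K _ _) ab
    qb : f K q b ≡ h
    qb = trans (f-sym K _ _) bq
    pq : f K p q ≡ c
    pq = trans (f-sym K _ _) qp
    ap : f K a p ≡ h
    ap = trans (f-sym K _ _) pa
    nbc : ∀ {u} → u ∈ˡ S → nb K c u ∈ˡ S
    nbc (here refl) = subst (_∈ˡ S) (sym (nb-unique K a≢b ab)) b∈
    nbc (there (here refl)) = subst (_∈ˡ S) (sym (nb-unique K (a≢b ∘ sym) ba)) a∈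
    nbc (there (there (here refl))) = subst (_∈ˡ S) (sym (nb-unique K q≢p qp)) p∈
    nbc (there (there (there (here refl)))) = subst (_∈ˡ S) (sym (nb-unique K (q≢p ∘ sym) pq)) q∈
    nbh : ∀ {u} → u ∈ˡ S → nb K h u ∈ˡ S
    nbh (here refl) = subst (_∈ˡ S) (sym (nb-unique K (p≢a ∘ sym) ap)) p∈
    nbh (there (here refl)) = subst (_∈ˡ S) (sym (nb-unique K b≢q bq)) q∈
    nbh (there (there (here refl))) = subst (_∈ˡ S) (sym (nb-unique K (b≢q ∘ sym) qb)) b∈
    nbh (there (there (there (here refl)))) = subst (_∈ˡ S) (sym (nb-unique K p≢a pa)) a∈
    open Kempe K c h S nbc nbh
    to-h : ∀ {u v} → u ∈ˡ S → v ∈ˡ S → f K u v ≡ c → f′ u v ≡ h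
    to-h u∈ v∈ e = trans (f′-in u∈ v∈) (trans (cong τ e) τ-c)
    to-c : ∀ {u v} → u ∈ˡ S → v ∈ˡ S → f K u v ≡ h → f′ u v ≡ c
    to-c u∈ v∈ e = trans (f′-in u∈ v∈) (trans (cong τ e) τ-h)
    Cyc : List (Fin n × Fin n)
    Cyc = cycle a b q p
    Ok : Fin n → Fin n → Set
    Ok u v = (u , v) ∈ˡ Cyc × ¬ X u v (f′ u v)
    -- At each vertex a colour determines the other end. So the edges of the two colours inside `S`
    -- are just the four of the cycle, and the chords keep their colours.
    same : ∀ {u v w x} → u ≢ v → u ≢ w → f K u v ≡ x → f K u w ≡ x → w ≡ v
    same u≢v u≢w e e′ = sym (f-inj K u≢v u≢w (trans e (sym e′)))
    okc : ∀ u v → u ≢ v → u ∈ˡ S → v ∈ˡ S → f K u v ≡ c → Ok u v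
    okc u v u≢v (here refl) v∈ e with same a≢b u≢v ab e
    ... | refl = here refl , λ x → Xab (subst (X _ _) (to-h a∈ b∈ e) x)
    okc u v u≢v (there (here refl)) v∈ e with same (a≢b ∘ sym) u≢v ba e
    ... | refl = there (here refl) , λ x → Xab (subst (X _ _) (to-h b∈ a∈ e) (flip X-sym x) )
    okc u v u≢v (there (there (here refl))) v∈ e with same q≢p u≢v qp e
    ... | refl = there (there (there (there (here refl)))) , λ x → Xqp (subst (X _ _) (to-h q∈ p∈ e) x)
    okc u v u≢v (there (there (there (here refl)))) v∈ e with same (q≢p ∘ sym) u≢v pq e
    ... | refl = there (there (there (there (there (here refl))))) , λ x → Xqp (subst (X _ _) (to-h p∈ q∈ e) (flip X-sym x))
    okh : ∀ u v → u ≢ v → u ∈ˡ S → v ∈ˡ S → f K u v ≡ h → Ok u v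
    okh u v u≢v (here refl) v∈ e with same (p≢a ∘ sym) u≢v ap e
    ... | refl = there (there (there (there (there (there (there (here refl))))))) , λ x → Xpa (subst (X _ _) (to-c a∈ p∈ e) (flip X-sym x))
    okh u v u≢v (there (here refl)) v∈ e with same b≢q u≢v bq e
    ... | refl = there (there (here refl)) , λ x → Xbq (subst (X _ _) (to-c b∈ q∈ e) x)
    okh u v u≢v (there (there (here refl))) v∈ e with same (b≢q ∘ sym) u≢v qb e
    ... | refl = there (there (there (here refl))) , λ x → Xbq (subst (X _ _) (to-c q∈ b∈ e) (flip X-sym x))
    okh u v u≢v (there (there (there (here refl)))) v∈ e with same p≢a u≢v pa e
    ... | refl = there (there (there (there (there (there (here refl)))))) , λ x → Xpa (subst (X _ _) (to-c p∈ a∈ e) x)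
    decide : ∀ u v → u ≢ v → Dec (f′ u v ≡ f K u v) → f′ u v ≡ f K u v ⊎ Ok u v
    decide u v u≢v (yes e) = inj₁ e
    decide u v u≢v (no d) with f′-changed d
    ... | u∈ , v∈ , inj₁ e = inj₂ (okc u v u≢v u∈ v∈ e)
    ... | u∈ , v∈ , inj₂ e = inj₂ (okh u v u≢v u∈ v∈ e)

-- The reference pattern

Ty : Set
Ty = Fin 4

pattern o = fzero
pattern i₁ = fsuc fzero
pattern i₂ = fsuc (fsuc fzero)
pattern i₃ = fsuc (fsuc (fsuc fzero))

infixl 6 _⊕_
_⊕_ : Ty → Ty → Ty
o ⊕ y = y
i₁ ⊕ o = i₁
i₁ ⊕ i₁ = o
i₁ ⊕ i₂ = i₃
i₁ ⊕ i₃ = i₂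
i₂ ⊕ o = i₂
i₂ ⊕ i₁ = i₃
i₂ ⊕ i₂ = o
i₂ ⊕ i₃ = i₁
i₃ ⊕ o = i₃
i₃ ⊕ i₁ = i₂
i₃ ⊕ i₂ = i₁
i₃ ⊕ i₃ = o

⊕-fixed : ∀ A x → A ⊕ x ≡ A → x ≡ o
⊕-fixed = from-yes (Fₚ.all? λ A → Fₚ.all? λ x → (A ⊕ x F.≟ A) →-dec (x F.≟ o))

⊕-self : ∀ A B → A ⊕ B ≡ o → A ≡ B
⊕-self = from-yes (Fₚ.all? λ A → Fₚ.all? λ B → (A ⊕ B F.≟ o) →-dec (A F.≟ B))

⊕-shift : ∀ A B x → A ⊕ B ≡ x → B ≡ A ⊕ x
⊕-shift = from-yes (Fₚ.all? λ A → Fₚ.all? λ B → Fₚ.all? λ x → (A ⊕ B F.≟ x) →-dec (B F.≟ A ⊕ x))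

third-type : ∀ (x y : Ty) → ∃ λ (z : Ty) → z ≢ o × z ≢ x × z ≢ y
third-type = from-yes (Fₚ.all? λ (x : Ty) → Fₚ.all? λ (y : Ty) → Fₚ.any? λ (z : Ty) →
  ¬? (z F.≟ o) ×-dec ¬? (z F.≟ x) ×-dec ¬? (z F.≟ y))

-- Because `x ≢ y`, two of the four excluded parts always coincide; with `x ≡ y` and `B` different
-- from `A` and `A ⊕ x` they would be all four. This is why two colours to be exchanged are given
-- different types.
fourth-part : ∀ (A B x y : Ty) → x ≢ o → y ≢ o → x ≢ y →
  ∃ λ (z : Ty) → z ≢ A × z ≢ B × z ≢ A ⊕ x × z ≢ B ⊕ y
fourth-part = from-yes (Fₚ.all? λ A → Fₚ.all? λ B → Fₚ.all? λ x → Fₚ.all? λ y →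
  ¬? (x F.≟ o) →-dec (¬? (y F.≟ o) →-dec (¬? (x F.≟ y) →-dec
  (Fₚ.any? λ z → ¬? (z F.≟ A) ×-dec ¬? (z F.≟ B) ×-dec ¬? (z F.≟ A ⊕ x) ×-dec ¬? (z F.≟ B ⊕ y)))))

-- A pattern on most of K_n. Parts and types are elements of the Klein four-group: a colour of type r ≢ o
-- joins part A to part A ⊕ r, and two colours of different types ≢ o form 4-cycles only. Nothing is known
-- about the colours of type o, the vertices without part, and the values of nb₀ and f₀ at these.
record Ref (n m κ ε : ℕ) : Set where
  field
    pt : Fin n → Maybe Ty
    ty : Fin m → Ty
    nb₀ : Fin m → Fin n → Fin n
    f₀ : Fin n → Fin n → Fin m
    pt-nb₀ : ∀ {a A c} → pt a ≡ just A → ty c ≢ o → pt (nb₀ c a) ≡ just (A ⊕ ty c)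
    nb₀-nb₀ : ∀ {a A c} → pt a ≡ just A → ty c ≢ o → nb₀ c (nb₀ c a) ≡ a
    nb₀-comm : ∀ {a A c h} → pt a ≡ just A → ty c ≢ o → ty h ≢ o → ty h ≢ ty c →
      nb₀ h (nb₀ c a) ≡ nb₀ c (nb₀ h a)
    nb₀-f₀ : ∀ {a b A B} → pt a ≡ just A → pt b ≡ just B → B ≢ A → nb₀ (f₀ a b) a ≡ b
    ty-f₀ : ∀ {a b A B} → pt a ≡ just A → pt b ≡ just B → B ≢ A → ty (f₀ a b) ≡ A ⊕ B
    f₀-nb₀ : ∀ {a A c} → pt a ≡ just A → ty c ≢ o → f₀ a (nb₀ c a) ≡ c
    pt-cover : ∀ A → Cover κ (λ v → pt v ≡ just A)
    ∞-cover : Cover ε (λ v → pt v ≡ nothing)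
    ty-cover : ∀ r → Cover κ (λ c → ty c ≡ r)

  part : ∀ v → pt v ≢ nothing → ∃ λ A → pt v ≡ just A
  part v ≢n with pt v
  ... | just A = A , refl
  ... | nothing = ⊥-elim (≢n refl)

module Structure {n m κ ε : ℕ} (R : Ref n m κ ε) where
  open Ref R

  nb₀-≢ : ∀ {a A c} → pt a ≡ just A → ty c ≢ o → a ≢ nb₀ c a
  nb₀-≢ {a} {A} {c} pa tc e = tc (⊕-fixed A (ty c) (just-injective
    (trans (sym (pt-nb₀ pa tc)) (trans (sym (cong pt e)) pa))))

  just≢nothing : ∀ {v A} → pt v ≡ just A → pt v ≢ nothing
  just≢nothing e e′ with trans (sym e) e′
  ... | ()

  -- Each field from Wa on bounds the number of colours h for which one particular defect spoils the
  -- two-coloured 4-cycle a, b, nb₀ h b, nb₀ h a; obstructions adds them up.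
  record Good (K : Col n m) (X : Forbid n m) (τ : ℕ) (a : Fin n) (c : Fin m) : Set where
    b : Fin n
    b = nb₀ c a
    field
      {A} : Ty
      pa : pt a ≡ just A
      tc : ty c ≢ o
      edge : f K a b ≡ c
      Wa : Cover τ λ h → ty h ≢ o × f K a (nb₀ h a) ≢ h
      Wb : Cover τ λ h → ty h ≢ o × f K b (nb₀ h b) ≢ h
      Wc : Cover τ λ v → pt v ≢ nothing × f K v (nb₀ c v) ≢ c
      Z : Cover τ λ h → ty h ≢ o × ty h ≢ ty c × X (nb₀ h a) (nb₀ h b) h
      E : Cover τ (X a b)
      Va : Cover τ λ v → X a v c
      Vb : Cover τ λ v → X b v c

    pb : pt b ≡ just (A ⊕ ty c)
    pb = pt-nb₀ pa tc

    Obstruction : Fin m → Set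
    Obstruction h = ty h ≢ o × ty h ≢ ty c ×
      ( f K a (nb₀ h a) ≢ h
      ⊎ f K b (nb₀ h b) ≢ h
      ⊎ f K (nb₀ h a) (nb₀ c (nb₀ h a)) ≢ c
      ⊎ X (nb₀ h a) (nb₀ h b) h
      ⊎ X a b h
      ⊎ X a (nb₀ h a) c
      ⊎ X b (nb₀ h b) c )

    obstructions : Cover (7 * τ) Obstruction
    obstructions = Cover-mono (ℕₚ.≤-reflexive refl-len) split
      (Cover-⊎ Wa (Cover-⊎ Wb (Cover-⊎ Wc′ (Cover-⊎ Z (Cover-⊎ E (Cover-⊎ Va′ Vb′))))))
      where
      refl-len : τ + (τ + (τ + (τ + (τ + (τ + τ))))) ≡ 7 * τ
      refl-len = cong (λ x → τ + (τ + (τ + (τ + (τ + (τ + x)))))) (sym (ℕₚ.+-identityʳ τ))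
      Wc′ : Cover τ λ h → ty h ≢ o × f K (nb₀ h a) (nb₀ c (nb₀ h a)) ≢ c
      Wc′ = Cover-image (f₀ a) (λ {h} (th , d) → nb₀ h a , (just≢nothing (pt-nb₀ pa th) , d) , f₀-nb₀ pa th) Wc
      Va′ : Cover τ λ h → ty h ≢ o × X a (nb₀ h a) c
      Va′ = Cover-image (f₀ a) (λ {h} (th , x) → nb₀ h a , x , f₀-nb₀ pa th) Va
      Vb′ : Cover τ λ h → ty h ≢ o × X b (nb₀ h b) c
      Vb′ = Cover-image (f₀ b) (λ {h} (th , x) → nb₀ h b , x , f₀-nb₀ pb th) Vb
      split : ∀ {h} → Obstruction h → _
      split (th , _ , inj₁ x) = inj₁ (th , x)
      split (th , _ , inj₂ (inj₁ x)) = inj₂ (inj₁ (th , x))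
      split (th , _ , inj₂ (inj₂ (inj₁ x))) = inj₂ (inj₂ (inj₁ (th , x)))
      split (th , h≢c , inj₂ (inj₂ (inj₂ (inj₁ x)))) = inj₂ (inj₂ (inj₂ (inj₁ (th , h≢c , x))))
      split (th , _ , inj₂ (inj₂ (inj₂ (inj₂ (inj₁ x))))) = inj₂ (inj₂ (inj₂ (inj₂ (inj₁ x))))
      split (th , _ , inj₂ (inj₂ (inj₂ (inj₂ (inj₂ (inj₁ x)))))) = inj₂ (inj₂ (inj₂ (inj₂ (inj₂ (inj₁ (th , x))))))
      split (th , _ , inj₂ (inj₂ (inj₂ (inj₂ (inj₂ (inj₂ x)))))) = inj₂ (inj₂ (inj₂ (inj₂ (inj₂ (inj₂ (th , x))))))

    square : Symm X → ∀ {h} → ty h ≢ o → ty h ≢ ty c → ¬ Obstruction h →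
      Square K X c h a b (nb₀ h b) (nb₀ h a)
    square X-sym {h} th h≢c ok = record
      { a≢b = nb₀-≢ pa tc ; b≢q = nb₀-≢ pb th ; q≢p = q≢p ; p≢a = nb₀-≢ pa th ∘ sym
      ; c≢h = λ e → h≢c (cong ty (sym e))
      ; ab = edge
      ; bq = stable λ x → ok′ (inj₂ (inj₁ x))
      ; qp = trans (f-sym K _ _) (trans (cong (f K p) q≡) (stable λ x → ok′ (inj₂ (inj₂ (inj₁ x)))))
      ; pa = trans (f-sym K _ _) (stable λ x → ok′ (inj₁ x))
      ; Xab = λ x → ok′ (inj₂ (inj₂ (inj₂ (inj₂ (inj₁ x)))))
      ; Xbq = λ x → ok′ (inj₂ (inj₂ (inj₂ (inj₂ (inj₂ (inj₂ x))))))
      ; Xqp = λ x → ok′ (inj₂ (inj₂ (inj₂ (inj₁ (flip X-sym x)))))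
      ; Xpa = λ x → ok′ (inj₂ (inj₂ (inj₂ (inj₂ (inj₂ (inj₁ (flip X-sym x)))))))
      }
      where
      p : Fin n
      p = nb₀ h a
      q≡ : nb₀ h b ≡ nb₀ c p
      q≡ = nb₀-comm pa tc th h≢c
      q≢p : nb₀ h b ≢ p
      q≢p e = nb₀-≢ (pt-nb₀ pa th) tc (trans (sym e) q≡)
      ok′ : ¬ _
      ok′ x = ok (th , h≢c , x)
      stable : ∀ {x y : Fin m} → ¬ (x ≢ y) → x ≡ y
      stable = decidable-stable (_ F.≟ _)

  -- Each recoloured pair adds at most one value to each of `Wa`, `Wb` and `Wc`, and the other
  -- covers speak of `X` alone. Only the places of the changes matter, so the step may obey another
  -- relation `Y`.
  Good-step : ∀ {K K′ X Y ch τ a c} → Step Y ch K K′ → (G : Good K X τ a c) → f K′ a (nb₀ c a) ≡ c →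
    Good K′ X (τ + length ch) a c
  Good-step {K} {K′} {X} {Y} {ch} {τ} {a} {c} s G e = record
    { pa = pa ; tc = tc ; edge = e
    ; Wa = W pa Wa
    ; Wb = W pb Wb
    ; Wc = Cover-mono ℕₚ.≤-refl splitC (Cover-⊎ Wc firsts)
    ; Z = more Z ; E = more E ; Va = more Va ; Vb = more Vb }
    where
    open Good G
    more : ∀ {j} {P : Fin j → Set} → Cover τ P → Cover (τ + length ch) P
    more = Cover-mono (ℕₚ.m≤m+n τ _) id
    firsts : Cover (length ch) (λ v → ∃ λ w → (v , w) ∈ˡ ch)
    firsts = cover (map proj₁ ch) (ℕₚ.≤-reflexive (Lₚ.length-map proj₁ ch)) (λ (w , ∈ch) → Mₚ.∈-map⁺ proj₁ ∈ch)
    W : ∀ {u B} → pt u ≡ just B → Cover τ (λ h → ty h ≢ o × f K u (nb₀ h u) ≢ h) →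
      Cover (τ + length ch) (λ h → ty h ≢ o × f K′ u (nb₀ h u) ≢ h)
    W {u} pu C = Cover-mono ℕₚ.≤-refl g (Cover-⊎ C
      (cover {P = λ h → ty h ≢ o × (u , nb₀ h u) ∈ˡ ch} (map (f₀ u ∘ proj₂) ch) (ℕₚ.≤-reflexive (Lₚ.length-map _ ch))
        λ (th , ∈ch) → subst (_∈ˡ _) (f₀-nb₀ pu th) (Mₚ.∈-map⁺ (f₀ u ∘ proj₂) ∈ch)))
      where
      g : ∀ {h} → ty h ≢ o × f K′ u (nb₀ h u) ≢ h → _
      g {h} (th , d) with Step.at s u (nb₀ h u) (nb₀-≢ pu th)
      ... | inj₁ eq = inj₁ (th , λ e → d (trans eq e))
      ... | inj₂ (∈ch , _) = inj₂ (th , ∈ch)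
    splitC : ∀ {v} → pt v ≢ nothing × f K′ v (nb₀ c v) ≢ c → _
    splitC {v} (nv , d) with Step.at s v (nb₀ c v) (nb₀-≢ (proj₂ (part v nv)) tc)
    ... | inj₁ eq = inj₁ (nv , λ e → d (trans eq e))
    ... | inj₂ (∈ch , _) = inj₂ (_ , ∈ch)

-- Exchanging two colours at an arbitrary vertex

-- The form in which a part or a type is prescribed: the three others are avoided, at the price of
-- 3κ values.
three-others : ∀ (σ x : Ty) → x ≢ σ ⊕ i₁ → x ≢ σ ⊕ i₂ → x ≢ σ ⊕ i₃ → x ≡ σ
three-others = from-yes (Fₚ.all? λ (σ : Ty) → Fₚ.all? λ (x : Ty) → ¬? (x F.≟ σ ⊕ i₁) →-dec
  (¬? (x F.≟ σ ⊕ i₂) →-dec (¬? (x F.≟ σ ⊕ i₃) →-dec (x F.≟ σ))))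

Kept : ∀ {n m} → Col n m → Col n m → Fin n → Set
Kept K K′ u = ∀ {v} → f K′ u v ≡ f K u v

module Trades {n m κ ε U : ℕ} (R : Ref n m κ ε) (ε≤U : ε ≤ U) (1≤U : 1 ≤ U)
  (n-big : 3 * κ + 60 * U < n) (m-big : 3 * κ + 60 * U < m) where
  open Ref R
  open Structure R public
  open Good using (obstructions; square)

  -- The implicit `True` arguments let evaluation count the conditions of a concrete list. The bound
  -- 60 is generous.
  choose : ∀ {j} {big small : List (Fin j → Set)} → 3 * κ + 60 * U < j →
    {_ : True (length big ℕ.≤? 3)} {_ : True (length small ℕ.≤? 60)} →
    All (Cover κ) big → All (Cover U) small →
    ∃ λ i → AvoidsAll big i × AvoidsAll small i
  choose l {b} {s} cs ds = avoid cs ds (ℕₚ.≤-<-trans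
    (ℕₚ.+-mono-≤ (ℕₚ.*-monoˡ-≤ κ (toWitness b)) (ℕₚ.*-monoˡ-≤ U (toWitness s))) l)

  ∞-small : Cover U (λ v → pt v ≡ nothing)
  ∞-small = Cover-mono ε≤U id ∞-cover

  one : ∀ {j} (v : Fin j) → Cover U (_≡ v)
  one v = Cover-mono 1≤U id (Cover-≡ v)

  outside : ∀ σ → All (Cover κ) ((λ v → pt v ≡ just (σ ⊕ i₁)) ∷ (λ v → pt v ≡ just (σ ⊕ i₂)) ∷ (λ v → pt v ≡ just (σ ⊕ i₃)) ∷ [])
  outside σ = pt-cover _ ∷ pt-cover _ ∷ pt-cover _ ∷ []

  inside : ∀ {σ v} → pt v ≢ nothing → pt v ≢ just (σ ⊕ i₁) → pt v ≢ just (σ ⊕ i₂) → pt v ≢ just (σ ⊕ i₃) → pt v ≡ just σ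
  inside {σ} {v} n₀ n₁ n₂ n₃ with part v n₀
  ... | B , e = trans e (cong just (three-others σ B (λ { refl → n₁ e }) (λ { refl → n₂ e }) (λ { refl → n₃ e })))

  nb-cover : ∀ (K : Col n m) c {b} {P : Fin n → Set} → Cover b P → Cover b (λ v → P (nb K c v))
  nb-cover K c = Cover-image (nb K c) (λ {v} p → nb K c v , p , nb-nb K c v)

  nb₀-cover : ∀ c {b} {P : Fin n → Set} → ty c ≢ o → Cover b P → Cover b (λ v → pt v ≢ nothing × P (nb₀ c v))
  nb₀-cover c tc = Cover-image (nb₀ c) (λ {v} (nv , p) → nb₀ c v , p , nb₀-nb₀ (proj₂ (part v nv)) tc)

  f-cover : ∀ (K : Col n m) u {b} {P : Fin m → Set} → Cover b P → Cover b (λ v → u ≢ v × P (f K u v))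
  f-cover K u = Cover-image (λ c → nb K c u) (λ {v} (u≢v , p) → f K u v , p , nb-f K u v u≢v)

  -- The colours `g` and `d` of two edges at `x` change places. `Γ` and `Φ` name colours and
  -- vertices that stay untouched, so that a second exchange and the closing of a 4-cycle can follow
  -- without interference. The length 24 comes from three swaps.
  record Exchanged (K : Col n m) (X : Forbid n m) (x a a′ : Fin n) (g d : Fin m) (Γ : List (Fin m)) (Φ : List (Fin n)) : Set where
    field
      K⁺ : Col n m
      ch : List (Fin n × Fin n)
      ch-len : length ch ≡ 24
      xa : f K⁺ x a ≡ d
      xa′ : f K⁺ x a′ ≡ g
      step : Step X ch K K⁺
      colour : ∀ {u v} → f K u v ∈ˡ Γ → f K⁺ u v ≡ f K u v
      vertex : ∀ {u} → u ∈ˡ Φ → Kept K K⁺ u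

  module _ {K : Col n m} {X : Forbid n m} (X-sym : Symm X) where

    -- Give a′–s the colour g and s–a the colour d, for a suitable s; then x a′ s a is a 4-cycle
    -- in the colours d, g.
    record ExchangeAt (τ : ℕ) (x a a′ : Fin n) (g d : Fin m) (Γ : List (Fin m)) (Φ : List (Fin n)) : Set where
      field
        G₁ : Good K X τ a′ g
        G₂ : Good K X τ a d
        g≢d : ty g ≢ ty d
        x≢a : x ≢ a
        x≢a′ : x ≢ a′
        xa : f K x a ≡ g
        xa′ : f K x a′ ≡ d
        Xxa : ¬ X x a d
        Xxa′ : ¬ X x a′ g
        g∉Γ : g ∉ˡ Γ
        d∉Γ : d ∉ˡ Γ
        x∉Φ : x ∉ˡ Φ
        a∉Φ : a ∉ˡ Φ
        a′∉Φ : a′ ∉ˡ Φ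
        b₁∉Φ : nb₀ g a′ ∉ˡ Φ
        b₂∉Φ : nb₀ d a ∉ˡ Φ
        {σ} : Ty
        {s} : Fin n
        ps : pt s ≡ just σ
        σ≢A₁ : σ ≢ Good.A G₁
        σ≢A₂ : σ ≢ Good.A G₂
        σ≢B₁ : σ ≢ Good.A G₁ ⊕ ty g
        σ≢B₂ : σ ≢ Good.A G₂ ⊕ ty d
        no₁ : ¬ Good.Obstruction G₁ (f₀ a′ s)
        no₂ : ¬ Good.Obstruction G₂ (f₀ a s)
        s≢x : s ≢ x
        Xa′s : ¬ X a′ s d
        Xas : ¬ X a s g
        Γ₁ : ¬ (a′ ≢ s × f K a′ s ∈ˡ Γ)
        Γ₂ : ¬ (a ≢ s × f K a s ∈ˡ Γ)
        s∉Φ : s ∉ˡ Φ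
        q₁∉Φ : nb₀ g s ∉ˡ Φ
        q₂∉Φ : nb₀ d s ∉ˡ Φ

      ∈≢ : ∀ {u v} → u ∈ˡ Φ → v ∉ˡ Φ → u ≢ v
      ∈≢ u∈ v∉ refl = v∉ u∈
      h₁ : Fin m
      h₁ = f₀ a′ s
      h₂ : Fin m
      h₂ = f₀ a s
      b₁ : Fin n
      b₁ = nb₀ g a′
      b₂ : Fin n
      b₂ = nb₀ d a
      q₁ : Fin n
      q₁ = nb₀ h₁ b₁
      q₂ : Fin n
      q₂ = nb₀ h₂ b₂
      th : ∀ {a c} (G : Good K X τ a c) → σ ≢ Good.A G → ty (f₀ a s) ≢ o
      th G σ≢ e = σ≢ (sym (⊕-self _ σ (trans (sym (ty-f₀ (Good.pa G) ps σ≢)) e)))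
      th≢ : ∀ {a c} (G : Good K X τ a c) → σ ≢ Good.A G → σ ≢ Good.A G ⊕ ty c → ty (f₀ a s) ≢ ty c
      th≢ G σ≢ σ≢′ e = σ≢′ (⊕-shift _ σ _ (trans (sym (ty-f₀ (Good.pa G) ps σ≢)) e))
      sq : ∀ {a c} (G : Good K X τ a c) → σ ≢ Good.A G → σ ≢ Good.A G ⊕ ty c → ¬ Good.Obstruction G (f₀ a s) →
        Square K X c (f₀ a s) a (nb₀ c a) (nb₀ (f₀ a s) (nb₀ c a)) s
      sq {a} {c} G σ≢ σ≢′ free = subst (Square K X c (f₀ a s) a (nb₀ c a) (nb₀ (f₀ a s) (nb₀ c a))) (nb₀-f₀ (Good.pa G) ps σ≢)
        (square G X-sym (th G σ≢) (th≢ G σ≢ σ≢′) free)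
      S₁ : Square K X g h₁ a′ b₁ q₁ s
      S₁ = sq G₁ σ≢A₁ σ≢B₁ no₁
      S₂ : Square K X d h₂ a b₂ q₂ s
      S₂ = sq G₂ σ≢A₂ σ≢B₂ no₂
      a′≢s : a′ ≢ s
      a′≢s = (Square.p≢a S₁) ∘ sym
      a≢s : a ≢ s
      a≢s = (Square.p≢a S₂) ∘ sym
      a′s : f K a′ s ≡ h₁
      a′s = trans (f-sym K _ _) (Square.pa S₁)
      as : f K a s ≡ h₂
      as = trans (f-sym K _ _) (Square.pa S₂)
      a≢a′ : a ≢ a′
      a≢a′ refl = g≢d (cong ty (trans (sym xa) xa′))
      d≢g : d ≢ g
      d≢g e = g≢d (cong ty (sym e))
      a′x : f K a′ x ≡ d
      a′x = trans (f-sym K _ _) xa′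
      ax : f K a x ≡ g
      ax = trans (f-sym K _ _) xa
      clash : ∀ {u v w y z} → u ≢ v → u ≢ w → v ≢ w → f K u v ≡ y → f K u w ≡ z → y ≢ z
      clash uv uw vw e e′ y≡z = vw (f-inj K uv uw (trans e (trans y≡z (sym e′))))
      d≢h₁ : d ≢ h₁
      d≢h₁ = clash (x≢a′ ∘ sym) a′≢s (s≢x ∘ sym) a′x a′s
      h₂≢g : h₂ ≢ g
      h₂≢g = clash a≢s (x≢a ∘ sym) s≢x as ax
      h₂≢h₁ : h₂ ≢ h₁
      h₂≢h₁ = clash (Square.p≢a S₂) (Square.p≢a S₁) a≢a′ (Square.pa S₂) (Square.pa S₁)
      T₁ : Swapped K X g h₁ a′ b₁ q₁ s
      T₁ = swap X-sym S₁
      K₁ : Col n m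
      K₁ = Swapped.K⁺ T₁
      keep₁ : ∀ {y} → y ≢ g → y ≢ h₁ → ∀ {u v} → f K u v ≡ y → f K₁ u v ≡ y
      keep₁ y≢g y≢h₁ refl = Swapped.colour T₁ y≢g y≢h₁
      -- The first swap affects the colours `g` and `h₁` only, and the second square uses neither.
      S₂′ : Square K₁ X d h₂ a b₂ q₂ s
      S₂′ = Square-mono S₂ (keep₁ d≢g d≢h₁) (keep₁ h₂≢g h₂≢h₁)
      T₂ : Swapped K₁ X d h₂ a b₂ q₂ s
      T₂ = swap X-sym S₂′
      K₂ : Col n m
      K₂ = Swapped.K⁺ T₂
      x≢b₁ : x ≢ b₁
      x≢b₁ e = d≢g (trans (sym a′x) (trans (cong (f K a′) e) (Square.ab S₁)))
      x≢q₁ : x ≢ q₁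
      x≢q₁ e = clash (Square.q≢p S₁) (subst (_≢ a) e x≢a) (a≢s ∘ sym) (Square.qp S₁) (subst (λ y → f K y a ≡ g) e xa) refl
      x≢b₂ : x ≢ b₂
      x≢b₂ e = d≢g (trans (sym (Square.ab S₂)) (trans (cong (f K a) (sym e)) ax))
      x≢q₂ : x ≢ q₂
      x≢q₂ e = clash (Square.q≢p S₂) (subst (_≢ a′) e x≢a′) (a′≢s ∘ sym) (Square.qp S₂) (subst (λ y → f K y a′ ≡ d) e xa′) refl
      xv : Kept K K₂ x
      xv = trans (Swapped.vertex T₂ x≢a x≢b₂ x≢q₂ (s≢x ∘ sym)) (Swapped.vertex T₁ x≢a′ x≢b₁ x≢q₁ (s≢x ∘ sym))
      S₃ : Square K₂ X d g x a′ s a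
      S₃ = record
        { a≢b = x≢a′ ; b≢q = a′≢s ; q≢p = a≢s ∘ sym ; p≢a = x≢a ∘ sym ; c≢h = d≢g
        ; ab = trans xv xa′
        ; bq = trans (f-sym K₂ _ _) (trans (Swapped.colour T₂ (λ e → d≢g (trans (sym e) (Swapped.pa T₁))) (λ e → h₂≢g (trans (sym e) (Swapped.pa T₁)))) (Swapped.pa T₁))
        ; qp = Swapped.pa T₂
        ; pa = trans (f-sym K₂ _ _) (trans xv xa)
        ; Xab = Xxa′ ; Xbq = Xa′s ; Xqp = λ y → Xas (flip X-sym y) ; Xpa = λ y → Xxa (flip X-sym y) }
      T₃ : Swapped K₂ X d g x a′ s a
      T₃ = swap X-sym S₃
      K₃ : Col n m
      K₃ = Swapped.K⁺ T₃
      -- By commutation the remaining corner is the partner of `s` in `g` or `d`; keeping it out of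
      -- `Φ` thus becomes a condition on `s`.
      q≡ : ∀ {a c} (G : Good K X τ a c) (σ≢ : σ ≢ Good.A G) → σ ≢ Good.A G ⊕ ty c → nb₀ (f₀ a s) (nb₀ c a) ≡ nb₀ c s
      q≡ {a} {c} G σ≢ σ≢′ = trans (nb₀-comm (Good.pa G) (Good.tc G) (th G σ≢) (th≢ G σ≢ σ≢′)) (cong (nb₀ c) (nb₀-f₀ (Good.pa G) ps σ≢))
      q₁∉′ : q₁ ∉ˡ Φ
      q₁∉′ q∈ = q₁∉Φ (subst (_∈ˡ Φ) (q≡ G₁ σ≢A₁ σ≢B₁) q∈)
      q₂∉′ : q₂ ∉ˡ Φ
      q₂∉′ q∈ = q₂∉Φ (subst (_∈ˡ Φ) (q≡ G₂ σ≢A₂ σ≢B₂) q∈)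
      exchanged : Exchanged K X x a a′ g d Γ Φ
      exchanged = record
        { K⁺ = K₃
        ; ch = cycle a′ b₁ q₁ s ++ cycle a b₂ q₂ s ++ cycle x a′ s a
        ; ch-len = refl
        ; xa = trans (f-sym K₃ _ _) (Swapped.pa T₃)
        ; xa′ = Swapped.ab T₃
        ; step = Step-trans (Swapped.step T₁) (Step-trans (Swapped.step T₂) (Swapped.step T₃))
        ; colour = λ {u} {v} y∈ →
          let e₁ = Swapped.colour T₁ {u} {v} (λ e → g∉Γ (subst (_∈ˡ Γ) e y∈)) (λ e → Γ₁ (a′≢s , subst (_∈ˡ Γ) (trans e (sym a′s)) y∈))
              e₂ = trans (Swapped.colour T₂ {u} {v} (λ e → d∉Γ (subst (_∈ˡ Γ) (trans (sym e₁) e) y∈))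
                     (λ e → Γ₂ (a≢s , subst (_∈ˡ Γ) (trans (trans (sym e₁) e) (sym as)) y∈))) e₁
          in trans (Swapped.colour T₃ {u} {v} (λ e → d∉Γ (subst (_∈ˡ Γ) (trans (sym e₂) e) y∈)) (λ e → g∉Γ (subst (_∈ˡ Γ) (trans (sym e₂) e) y∈))) e₂
        ; vertex = λ {u} u∈ {v} →
          trans (Swapped.vertex T₃ (∈≢ u∈ x∉Φ) (∈≢ u∈ a′∉Φ) (∈≢ u∈ s∉Φ) (∈≢ u∈ a∉Φ))
          (trans (Swapped.vertex T₂ (∈≢ u∈ a∉Φ) (∈≢ u∈ b₂∉Φ) (∈≢ u∈ q₂∉′) (∈≢ u∈ s∉Φ))
                 (Swapped.vertex T₁ (∈≢ u∈ a′∉Φ) (∈≢ u∈ b₁∉Φ) (∈≢ u∈ q₁∉′) (∈≢ u∈ s∉Φ)))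
        }

    opaque
      exchange : ∀ {τ x a a′ g d} {Γ : List (Fin m)} {Φ : List (Fin n)} → 7 * τ ≤ U →
        Good K X τ a′ g → Good K X τ a d → ty g ≢ ty d →
        x ≢ a → x ≢ a′ → f K x a ≡ g → f K x a′ ≡ d →
        ¬ X x a d → ¬ X x a′ g → Cover U (λ v → X a′ v d) → Cover U (λ v → X a v g) →
        length Γ ≤ U → g ∉ˡ Γ → d ∉ˡ Γ →
        length Φ ≤ U → x ∉ˡ Φ → a ∉ˡ Φ → a′ ∉ˡ Φ → nb₀ g a′ ∉ˡ Φ → nb₀ d a ∉ˡ Φ →
        Exchanged K X x a a′ g d Γ Φ
      exchange {τ} {x} {a} {a′} {g} {d} {Γ} {Φ} 7τ≤U G₁ G₂ g≢d x≢a x≢a′ xa xa′ Xxa Xxa′ Xa′ Xa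
        Γ-len g∉Γ d∉Γ Φ-len x∉Φ a∉Φ a′∉Φ b₁∉Φ b₂∉Φ =
        -- `σ` differs from the parts of `a` and `a′`, which gives their edges to `s` a type other
        -- than `o`, and from the parts of their partners, which makes this type differ from that of
        -- `d` or `g`, as a square requires.
        case fourth-part (Good.A G₁) (Good.A G₂) (ty g) (ty d) (Good.tc G₁) (Good.tc G₂) g≢d of
        λ (σ , σ≢A₁ , σ≢A₂ , σ≢B₁ , σ≢B₂) →
        case choose n-big (outside σ)
          ( ∞-small ∷ obst-cover G₁ σ≢A₁ ∷ obst-cover G₂ σ≢A₂ ∷ one x ∷ Xa′ ∷ Xa
          ∷ f-cover K a′ (Cover-mono Γ-len id (Cover-list Γ))
          ∷ f-cover K a (Cover-mono Γ-len id (Cover-list Γ))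
          ∷ Cover-mono Φ-len id (Cover-list Φ)
          ∷ nb₀-cover g (Good.tc G₁) (Cover-mono Φ-len id (Cover-list Φ))
          ∷ nb₀-cover d (Good.tc G₂) (Cover-mono Φ-len id (Cover-list Φ)) ∷ []) of
        λ (s , (n₁ , n₂ , n₃ , _) , (n∞ , no₁ , no₂ , s≢x , Xa′s , Xas , Γ₁ , Γ₂ , s∉Φ , q₁∉Φ , q₂∉Φ , _)) →
        case inside n∞ n₁ n₂ n₃ of
        λ ps → ExchangeAt.exchanged {τ} record
          { G₁ = G₁ ; G₂ = G₂ ; g≢d = g≢d ; x≢a = x≢a ; x≢a′ = x≢a′ ; xa = xa ; xa′ = xa′
          ; Xxa = Xxa ; Xxa′ = Xxa′ ; g∉Γ = g∉Γ ; d∉Γ = d∉Γ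
          ; x∉Φ = x∉Φ ; a∉Φ = a∉Φ ; a′∉Φ = a′∉Φ ; b₁∉Φ = b₁∉Φ ; b₂∉Φ = b₂∉Φ
          ; ps = ps ; σ≢A₁ = σ≢A₁ ; σ≢A₂ = σ≢A₂ ; σ≢B₁ = σ≢B₁ ; σ≢B₂ = σ≢B₂
          ; no₁ = λ ob → no₁ (ps , ob) ; no₂ = λ ob → no₂ (ps , ob) ; s≢x = s≢x ; Xa′s = Xa′s ; Xas = Xas
          ; Γ₁ = Γ₁ ; Γ₂ = Γ₂ ; s∉Φ = s∉Φ ; q₁∉Φ = λ q∈ → q₁∉Φ (n∞ , q∈) ; q₂∉Φ = λ q∈ → q₂∉Φ (n∞ , q∈) }
        where
        obst-cover : ∀ {σ a c} (G : Good K X τ a c) → σ ≢ Good.A G →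
          Cover U (λ s → pt s ≡ just σ × Good.Obstruction G (f₀ a s))
        obst-cover {σ} {a} G σ≢ = Cover-mono 7τ≤U id
          (Cover-image (λ h → nb₀ h a) (λ {s} (ps , ob) → f₀ a s , ob , nb₀-f₀ (Good.pa G) ps σ≢) (obstructions G))

  -- Closing up a 4-cycle with an arbitrary colour

  record Finished (K : Col n m) (X : Forbid n m) (x y a : Fin n) (c₀ c : Fin m) : Set where
    field
      K⁺ : Col n m
      ch : List (Fin n × Fin n)
      ch-len : length ch ≡ 32
      xy : f K⁺ x y ≡ c
      xa : f K⁺ x a ≡ c₀
      step : Step X ch K K⁺

  module _ {K : Col n m} {X : Forbid n m} (X-sym : Symm X) where

    -- Both `c₀` and `c` may be colours of which the pattern says nothing. Only `ab` and `pq` have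
    -- to lie in the pattern, where `p` and `q` are the `c₀`-partners of `a` and `b`.
    record Frame (τ : ℕ) (x y a b p q : Fin n) (c₀ c e₁ e₂ : Fin m) : Set where
      field
        G₁ : Good K X τ a e₁
        G₂ : Good K X τ p e₂
        b≡ : nb₀ e₁ a ≡ b
        q≡ : nb₀ e₂ p ≡ q
        x≢y : x ≢ y
        x≢a : x ≢ a
        x≢b : x ≢ b
        y≢a : y ≢ a
        y≢b : y ≢ b
        a≢p : a ≢ p
        b≢q : b ≢ q
        b≢p : b ≢ p
        xy : f K x y ≡ c₀
        xa : f K x a ≡ c
        yb : f K y b ≡ c
        ap : f K a p ≡ c₀
        bq : f K b q ≡ c₀
        Xxy : ¬ X x y c
        Xxa : ¬ X x a c₀
        Xyb : ¬ X y b c₀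
        Xab : ¬ X a b c
        Xab₀ : ¬ X a b c₀
        Xpq : ¬ X p q c₀
        Xap : Cover U (X a p)
        Xbq : Cover U (X b q)

      a≢b : a ≢ b
      a≢b = subst (a ≢_) b≡ (nb₀-≢ (Good.pa G₁) (Good.tc G₁))
      p≢q : p ≢ q
      p≢q = subst (p ≢_) q≡ (nb₀-≢ (Good.pa G₂) (Good.tc G₂))
      ab : f K a b ≡ e₁
      ab = subst (λ z → f K a z ≡ e₁) b≡ (Good.edge G₁)
      pq : f K p q ≡ e₂
      pq = subst (λ z → f K p z ≡ e₂) q≡ (Good.edge G₂)
      a≢q : a ≢ q
      a≢q e = b≢p (f-inj K a≢b a≢p (trans (trans (f-sym K a b) (trans (cong (f K b) e) bq)) (sym ap)))

    -- The wild colour c₀ is put on a b by giving a b and p q a common colour h first; then x y b a is a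
    -- 4-cycle in the colours c₀, c.
    record FrameAt (τ : ℕ) (x y a b p q : Fin n) (c₀ c e₁ e₂ h : Fin m) : Set where
      field
        frame : Frame τ x y a b p q c₀ c e₁ e₂
      open Frame frame
      field
        th : ty h ≢ o
        h≢e₁ : ty h ≢ ty e₁
        h≢e₂ : ty h ≢ ty e₂
        no₁ : ¬ Good.Obstruction G₁ h
        no₂ : ¬ Good.Obstruction G₂ h
        Xaph : ¬ X a p h
        Xbqh : ¬ X b q h
        h≢c : h ≢ c
        h≢c₀ : h ≢ c₀
        h≢aq : h ≢ f K a q
        h≢bp : h ≢ f K b p

      a′ b′ p′ q′ : Fin n
      a′ = nb₀ h a
      b′ = nb₀ h b
      p′ = nb₀ h p
      q′ = nb₀ h q
      S₁ : Square K X e₁ h a b b′ a′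
      S₁ = subst (λ z → Square K X e₁ h a z (nb₀ h z) a′) b≡ (Good.square G₁ X-sym th h≢e₁ no₁)
      S₂ : Square K X e₂ h p q q′ p′
      S₂ = subst (λ z → Square K X e₂ h p z (nb₀ h z) p′) q≡ (Good.square G₂ X-sym th h≢e₂ no₂)
      aa′ : f K a a′ ≡ h
      aa′ = trans (f-sym K _ _) (Square.pa S₁)
      pp′ : f K p p′ ≡ h
      pp′ = trans (f-sym K _ _) (Square.pa S₂)
      T₁ : Swapped K X e₁ h a b b′ a′
      T₁ = swap X-sym S₁
      K₁ : Col n m
      K₁ = Swapped.K⁺ T₁
      clash : ∀ {u v w y z} → u ≢ v → u ≢ w → v ≢ w → f K u v ≡ y → f K u w ≡ z → y ≢ z
      clash uv uw vw e e′ y≡z = vw (f-inj K uv uw (trans e (trans y≡z (sym e′))))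
      not-h : ∀ {u v w} → f K u v ≡ h → f K u w ≢ h → w ≢ v
      not-h e d refl = d e
      qa≢h : f K q a ≢ h
      qa≢h e = h≢aq (trans (sym e) (f-sym K _ _))
      pb≢h : f K p b ≢ h
      pb≢h e = h≢bp (trans (sym e) (f-sym K _ _))
      qb≢h : f K q b ≢ h
      qb≢h e = h≢c₀ (trans (sym e) (trans (f-sym K _ _) bq))
      pa≢h : f K p a ≢ h
      pa≢h e = h≢c₀ (trans (sym e) (trans (f-sym K _ _) ap))
      -- `h` is not the colour of any of `ap`, `aq`, `bp`, `bq`, so the square on `ab` misses `p`
      -- and `q`. The square on `pq` misses `a` and `b` for the same reason.
      p₁ : Kept K K₁ p
      p₁ = Swapped.vertex T₁ (a≢p ∘ sym) (b≢p ∘ sym)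
        (not-h (Square.bq S₁) (λ e → h≢bp (sym e)))
        (not-h aa′ (λ e → h≢c₀ (trans (sym e) ap)))
      q₁ : Kept K K₁ q
      q₁ = Swapped.vertex T₁ (a≢q ∘ sym) (b≢q ∘ sym)
        (not-h (Square.bq S₁) (λ e → h≢c₀ (trans (sym e) bq)))
        (not-h aa′ (λ e → h≢aq (sym e)))
      a≢q′ : a ≢ q′
      a≢q′ = not-h (Square.bq S₂) qa≢h
      b≢q′ : b ≢ q′
      b≢q′ = not-h (Square.bq S₂) qb≢h
      same-end : ∀ {u v w} → u ≢ v → w ≢ v → f K u v ≡ h → f K w v ≡ h → u ≡ w
      same-end uv wv e e′ = f-inj K (uv ∘ sym) (wv ∘ sym)
        (trans (f-sym K _ _) (trans e (trans (sym e′) (f-sym K _ _))))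
      q′₁ : Kept K K₁ q′
      q′₁ = Swapped.vertex T₁ (a≢q′ ∘ sym) (b≢q′ ∘ sym)
        (λ e → b≢q (same-end (Square.b≢q S₁) (λ e′ → Square.b≢q S₂ (trans e′ (sym e))) (Square.bq S₁)
          (subst (λ z → f K q z ≡ h) e (Square.bq S₂))))
        (λ e → a≢q (same-end (Square.p≢a S₁ ∘ sym) (λ e′ → Square.b≢q S₂ (trans e′ (sym e))) aa′
          (subst (λ z → f K q z ≡ h) e (Square.bq S₂))))
      S₂′ : Square K₁ X e₂ h p q q′ p′
      S₂′ = record
        { a≢b = Square.a≢b S₂ ; b≢q = Square.b≢q S₂ ; q≢p = Square.q≢p S₂ ; p≢a = Square.p≢a S₂ ; c≢h = Square.c≢h S₂
        ; ab = trans p₁ (Square.ab S₂) ; bq = trans q₁ (Square.bq S₂) ; qp = trans q′₁ (Square.qp S₂)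
        ; pa = trans (f-sym K₁ _ _) (trans p₁ pp′)
        ; Xab = Square.Xab S₂ ; Xbq = Square.Xbq S₂ ; Xqp = Square.Xqp S₂ ; Xpa = Square.Xpa S₂ }
      T₂ : Swapped K₁ X e₂ h p q q′ p′
      T₂ = swap X-sym S₂′
      K₂ : Col n m
      K₂ = Swapped.K⁺ T₂
      a₂ : Kept K₁ K₂ a
      a₂ = Swapped.vertex T₂ a≢p a≢q a≢q′ (not-h pp′ pa≢h)
      b₂ : Kept K₁ K₂ b
      b₂ = Swapped.vertex T₂ b≢p (b≢q) b≢q′ (not-h pp′ pb≢h)
      S₃ : Square K₂ X h c₀ a b q p
      S₃ = record
        { a≢b = a≢b ; b≢q = b≢q ; q≢p = p≢q ∘ sym ; p≢a = a≢p ∘ sym ; c≢h = h≢c₀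
        ; ab = trans a₂ (Swapped.ab T₁)
        ; bq = trans b₂ (trans (f-sym K₁ _ _) (trans q₁ (trans (f-sym K _ _) bq)))
        ; qp = trans (f-sym K₂ _ _) (Swapped.ab T₂)
        ; pa = trans (f-sym K₂ _ _) (trans a₂ (trans (f-sym K₁ _ _) (trans p₁ (trans (f-sym K _ _) ap))))
        ; Xab = Xab₀ ; Xbq = Xbqh ; Xqp = λ z → Xpq (flip X-sym z) ; Xpa = λ z → Xaph (flip X-sym z) }
      T₃ : Swapped K₂ X h c₀ a b q p
      T₃ = swap X-sym S₃
      K₃ : Col n m
      K₃ = Swapped.K⁺ T₃
      ba : f K b a ≡ e₁
      ba = trans (f-sym K _ _) ab
      ax : f K a x ≡ c
      ax = trans (f-sym K _ _) xa
      by : f K b y ≡ c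
      by = trans (f-sym K _ _) yb
      c₀≢e₁ : c₀ ≢ e₁
      c₀≢e₁ = clash a≢p a≢b (b≢p ∘ sym) ap ab
      c₀≢e₂ : c₀ ≢ e₂
      c₀≢e₂ = clash (a≢p ∘ sym) p≢q a≢q (trans (f-sym K _ _) ap) pq
      c₀≢c : c₀ ≢ c
      c₀≢c = clash x≢y x≢a y≢a xy xa
      c≢e₁ : c ≢ e₁
      c≢e₁ = clash (x≢a ∘ sym) a≢b x≢b ax ab
      x≢q : x ≢ q
      x≢q e = y≢b (f-inj K x≢y x≢b (trans xy (trans (sym bq) (trans (cong (f K b) (sym e)) (f-sym K _ _)))))
      x≢p : x ≢ p
      x≢p e = y≢a (f-inj K x≢y x≢a (trans xy (trans (sym ap) (trans (cong (f K a) (sym e)) (f-sym K _ _)))))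
      keep-a : f K₃ a x ≡ c
      keep-a = trans (Swapped.colour T₃ (λ e → h≢c (trans (sym e) a²)) (λ e → c₀≢c (trans (sym e) a²))) a²
        where
        a² : f K₂ a x ≡ c
        a² = trans a₂ (trans (Swapped.colour T₁ (λ e → c≢e₁ (trans (sym ax) e)) (λ e → h≢c (trans (sym e) ax))) ax)
      keep-b : f K₃ b y ≡ c
      keep-b = trans (Swapped.colour T₃ (λ e → h≢c (trans (sym e) b²)) (λ e → c₀≢c (trans (sym e) b²))) b²
        where
        b² : f K₂ b y ≡ c
        b² = trans b₂ (trans (Swapped.colour T₁ (λ e → c≢e₁ (trans (sym by) e)) (λ e → h≢c (trans (sym e) by))) by)
      keep-xy : f K₃ x y ≡ c₀
      keep-xy = trans (Swapped.vertex T₃ x≢a x≢b x≢q x≢p)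
        (trans (Swapped.colour T₂ (λ e → c₀≢e₂ (trans (sym x¹) e)) (λ e → h≢c₀ (trans (sym e) x¹))) x¹)
        where
        x¹ : f K₁ x y ≡ c₀
        x¹ = trans (Swapped.colour T₁ (λ e → c₀≢e₁ (trans (sym xy) e)) (λ e → h≢c₀ (trans (sym e) xy))) xy
      S₄ : Square K₃ X c₀ c x y b a
      S₄ = record
        { a≢b = x≢y ; b≢q = y≢b ; q≢p = a≢b ∘ sym ; p≢a = x≢a ∘ sym ; c≢h = c₀≢c
        ; ab = keep-xy ; bq = trans (f-sym K₃ _ _) keep-b
        ; qp = trans (f-sym K₃ _ _) (Swapped.ab T₃) ; pa = keep-a
        ; Xab = Xxy ; Xbq = Xyb ; Xqp = λ z → Xab (flip X-sym z) ; Xpa = λ z → Xxa (flip X-sym z) }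
      T₄ : Swapped K₃ X c₀ c x y b a
      T₄ = swap X-sym S₄

      finished : Finished K X x y a c₀ c
      finished = record
        { K⁺ = Swapped.K⁺ T₄
        ; ch = cycle a b b′ a′ ++ cycle p q q′ p′ ++ cycle a b q p ++ cycle x y b a
        ; ch-len = refl
        ; xy = Swapped.ab T₄
        ; xa = trans (f-sym (Swapped.K⁺ T₄) _ _) (Swapped.pa T₄)
        ; step = Step-trans (Swapped.step T₁) (Step-trans (Swapped.step T₂) (Step-trans (Swapped.step T₃) (Swapped.step T₄)))
        }

    opaque
      finish : ∀ {τ x y a b p q c₀ c e₁ e₂} → 7 * τ ≤ U → Frame τ x y a b p q c₀ c e₁ e₂ → Finished K X x y a c₀ c
      finish {τ} {a = a} {b} {p} {q} {c₀} {c} {e₁} {e₂} 7τ≤U frame =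
        case third-type (ty e₁) (ty e₂) of λ (r , r≢o , r≢e₁ , r≢e₂) →
        case choose {big = _ ∷ _ ∷ _ ∷ []} m-big (ty-cover (r ⊕ i₁) ∷ ty-cover (r ⊕ i₂) ∷ ty-cover (r ⊕ i₃) ∷ [])
          ( Cover-mono 7τ≤U id (Good.obstructions G₁) ∷ Cover-mono 7τ≤U id (Good.obstructions G₂)
          ∷ Xap ∷ Xbq ∷ one c ∷ one c₀ ∷ one (f K a q) ∷ one (f K b p) ∷ []) of
        λ (h , (n₁ , n₂ , n₃ , _) , (no₁ , no₂ , Xaph , Xbqh , h≢c , h≢c₀ , h≢aq , h≢bp , _)) →
        case three-others r (ty h) n₁ n₂ n₃ of λ e →
        FrameAt.finished {τ} {h = h} record
          { frame = frame
          ; th = λ z → r≢o (trans (sym e) z)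
          ; h≢e₁ = λ z → r≢e₁ (trans (sym e) z)
          ; h≢e₂ = λ z → r≢e₂ (trans (sym e) z)
          ; no₁ = no₁ ; no₂ = no₂ ; Xaph = Xaph ; Xbqh = Xbqh
          ; h≢c = h≢c ; h≢c₀ = h≢c₀ ; h≢aq = h≢aq ; h≢bp = h≢bp }
        where
        open Frame frame using (G₁; G₂; Xap; Xbq)

  -- Recolouring an arbitrary edge

  choose′ : ∀ {j} {big small : List (Fin j → Set)} → 3 * κ + 60 * U < j →
    length big ≤ 3 → length small ≤ 60 → All (Cover κ) big → All (Cover U) small →
    ∃ λ i → AvoidsAll big i × AvoidsAll small i
  choose′ l b s cs ds = avoid cs ds (ℕₚ.≤-<-trans (ℕₚ.+-mono-≤ (ℕₚ.*-monoˡ-≤ κ b) (ℕₚ.*-monoˡ-≤ U s)) l)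

  nb-at-cover : ∀ (K : Col n m) u {b} {P : Fin n → Set} → Cover b P → Cover b (λ c → P (nb K c u))
  nb-at-cover K u = Cover-image (f K u) (λ {c} p → nb K c u , p , f-nb K c u)

  hits : ∀ (K : Col n m) u {L : List (Fin n)} → length L ≤ U → Cover U (λ c → nb K c u ∈ˡ L)
  hits K u {L} l = nb-at-cover K u (Cover-mono l id (Cover-list L))

  -- All that a move has to know. `Prot` marks edges that may be closed to every colour, `special`
  -- the vertices at which all edges may be; elsewhere `X` excludes few vertices and few colours.
  -- `badV`, `badC` and `NotGood` are the exceptions to the pattern. In `τ-small`, 48 pays for the
  -- two exchanges that precede `finish`, and 7 for the defects added up in `obstructions`.
  record Env (τ : ℕ) (K : Col n m) (X : Forbid n m) : Set₁ where
    field
      X-sym : Symm X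
      τ-small : 7 * (τ + 48) ≤ U
      Prot : Fin n → Fin n → Set
      special : List (Fin n)
      badV : List (Fin n)
      badC : List (Fin m)
      badV-len : length badV ≤ U
      badC-len : length badC ≤ U
      badV-∞ : ∀ {v} → v ∉ˡ badV → pt v ≢ nothing
      badV-special : ∀ {v} → v ∉ˡ badV → v ∉ˡ special
      NotGood : Fin n → Fin m → Set
      good : ∀ {a c} → ty c ≢ o → ¬ NotGood a c → Good K X τ a c
      good-vertex : ∀ {a c} → ty c ≢ o → ¬ NotGood a c → a ∉ˡ badV
      good-edge-free : ∀ {a c} → ty c ≢ o → ¬ NotGood a c → ¬ Prot a (nb₀ c a)
      NotGood-vertex : ∀ {a} → a ∉ˡ badV → Cover U (NotGood a)
      NotGood-colour : ∀ {c} → c ∉ˡ badC → Cover U (λ v → ty c ≢ o × NotGood v c)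
      X-vertex : ∀ {u} c → u ∉ˡ special → Cover U (λ v → X u v c)
      X-edge : ∀ {u v} → ¬ Prot u v → Cover U (X u v)
      Prot-vertex : ∀ {u} → u ∉ˡ special → Cover U (Prot u)

  module Moves {τ : ℕ} {K : Col n m} {X : Forbid n m} (env : Env τ K X) where
    open Env env

    τ≤U : τ ≤ U
    τ≤U = ℕₚ.≤-trans (ℕₚ.m≤m+n τ 48) (ℕₚ.≤-trans (ℕₚ.m≤n*m _ 7) τ-small)

    336≤U : 336 ≤ U
    336≤U = ℕₚ.≤-trans (ℕₚ.*-monoʳ-≤ 7 (ℕₚ.m≤n+m 48 τ)) τ-small

    -- The edge `xy` is to receive `d`. An exchange at `x` brings `d` from `xa′` to `xa`, an
    -- exchange at `y` brings it from `yb′` to `yb`, and `finish` closes up `x y b a`. The fields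
    -- are what these three operations ask of the colouring at the outset.
    record Plan (x y a b : Fin n) (d : Fin m) : Set where
      c₀ : Fin m
      c₀ = f K x y
      g : Fin m
      g = f K x a
      g′ : Fin m
      g′ = f K y b
      p : Fin n
      p = nb K c₀ a
      q : Fin n
      q = nb K c₀ b
      a′ : Fin n
      a′ = nb K d x
      b′ : Fin n
      b′ = nb K d y
      e₁ : Fin m
      e₁ = f₀ a b
      e₂ : Fin m
      e₂ = f₀ p q
      field
        {A P B Q} : Ty
        x≢y : x ≢ y
        a≢x : a ≢ x
        a≢y : a ≢ y
        b≢x : b ≢ x
        b≢y : b ≢ y
        b≢p : b ≢ p
        pa : pt a ≡ just A
        pb : pt b ≡ just B
        pp : pt p ≡ just P
        pq : pt q ≡ just Q
        B≢A : B ≢ A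
        Q≢P : Q ≢ P
        td : ty d ≢ o
        tg : ty g ≢ o
        tg′ : ty g′ ≢ o
        g≢d : ty g ≢ ty d
        g′≢d : ty g′ ≢ ty d
        g≢g′ : g ≢ g′
        Gab : ¬ NotGood a e₁
        Gpq : ¬ NotGood p e₂
        Ga′ : ¬ NotGood a′ g
        Gb′ : ¬ NotGood b′ g′
        Ga : ¬ NotGood a d
        Gb : ¬ NotGood b d
        Xxa₀ : ¬ X x a c₀
        Xyb₀ : ¬ X y b c₀
        Xab₀ : ¬ X a b c₀
        Xpq₀ : ¬ X p q c₀
        Xxy : ¬ X x y d
        Xxa : ¬ X x a d
        Xyb : ¬ X y b d
        Xab : ¬ X a b d
        Xxa′ : ¬ X x a′ g
        Xyb′ : ¬ X y b′ g′
        Xap : Cover U (X a p)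
        Xbq : Cover U (X b q)
        -- The last three entries keep `nb₀ g a′`, a corner of the first square, away from `y`, `b`
        -- and `p`.
        a′∉ : a′ ∉ˡ (y ∷ b ∷ p ∷ nb K g y ∷ nb K g b ∷ nb K g p ∷ [])
        b′∉ : b′ ∉ˡ (x ∷ a ∷ p ∷ nb K g′ x ∷ nb K g′ a ∷ nb K g′ p ∷ [])
        a-d∉ : nb K d a ∉ˡ (y ∷ b ∷ p ∷ [])
        b-d∉ : nb K d b ∉ˡ (x ∷ a ∷ p ∷ [])

    -- The old colour of `xy` is not merely removed but carried to an edge `xa` whose end obeys
    -- conditions of the caller. `Assign` uses this to bring a prescribed colour to a convenient
    -- place. The length is 24 + 24 + 32.
    record Moved (x y : Fin n) (B₁ B₂ : Fin n → Set) (Bs : List (Fin n → Set)) : Set where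
      field
        K⁺ : Col n m
        ch : List (Fin n × Fin n)
        ch-len : length ch ≡ 80
        step : Step X ch K K⁺
        xy : f K⁺ x y ≢ f K x y
        a : Fin n
        xa : f K⁺ x a ≡ f K x y
        a≢x : a ≢ x
        a≢y : a ≢ y
        a∉ : a ∉ˡ badV
        avoids : ¬ B₁ a × ¬ B₂ a × AvoidsAll Bs a

    module Execute {x y a b : Fin n} {d : Fin m} (plan : Plan x y a b d) where
      open Plan plan

      ∈⁶ : ∀ {u v₁ v₂ v₃ : Fin n} {L : List (Fin n)} → u ∈ˡ (v₁ ∷ v₂ ∷ v₃ ∷ []) → u ∈ˡ (v₁ ∷ v₂ ∷ v₃ ∷ L)
      ∈⁶ = Mₚ.∈-++⁺ˡ

      clash : ∀ {u v w y z} → u ≢ v → u ≢ w → v ≢ w → f K u v ≡ y → f K u w ≡ z → y ≢ z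
      clash uv uw vw e e′ y≡z = vw (f-inj K uv uw (trans e (trans y≡z (sym e′))))

      ap : f K a p ≡ c₀
      ap = f-nb K c₀ a
      bq : f K b q ≡ c₀
      bq = f-nb K c₀ b
      ya : f K y a ≢ c₀
      ya e = clash (x≢y ∘ sym) (a≢y ∘ sym) (a≢x ∘ sym) (f-sym K y x) e refl
      x≢p : x ≢ p
      x≢p e = a≢y (f-inj K (a≢x ∘ sym) x≢y (trans (cong (λ z → f K z a) e) (trans (f-sym K p a) ap)))
      y≢p : y ≢ p
      y≢p e = ya (trans (cong (λ z → f K z a) e) (trans (f-sym K p a) ap))
      a≢p : a ≢ p
      a≢p = nb-≢ K c₀ a ∘ sym
      b≢q : b ≢ q
      b≢q = nb-≢ K c₀ b ∘ sym
      b≢a : b ≢ a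
      b≢a e = B≢A (just-injective (trans (sym pb) (trans (cong pt e) pa)))
      e₁≡ : nb₀ e₁ a ≡ b
      e₁≡ = nb₀-f₀ pa pb B≢A
      e₂≡ : nb₀ e₂ p ≡ q
      e₂≡ = nb₀-f₀ pp pq Q≢P
      te₁ : ty e₁ ≢ o
      te₁ e = B≢A (sym (⊕-self _ _ (trans (sym (ty-f₀ pa pb B≢A)) e)))
      te₂ : ty e₂ ≢ o
      te₂ e = Q≢P (sym (⊕-self _ _ (trans (sym (ty-f₀ pp pq Q≢P)) e)))
      g≢c₀ : g ≢ c₀
      g≢c₀ = clash (a≢x ∘ sym) x≢y a≢y refl refl
      g′≢c₀ : g′ ≢ c₀
      g′≢c₀ = clash (b≢y ∘ sym) (x≢y ∘ sym) b≢x refl (f-sym K y x)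
      d≢c₀ : d ≢ c₀
      d≢c₀ e = a′∉ (here (trans (cong (λ z → nb K z x) e) (nb-f K x y x≢y)))

      τ-small₀ : 7 * τ ≤ U
      τ-small₀ = ℕₚ.≤-trans (ℕₚ.*-monoʳ-≤ 7 (ℕₚ.m≤m+n τ 48)) τ-small

      τ-small₁ : 7 * (τ + 24) ≤ U
      τ-small₁ = ℕₚ.≤-trans (ℕₚ.*-monoʳ-≤ 7 (ℕₚ.+-monoʳ-≤ τ (toWitness {a? = 24 ℕ.≤? 48} tt))) τ-small

      nb₀≡nb : ∀ {u c} → ty c ≢ o → ¬ NotGood u c → nb₀ c u ≡ nb K c u
      nb₀≡nb tc G = sym (nb-unique K (nb₀-≢ (Good.pa (good tc G)) tc) (Good.edge (good tc G)))

      through : ∀ {u v c} → nb K c u ≡ v → u ≡ nb K c v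
      through {u} {v} {c} e = trans (sym (nb-nb K c u)) (cong (nb K c) e)

      X-vertex′ : ∀ {u c} c′ → ty c ≢ o → ¬ NotGood u c → Cover U (λ v → X u v c′)
      X-vertex′ c′ tc G = X-vertex c′ (badV-special (good-vertex tc G))

      opaque
        -- Frozen are all things on which the later operations rely: the edges at `y`, `b` and `p`,
        -- and the colours `g′` and `c₀`.
        E₁ : Exchanged K X x a a′ g d (g′ ∷ c₀ ∷ []) (y ∷ b ∷ p ∷ [])
        E₁ = exchange X-sym τ-small₀ (good tg Ga′) (good td Ga) g≢d (a≢x ∘ sym) (nb-≢ K d x ∘ sym)
          refl (f-nb K d x) Xxa Xxa′ (X-vertex′ d tg Ga′) (X-vertex′ g td Ga)
          (ℕₚ.≤-trans (toWitness {a? = 2 ℕ.≤? 336} tt) 336≤U)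
          (λ { (here e) → g≢g′ e ; (there (here e)) → g≢c₀ e })
          (λ { (here e) → g′≢d (cong ty (sym e)) ; (there (here e)) → d≢c₀ e })
          (ℕₚ.≤-trans (toWitness {a? = 3 ℕ.≤? 336} tt) 336≤U)
          (λ { (here e) → x≢y e ; (there (here e)) → b≢x (sym e) ; (there (there (here e))) → x≢p e })
          (λ { (here e) → a≢y e ; (there (here e)) → b≢a (sym e) ; (there (there (here e))) → a≢p e })
          (λ u∈ → a′∉ (∈⁶ u∈))
          (λ { (here e) → a′∉ (there (there (there (here (through (trans (sym (nb₀≡nb tg Ga′)) e))))))
             ; (there (here e)) → a′∉ (there (there (there (there (here (through (trans (sym (nb₀≡nb tg Ga′)) e)))))))
             ; (there (there (here e))) → a′∉ (there (there (there (there (there (here (through (trans (sym (nb₀≡nb tg Ga′)) e)))))))) })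
          (λ u∈ → a-d∉ (subst (_∈ˡ _) (nb₀≡nb td Ga) u∈))

      K₃ : Col n m
      K₃ = Exchanged.K⁺ E₁

      y₃ : Kept K K₃ y
      y₃ = Exchanged.vertex E₁ (here refl)
      b₃ : Kept K K₃ b
      b₃ = Exchanged.vertex E₁ (there (here refl))
      p₃ : Kept K K₃ p
      p₃ = Exchanged.vertex E₁ (there (there (here refl)))
      c₃ : ∀ {u v} → f K u v ≡ c₀ → f K₃ u v ≡ c₀
      c₃ e = trans (Exchanged.colour E₁ (there (here e))) e

      step₃ : ∀ {u c} → Good K X τ u c → f K₃ u (nb₀ c u) ≡ f K u (nb₀ c u) → Good K₃ X (τ + 24) u c
      step₃ {u} {c} G e = subst (λ k → Good K₃ X (τ + k) u c) (Exchanged.ch-len E₁)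
        (Good-step (Exchanged.step E₁) G (trans e (Good.edge G)))

      G₃b′ : Good K₃ X (τ + 24) b′ g′
      G₃b′ = step₃ (good tg′ Gb′) (Exchanged.colour E₁ (here (Good.edge (good tg′ Gb′))))

      opaque
        E₂ : Exchanged K₃ X y b b′ g′ d (c₀ ∷ []) (x ∷ a ∷ p ∷ [])
        E₂ = exchange X-sym τ-small₁ G₃b′ (step₃ (good td Gb) b₃) g′≢d (b≢y ∘ sym) (nb-≢ K d y ∘ sym)
          y₃ (trans y₃ (f-nb K d y)) Xyb Xyb′ (X-vertex′ d tg′ Gb′) (X-vertex′ g′ td Gb)
          (ℕₚ.≤-trans (toWitness {a? = 1 ℕ.≤? 336} tt) 336≤U)
          (λ { (here e) → g′≢c₀ e })
          (λ { (here e) → d≢c₀ e })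
          (ℕₚ.≤-trans (toWitness {a? = 3 ℕ.≤? 336} tt) 336≤U)
          (λ { (here e) → x≢y (sym e) ; (there (here e)) → a≢y (sym e) ; (there (there (here e))) → y≢p e })
          (λ { (here e) → b≢x e ; (there (here e)) → b≢a e ; (there (there (here e))) → b≢p e })
          (λ u∈ → b′∉ (∈⁶ u∈))
          (λ { (here e) → b′∉ (there (there (there (here (through (trans (sym (nb₀≡nb tg′ Gb′)) e))))))
             ; (there (here e)) → b′∉ (there (there (there (there (here (through (trans (sym (nb₀≡nb tg′ Gb′)) e)))))))
             ; (there (there (here e))) → b′∉ (there (there (there (there (there (here (through (trans (sym (nb₀≡nb tg′ Gb′)) e)))))))) })
          (λ u∈ → b-d∉ (subst (_∈ˡ _) (nb₀≡nb td Gb) u∈))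

      K₆ : Col n m
      K₆ = Exchanged.K⁺ E₂

      c₆ : ∀ {u v} → f K u v ≡ c₀ → f K₆ u v ≡ c₀
      c₆ e = trans (Exchanged.colour E₂ (here (c₃ e))) (c₃ e)
      x₆ : Kept K₃ K₆ x
      x₆ = Exchanged.vertex E₂ (here refl)
      a₆ : Kept K₃ K₆ a
      a₆ = Exchanged.vertex E₂ (there (here refl))
      p₆ : Kept K₃ K₆ p
      p₆ = Exchanged.vertex E₂ (there (there (here refl)))

      step₆ : ∀ {u c} (G : Good K X τ u c) → f K₃ u (nb₀ c u) ≡ f K u (nb₀ c u) → f K₆ u (nb₀ c u) ≡ f K₃ u (nb₀ c u) →
        Good K₆ X (τ + 48) u c
      step₆ {u} {c} G e e′ = subst (λ k → Good K₆ X k u c)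
        (trans (cong (τ + 24 +_) (Exchanged.ch-len E₂)) (ℕₚ.+-assoc τ 24 24))
        (Good-step (Exchanged.step E₂) (step₃ G e) (trans e′ (trans e (Good.edge G))))

      ab₃ : f K₃ a b ≡ f K a b
      ab₃ = trans (f-sym K₃ a b) (trans b₃ (f-sym K b a))

      opaque
        F : Finished K₆ X x y a c₀ d
        F = finish X-sym τ-small record
          { G₁ = step₆ (good te₁ Gab) (subst (λ z → f K₃ a z ≡ f K a z) (sym e₁≡) ab₃) a₆
          ; G₂ = step₆ (good te₂ Gpq) p₃ p₆
          ; b≡ = e₁≡ ; q≡ = e₂≡
          ; x≢y = x≢y ; x≢a = a≢x ∘ sym ; x≢b = b≢x ∘ sym ; y≢a = a≢y ∘ sym ; y≢b = b≢y ∘ sym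
          ; a≢p = a≢p ; b≢q = b≢q ; b≢p = b≢p
          ; xy = c₆ refl ; xa = trans x₆ (Exchanged.xa E₁) ; yb = Exchanged.xa E₂
          ; ap = c₆ ap ; bq = c₆ bq
          ; Xxy = Xxy ; Xxa = Xxa₀ ; Xyb = Xyb₀ ; Xab = Xab ; Xab₀ = Xab₀ ; Xpq = Xpq₀ ; Xap = Xap ; Xbq = Xbq }

      moved : ∀ {B₁ B₂ Bs} → a ∉ˡ badV → ¬ B₁ a × ¬ B₂ a × AvoidsAll Bs a → Moved x y B₁ B₂ Bs
      moved a∉ av = record
        { K⁺ = Finished.K⁺ F
        ; ch = Exchanged.ch E₁ ++ Exchanged.ch E₂ ++ Finished.ch F
        ; ch-len = trans (Lₚ.length-++ (Exchanged.ch E₁)) (cong₂ _+_ (Exchanged.ch-len E₁)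
            (trans (Lₚ.length-++ (Exchanged.ch E₂)) (cong₂ _+_ (Exchanged.ch-len E₂) (Finished.ch-len F))))
        ; step = Step-trans (Exchanged.step E₁) (Step-trans (Exchanged.step E₂) (Finished.step F))
        ; xy = λ e → d≢c₀ (trans (sym (Finished.xy F)) e)
        ; a = a ; xa = Finished.xa F ; a≢x = a≢x ; a≢y = a≢y ; a∉ = a∉ ; avoids = av }

    Vbad : Cover U (_∈ˡ badV)
    Vbad = Cover-mono badV-len id (Cover-list badV)

    Cbad : Cover U (_∈ˡ badC)
    Cbad = Cover-mono badC-len id (Cover-list badC)

    -- The order of choice is `a`, `b`, `d`, each with three big conditions. For `a` one concerns
    -- the type of `xa`, and two are left to the caller; for `b` they concern the type of `yb` and
    -- the parts of `a` and `p`; for `d` the types `o`, `ty g` and `ty g′`. Since `a′` and `b′` are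
    -- partners in `d`, conditions on them are conditions on `d`.
    record PickA (x y : Fin n) (B₁ B₂ : Fin n → Set) (Bs : List (Fin n → Set)) : Set where
      field
        x≢y : x ≢ y
        x∉ : x ∉ˡ special
        y∉ : y ∉ˡ special
        ¬xy : ¬ Prot x y
        Prot₀ : Cover U (λ v → Prot v (nb K (f K x y) v))
        a : Fin n
        {A P} : Ty
        tg : ¬ (x ≢ a × ty (f K x a) ≡ o)
        a≢x : a ≢ x
        a≢y : a ≢ y
        a∉ : a ∉ˡ badV
        g∉ : ¬ (x ≢ a × f K x a ∈ˡ badC)
        ¬xa : ¬ Prot x a
        Xxa₀ : ¬ X x a (f K x y)
        p∉ : nb K (f K x y) a ∉ˡ badV
        ¬ap : ¬ Prot a (nb K (f K x y) a)
        avoids : ¬ B₁ a × ¬ B₂ a × AvoidsAll Bs a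
        pa : pt a ≡ just A
        pp : pt (nb K (f K x y) a) ≡ just P

    opaque
      pickA : ∀ {x y B₁ B₂ Bs} → x ≢ y → x ∉ˡ special → y ∉ˡ special → ¬ Prot x y →
        Cover U (λ v → Prot v (nb K (f K x y) v)) →
        Cover κ B₁ → Cover κ B₂ → All (Cover U) Bs → length Bs ≤ 20 → PickA x y B₁ B₂ Bs
      pickA {x} {y} {B₁} {B₂} {Bs} x≢y x∉ y∉ ¬xy Prot₀ cB₁ cB₂ cBs Bs-len = pick (choose′ {big = _ ∷ _ ∷ _ ∷ []} n-big (ℕₚ.≤-refl)
          (ℕₚ.≤-trans (ℕₚ.+-monoʳ-≤ 8 Bs-len) (toWitness {a? = 28 ℕ.≤? 60} tt))
          (f-cover K x (ty-cover o) ∷ cB₁ ∷ cB₂ ∷ [])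
          ( one x ∷ one y ∷ Vbad ∷ f-cover K x Cbad ∷ Prot-vertex x∉ ∷ X-vertex (f K x y) x∉
          ∷ nb-cover K (f K x y) Vbad ∷ Prot₀ ∷ cBs))
        where
        pick : (∃ λ a → (¬ (x ≢ a × ty (f K x a) ≡ o) × ¬ B₁ a × ¬ B₂ a × ⊤) ×
            (a ≢ x × a ≢ y × a ∉ˡ badV × ¬ (x ≢ a × f K x a ∈ˡ badC) × ¬ Prot x a × ¬ X x a (f K x y) ×
             nb K (f K x y) a ∉ˡ badV × ¬ Prot a (nb K (f K x y) a) × AvoidsAll Bs a)) →
          PickA x y B₁ B₂ Bs
        pick (a , (tg , ¬B₁ , ¬B₂ , _) , (a≢x , a≢y , a∉ , g∉ , ¬xa , Xxa₀ , p∉ , ¬ap , ¬Bs)) = record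
          { x≢y = x≢y ; x∉ = x∉ ; y∉ = y∉ ; ¬xy = ¬xy ; Prot₀ = Prot₀ ; a = a ; tg = tg ; a≢x = a≢x ; a≢y = a≢y
          ; a∉ = a∉ ; g∉ = g∉ ; ¬xa = ¬xa ; Xxa₀ = Xxa₀ ; p∉ = p∉ ; ¬ap = ¬ap ; avoids = ¬B₁ , ¬B₂ , ¬Bs
          ; pa = proj₂ (part a (badV-∞ a∉)) ; pp = proj₂ (part _ (badV-∞ p∉)) }

    good-ends : ∀ {u A} → pt u ≡ just A → u ∉ˡ badV →
      Cover U (λ v → ∃ λ B → pt v ≡ just B × B ≢ A × NotGood u (f₀ u v))
    good-ends {u} pu u∉ = Cover-image (λ c → nb₀ c u)
      (λ {v} (B , pv , B≢A , N) → f₀ u v , N , nb₀-f₀ pu pv B≢A) (NotGood-vertex u∉)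

    good-edge : ∀ {a b A B} → pt a ≡ just A → pt b ≡ just B → B ≢ A → ¬ NotGood a (f₀ a b) → Cover U (X a b)
    good-edge {a} {b} {A} {B} pa pb B≢A G = subst (λ z → Cover U (X a z)) (nb₀-f₀ pa pb B≢A)
      (Cover-mono τ≤U id (Good.E (good (λ e → B≢A (sym (⊕-self A B (trans (sym (ty-f₀ pa pb B≢A)) e)))) G)))

    record PickB {x y B₁ B₂ Bs} (pickedA : PickA x y B₁ B₂ Bs) : Set where
      open PickA pickedA
      c₀ : Fin m
      c₀ = f K x y
      p : Fin n
      p = nb K c₀ a
      field
        b : Fin n
        {B Q} : Ty
        tg′ : ¬ (y ≢ b × ty (f K y b) ≡ o)
        b≢x : b ≢ x
        b≢y : b ≢ y
        b≢p : b ≢ p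
        b∉ : b ∉ˡ badV
        g′∉ : ¬ (y ≢ b × f K y b ∈ˡ badC)
        ¬yb : ¬ Prot y b
        Xyb₀ : ¬ X y b c₀
        q∉ : nb K c₀ b ∉ˡ badV
        ¬bq : ¬ Prot b (nb K c₀ b)
        Xab₀ : ¬ X a b c₀
        Xpq₀ : ¬ X p (nb K c₀ b) c₀
        b≢gy : b ≢ nb K (f K x a) y
        pb : pt b ≡ just B
        pq : pt (nb K c₀ b) ≡ just Q
        B≢A : B ≢ A
        Q≢P : Q ≢ P
        Gab : ¬ NotGood a (f₀ a b)
        Gpq : ¬ NotGood p (f₀ p (nb K c₀ b))

    opaque
      pickB : ∀ {x y B₁ B₂ Bs} (pickedA : PickA x y B₁ B₂ Bs) → PickB pickedA
      pickB {x} {y} pickedA = pick (choose n-big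
          ( f-cover K y (ty-cover o) ∷ pt-cover A ∷ nb-cover K c₀ (pt-cover P) ∷ [])
          ( one x ∷ one y ∷ one p ∷ Vbad ∷ f-cover K y Cbad ∷ Prot-vertex y∉ ∷ X-vertex c₀ y∉
          ∷ nb-cover K c₀ Vbad ∷ Prot₀ ∷ good-ends pa a∉ ∷ nb-cover K c₀ (good-ends pp p∉)
          ∷ X-vertex c₀ (badV-special a∉) ∷ nb-cover K c₀ (X-vertex c₀ (badV-special p∉))
          ∷ one (nb K (f K x a) y) ∷ []))
        where
        open PickA pickedA
        c₀ : Fin m
        c₀ = f K x y
        p : Fin n
        p = nb K c₀ a
        pick : (∃ λ b → (¬ (y ≢ b × ty (f K y b) ≡ o) × pt b ≢ just A × pt (nb K c₀ b) ≢ just P × ⊤) ×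
            (b ≢ x × b ≢ y × b ≢ p × b ∉ˡ badV × ¬ (y ≢ b × f K y b ∈ˡ badC) × ¬ Prot y b × ¬ X y b c₀ ×
             nb K c₀ b ∉ˡ badV × ¬ Prot b (nb K c₀ b) ×
             ¬ (∃ λ B → pt b ≡ just B × B ≢ A × NotGood a (f₀ a b)) ×
             ¬ (∃ λ Q → pt (nb K c₀ b) ≡ just Q × Q ≢ P × NotGood p (f₀ p (nb K c₀ b))) ×
             ¬ X a b c₀ × ¬ X p (nb K c₀ b) c₀ × b ≢ nb K (f K x a) y × ⊤)) →
          PickB pickedA
        pick (b , (tg′ , b∉A , q∉P , _) , (b≢x , b≢y , b≢p , b∉ , g′∉ , ¬yb , Xyb₀ , q∉ , ¬bq , Gab , Gpq , Xab₀ , Xpq₀ , b≢gy , _))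
          with part b (badV-∞ b∉) | part (nb K c₀ b) (badV-∞ q∉)
        ... | B , pb | Q , pq = record
          { b = b ; tg′ = tg′ ; b≢x = b≢x ; b≢y = b≢y ; b≢p = b≢p ; b∉ = b∉ ; g′∉ = g′∉ ; ¬yb = ¬yb ; Xyb₀ = Xyb₀
          ; q∉ = q∉ ; ¬bq = ¬bq ; Xab₀ = Xab₀ ; Xpq₀ = Xpq₀ ; b≢gy = b≢gy ; pb = pb ; pq = pq
          ; B≢A = B≢A ; Q≢P = Q≢P ; Gab = λ z → Gab (B , pb , B≢A , z) ; Gpq = λ z → Gpq (Q , pq , Q≢P , z) }
          where
          B≢A : B ≢ A
          B≢A e = b∉A (trans pb (cong just e))
          Q≢P : Q ≢ P
          Q≢P e = q∉P (trans pq (cong just e))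

    opaque
      pickD : ∀ {x y B₁ B₂ Bs} {pickedA : PickA x y B₁ B₂ Bs} (pickedB : PickB pickedA) →
        ∃ λ d → Plan x y (PickA.a pickedA) (PickB.b pickedB) d
      pickD {x} {y} {pickedA = pickedA} pickedB = pick (choose m-big (ty-cover o ∷ ty-cover (ty g) ∷ ty-cover (ty g′) ∷ [])
          -- As `g` is outside `badC`, few vertices are bad for it, and each of them is the
          -- `d`-partner of `x` for one `d` only.
          ( nb-at-cover K x (NotGood-colour (λ z → g∉ (a≢x ∘ sym , z)))
          ∷ nb-at-cover K y (NotGood-colour (λ z → g′∉ (b≢y ∘ sym , z)))
          ∷ NotGood-vertex a∉ ∷ NotGood-vertex b∉
          ∷ X-edge ¬xy ∷ X-edge ¬xa ∷ X-edge ¬yb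
          ∷ good-edge pa pb B≢A Gab
          ∷ nb-at-cover K x (X-vertex g x∉) ∷ nb-at-cover K y (X-vertex g′ y∉)
          ∷ hits K x {L₁} (ℕₚ.≤-trans (toWitness {a? = 6 ℕ.≤? 336} tt) 336≤U)
          ∷ hits K y {L₂} (ℕₚ.≤-trans (toWitness {a? = 6 ℕ.≤? 336} tt) 336≤U)
          ∷ hits K a {L₃} (ℕₚ.≤-trans (toWitness {a? = 3 ℕ.≤? 336} tt) 336≤U)
          ∷ hits K b {L₄} (ℕₚ.≤-trans (toWitness {a? = 3 ℕ.≤? 336} tt) 336≤U) ∷ []))
        where
        open PickA pickedA
        open PickB pickedB
        g g′ : Fin m
        g = f K x a
        g′ = f K y b
        L₁ L₂ L₃ L₄ : List (Fin n)
        L₁ = y ∷ b ∷ p ∷ nb K g y ∷ nb K g b ∷ nb K g p ∷ []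
        L₂ = x ∷ a ∷ p ∷ nb K g′ x ∷ nb K g′ a ∷ nb K g′ p ∷ []
        L₃ = y ∷ b ∷ p ∷ []
        L₄ = x ∷ a ∷ p ∷ []
        pick : (∃ λ d → (ty d ≢ o × ty d ≢ ty g × ty d ≢ ty g′ × ⊤) ×
            (¬ (ty g ≢ o × NotGood (nb K d x) g) × ¬ (ty g′ ≢ o × NotGood (nb K d y) g′) × ¬ NotGood a d × ¬ NotGood b d ×
             ¬ X x y d × ¬ X x a d × ¬ X y b d × ¬ X a b d × ¬ X x (nb K d x) g × ¬ X y (nb K d y) g′ ×
             nb K d x ∉ˡ L₁ × nb K d y ∉ˡ L₂ × nb K d a ∉ˡ L₃ × nb K d b ∉ˡ L₄ × ⊤)) →
          ∃ λ d → Plan x y a b d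
        pick (d , (td , d≢g , d≢g′ , _) , (Ga′ , Gb′ , Ga , Gb , Xxy , Xxa , Xyb , Xab , Xxa′ , Xyb′ , a′∉ , b′∉ , a-d∉ , b-d∉ , _)) = d , record
          { x≢y = x≢y ; a≢x = a≢x ; a≢y = a≢y ; b≢x = b≢x ; b≢y = b≢y ; b≢p = b≢p
          ; pa = pa ; pb = pb ; pp = pp ; pq = pq ; B≢A = B≢A ; Q≢P = Q≢P
          ; td = td ; tg = tg₊ ; tg′ = tg′₊
          ; g≢d = λ z → d≢g (sym z) ; g′≢d = λ z → d≢g′ (sym z)
          ; g≢g′ = λ z → b≢gy (sym (nb-unique K (b≢y ∘ sym) (sym z)))
          ; Gab = Gab ; Gpq = Gpq
          ; Ga′ = λ z → Ga′ (tg₊ , z) ; Gb′ = λ z → Gb′ (tg′₊ , z)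
          ; Ga = Ga ; Gb = Gb
          ; Xxa₀ = Xxa₀ ; Xyb₀ = Xyb₀ ; Xab₀ = Xab₀ ; Xpq₀ = Xpq₀
          ; Xxy = Xxy ; Xxa = Xxa ; Xyb = Xyb ; Xab = Xab ; Xxa′ = Xxa′ ; Xyb′ = Xyb′
          ; Xap = X-edge ¬ap ; Xbq = X-edge ¬bq
          ; a′∉ = a′∉ ; b′∉ = b′∉ ; a-d∉ = a-d∉ ; b-d∉ = b-d∉ }
          where
          tg₊ : ty g ≢ o
          tg₊ z = tg (a≢x ∘ sym , z)
          tg′₊ : ty g′ ≢ o
          tg′₊ z = tg′ (b≢y ∘ sym , z)

    opaque
      -- The colour of `xy` and the ends `x`, `y` may be as irregular as they like. The edges of
      -- that colour must mostly be unprotected, because `ap` and `bq` get recoloured on the way.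
      move : ∀ {x y B₁ B₂ Bs} → x ≢ y → x ∉ˡ special → y ∉ˡ special → ¬ Prot x y →
        Cover U (λ v → Prot v (nb K (f K x y) v)) →
        Cover κ B₁ → Cover κ B₂ → All (Cover U) Bs → length Bs ≤ 20 → Moved x y B₁ B₂ Bs
      move x≢y x∉ y∉ ¬xy Prot₀ cB₁ cB₂ cBs Bs-len = go (pickA x≢y x∉ y∉ ¬xy Prot₀ cB₁ cB₂ cBs Bs-len)
        where
        go : ∀ {x y B₁ B₂ Bs} → PickA x y B₁ B₂ Bs → Moved x y B₁ B₂ Bs
        go A = let d , plan = pickD (pickB A) in Execute.moved plan (PickA.a∉ A) (PickA.avoids A)

-- From disturbed edges to good edges

∈-concatMap : ∀ {A B : Set} (g : A → List B) {xs x y} → x ∈ˡ xs → y ∈ˡ g x → y ∈ˡ concatMap g xs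
∈-concatMap g (here refl) y∈ = Mₚ.∈-++⁺ˡ y∈
∈-concatMap g {z ∷ xs} (there x∈) y∈ = Mₚ.∈-++⁺ʳ (g z) (∈-concatMap g x∈ y∈)

length-concatMap : ∀ {A B : Set} (g : A → List B) {b} → (∀ x → length (g x) ≤ b) → ∀ xs →
  length (concatMap g xs) ≤ length xs * b
length-concatMap g l [] = z≤n
length-concatMap g {b} l (x ∷ xs) = subst (_≤ b + length xs * b) (sym (Lₚ.length-++ (g x)))
  (ℕₚ.+-mono-≤ (l x) (length-concatMap g l xs))

few : ∀ {a b} → 1 ≤ b → a * b ≤ b * b → a ≤ b
few {a} {suc b} _ l = ℕₚ.*-cancelʳ-≤ a (suc b) (suc b) l

length-allFin : ∀ n → length (allFin n) ≡ n
length-allFin n = Lₚ.length-tabulate {n = n} id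

-- `s` bounds the forbidden edges per vertex and colour and the forbidden colours per edge. `T` is
-- the threshold of the averaging over disturbed pairs and, by `ms≤T²`, over forbidden opposite
-- sides of squares; `U` is that of the averaging over pairs that are not good, whose number is the
-- left side of `total≤U²`.
record Numbers (n m κ ε U T s : ℕ) : Set where
  field
    n-big : 3 * κ + 60 * U < n
    m-big : 3 * κ + 60 * U < m
    1≤T : 1 ≤ T
    s≤T : s ≤ T
    ε+2≤T : ε + 2 ≤ T
    ms≤T² : m * s ≤ T * T
    total≤U² : n * (6 * T) + (2 * T) * m ≤ U * U
    -- A move recolours 80 ordered pairs; 170 leaves room for the bound T + 2 after two moves.
    τ≤U : 7 * (T + 170) ≤ U
  T≤U : T ≤ U
  T≤U = ℕₚ.≤-trans (ℕₚ.m≤m+n T 170) (ℕₚ.≤-trans (ℕₚ.m≤n*m _ 7) τ≤U)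
  1≤U : 1 ≤ U
  1≤U = ℕₚ.≤-trans 1≤T T≤U
  ε≤U : ε ≤ U
  ε≤U = ℕₚ.≤-trans (ℕₚ.m≤m+n ε 2) (ℕₚ.≤-trans ε+2≤T T≤U)
  τ-small : 7 * (T + 2 + 48) ≤ U
  τ-small = ℕₚ.≤-trans (ℕₚ.*-monoʳ-≤ 7 (subst (_≤ T + 170) (sym (ℕₚ.+-assoc T 2 48))
    (ℕₚ.+-monoʳ-≤ T (toWitness {a? = 50 ℕ.≤? 170} tt)))) τ≤U

record Pre {n m : ℕ} (φ : Fin n → Fin n → Maybe (Fin m)) (r : ℕ) : Set where
  field
    φ-sym : ∀ u v → φ u v ≡ φ v u
    φ-loop : ∀ u → φ u u ≡ nothing
    φ-proper : ∀ {u v w c} → φ u v ≡ just c → φ u w ≡ just c → v ≡ w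
    φ-vertex : ∀ u → Cover r (λ v → φ u v ≢ nothing)
    φ-colour : ∀ c → Cover r (λ v → ∃ λ w → φ v w ≡ just c)

record Lists {n m : ℕ} (L : Forbid n m) (r′ : ℕ) : Set where
  field
    L-sym : Symm L
    L-dec : ∀ u v c → Dec (L u v c)
    L-vertex : ∀ u c → Cover r′ (λ v → u ≢ v × L u v c)
    L-edge : ∀ {u v} → u ≢ v → Cover r′ (L u v)

module Phases {n m κ ε U T s : ℕ} (R : Ref n m κ ε) (ν : Numbers n m κ ε U T s) where
  open Numbers ν
  open Ref R
  open Trades R ε≤U 1≤U n-big m-big public

  -- The global data from which an `Env` is obtained by averaging. At most two vertices may be
  -- frozen entirely.
  record Raw (K : Col n m) (X : Forbid n m) : Set₁ where
    field
      X-sym : Symm X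
      Prot : Fin n → Fin n → Set
      special : List (Fin n)
      special-len : length special ≤ 2
      zs : List (Fin n × Fin m)
      zs-len : length zs ≤ T * T
      zs-covers : ∀ {u c} → pt u ≢ nothing → ty c ≢ o → f K u (nb₀ c u) ≢ c → (u , c) ∈ˡ zs
      X-vertex : ∀ {u} c → u ∉ˡ special → Cover s (λ v → X u v c)
      X-edge : ∀ {u v} → ¬ Prot u v → Cover s (X u v)
      Prot-vertex : ∀ {u} → u ∉ˡ special → Cover s (Prot u)

  module FromRaw {K : Col n m} {X : Forbid n m} (raw : Raw K X) where
    open Raw raw

    flipped : List (Fin m × Fin n)
    flipped = map (λ (u , c) → c , u) zs

    opaque
      heavyV : ∃ λ (bad : List (Fin n)) → length bad ≤ T ×
        (∀ v → v ∉ˡ bad → ∃ λ (cs : List (Fin m)) → length cs ≤ T × (∀ {c} → (c , v) ∈ˡ flipped → c ∈ˡ cs))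
      heavyV with heavy-keys T flipped
      ... | bad , l , h = bad , few 1≤T (ℕₚ.≤-trans l (subst (_≤ T * T) (sym (Lₚ.length-map _ zs)) zs-len)) , h

      heavyC : ∃ λ (bad : List (Fin m)) → length bad ≤ T ×
        (∀ c → c ∉ˡ bad → ∃ λ (vs : List (Fin n)) → length vs ≤ T × (∀ {v} → (v , c) ∈ˡ zs → v ∈ˡ vs))
      heavyC with heavy-keys T zs
      ... | bad , l , h = bad , few 1≤T (ℕₚ.≤-trans l zs-len) , h

    hV : List (Fin n)
    hV = proj₁ heavyV

    hC : List (Fin m)
    hC = proj₁ heavyC

    ∞s : List (Fin n)
    ∞s = Cover.elems ∞-cover

    bads : List (Fin n)
    bads = ∞s ++ special ++ hV

    bads-len : length bads ≤ 2 * T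
    bads-len = subst (_≤ 2 * T) (sym (trans (Lₚ.length-++ ∞s) (cong (length ∞s +_) (Lₚ.length-++ special))))
      (ℕₚ.≤-trans (ℕₚ.+-mono-≤ (Cover.bound ∞-cover) (ℕₚ.+-mono-≤ special-len (proj₁ (proj₂ heavyV))))
      (ℕₚ.≤-trans (ℕₚ.≤-reflexive (sym (ℕₚ.+-assoc ε 2 T)))
      (ℕₚ.≤-trans (ℕₚ.+-monoˡ-≤ T ε+2≤T) (ℕₚ.≤-reflexive (cong (T +_) (sym (ℕₚ.+-identityʳ T)))))))

    bads-∞ : ∀ {v} → v ∉ˡ bads → pt v ≢ nothing
    bads-∞ v∉ e = v∉ (Mₚ.∈-++⁺ˡ (Cover.covers ∞-cover e))

    bads-special : ∀ {v} → v ∉ˡ bads → v ∉ˡ special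
    bads-special v∉ v∈ = v∉ (Mₚ.∈-++⁺ʳ ∞s (Mₚ.∈-++⁺ˡ v∈))

    bads-hV : ∀ {v} → v ∉ˡ bads → v ∉ˡ hV
    bads-hV v∉ v∈ = v∉ (Mₚ.∈-++⁺ʳ ∞s (Mₚ.∈-++⁺ʳ special v∈))

    -- Double counting for the field `Z`. As `c` varies, the side opposite to the edge from `a` runs
    -- through edges at `nb₀ h a`, and at most `s` of them forbid `h`. Over all `h` this makes at
    -- most m s spoiled pairs (h , c), so few `c` lie in many of them.
    cell : Fin n → Fin m → List (Fin m × Fin m)
    cell a h with nb₀ h a ∈? special
    ... | yes _ = []
    ... | no p∉ = map (λ q → h , f₀ (nb₀ h a) q) (Cover.elems (X-vertex h p∉))

    cell-len : ∀ a h → length (cell a h) ≤ s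
    cell-len a h with nb₀ h a ∈? special
    ... | yes _ = z≤n
    ... | no p∉ = subst (_≤ s) (sym (Lₚ.length-map _ (Cover.elems (X-vertex h p∉)))) (Cover.bound (X-vertex h p∉))

    cell-covers : ∀ {a A c h} → pt a ≡ just A → ty c ≢ o → ty h ≢ o → ty h ≢ ty c → nb₀ h a ∉ˡ special →
      X (nb₀ h a) (nb₀ h (nb₀ c a)) h → (h , c) ∈ˡ cell a h
    cell-covers {a} {A} {c} {h} pa tc th h≢c p∉ x with nb₀ h a ∈? special
    ... | yes p∈ = ⊥-elim (p∉ p∈)
    ... | no p∉′ = subst (λ z → (h , z) ∈ˡ _)
      (trans (cong (f₀ (nb₀ h a)) (nb₀-comm pa tc th h≢c)) (f₀-nb₀ (pt-nb₀ pa th) tc))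
      (Mₚ.∈-map⁺ (λ q → h , f₀ (nb₀ h a) q) (Cover.covers (X-vertex h p∉′) x))

    opaque
      heavyZ : ∀ a → ∃ λ (bad : List (Fin m)) → length bad ≤ T ×
        (∀ c → c ∉ˡ bad → ∃ λ (hs : List (Fin m)) → length hs ≤ T × (∀ {h} → (h , c) ∈ˡ cell a h → h ∈ˡ hs))
      heavyZ a with heavy-keys T (concatMap (cell a) (allFin m))
      ... | bad , l , k = bad
        , few 1≤T (ℕₚ.≤-trans l (ℕₚ.≤-trans (length-concatMap (cell a) (cell-len a) (allFin m))
            (subst (λ z → z * s ≤ T * T) (sym (length-allFin m)) ms≤T²)))
        , λ c c∉ → let hs , lh , kh = k c c∉ in hs , lh , λ {h} h∈ → kh (∈-concatMap (cell a) (Mₚ.∈-allFin h) h∈)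

    Bad : Fin n → Fin m → Set
    Bad a c = ty c ≢ o × (a ∈ˡ bads ⊎ nb₀ c a ∈ˡ bads ⊎ c ∈ˡ hC ⊎ f K a (nb₀ c a) ≢ c ⊎
      Prot a (nb₀ c a) ⊎ c ∈ˡ proj₁ (heavyZ a))

    W-cover : ∀ {a} → a ∉ˡ bads → Cover T (λ h → ty h ≢ o × f K a (nb₀ h a) ≢ h)
    W-cover {a} a∉ = let cs , l , k = proj₂ (proj₂ heavyV) a (bads-hV a∉) in
      cover cs l λ (th , d) → k (Mₚ.∈-map⁺ (λ (u , c) → c , u) (zs-covers (bads-∞ a∉) th d))

    Bad-vertex : ∀ {a} → a ∉ˡ bads → Cover (6 * T) (Bad a)
    Bad-vertex {a} a∉ = Cover-mono len split
      (Cover-⊎ bads′ (Cover-⊎ (Cover-mono (proj₁ (proj₂ heavyC)) id (Cover-list hC))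
        (Cover-⊎ (W-cover a∉) (Cover-⊎ prot (Cover-mono (proj₁ (proj₂ (heavyZ a))) id (Cover-list _))))))
      where
      pa : pt a ≡ just (proj₁ (part a (bads-∞ a∉)))
      pa = proj₂ (part a (bads-∞ a∉))
      bads′ : Cover (2 * T) (λ c → ty c ≢ o × nb₀ c a ∈ˡ bads)
      bads′ = Cover-image (f₀ a) (λ {c} (tc , b∈) → nb₀ c a , b∈ , f₀-nb₀ pa tc) (Cover-mono bads-len id (Cover-list bads))
      prot : Cover T (λ c → ty c ≢ o × Prot a (nb₀ c a))
      prot = Cover-image (f₀ a) (λ {c} (tc , p) → nb₀ c a , p , f₀-nb₀ pa tc) (Cover-mono s≤T id (Prot-vertex (bads-special a∉)))
      len : 2 * T + (T + (T + (T + T))) ≤ 6 * T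
      len = ℕₚ.≤-reflexive (shape T)
        where
        shape : ∀ t → 2 * t + (t + (t + (t + t))) ≡ 6 * t
        shape = solve-∀
      split : ∀ {c} → Bad a c → _
      split (tc , inj₁ a∈) = ⊥-elim (a∉ a∈)
      split (tc , inj₂ (inj₁ x)) = inj₁ (tc , x)
      split (tc , inj₂ (inj₂ (inj₁ x))) = inj₂ (inj₁ x)
      split (tc , inj₂ (inj₂ (inj₂ (inj₁ x)))) = inj₂ (inj₂ (inj₁ (tc , x)))
      split (tc , inj₂ (inj₂ (inj₂ (inj₂ (inj₁ x))))) = inj₂ (inj₂ (inj₂ (inj₁ (tc , x))))
      split (tc , inj₂ (inj₂ (inj₂ (inj₂ (inj₂ x))))) = inj₂ (inj₂ (inj₂ (inj₂ x)))

    row : Fin n → List (Fin n × Fin m)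
    row v with v ∈? bads
    ... | yes _ = []
    ... | no v∉ = map (v ,_) (Cover.elems (Bad-vertex v∉))

    row-len : ∀ v → length (row v) ≤ 6 * T
    row-len v with v ∈? bads
    ... | yes _ = z≤n
    ... | no v∉ = subst (_≤ 6 * T) (sym (Lₚ.length-map _ (Cover.elems (Bad-vertex v∉)))) (Cover.bound (Bad-vertex v∉))

    full : Fin n → List (Fin n × Fin m)
    full v = map (v ,_) (allFin m)

    full-len : ∀ v → length (full v) ≤ m
    full-len v = ℕₚ.≤-reflexive (trans (Lₚ.length-map _ (allFin m)) (length-allFin m))

    -- A vertex outside `bads` contributes at most 6T bad colours, one of the 2T others is charged
    -- with all `m`. Averaging over this list yields the exceptional colours.
    pairs : List (Fin n × Fin m)
    pairs = concatMap row (allFin n) ++ concatMap full bads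

    pairs-len : length pairs ≤ U * U
    pairs-len = subst (_≤ U * U) (sym (Lₚ.length-++ (concatMap row (allFin n))))
      (ℕₚ.≤-trans (ℕₚ.+-mono-≤
        (subst (λ z → length (concatMap row (allFin n)) ≤ z * (6 * T)) (length-allFin n) (length-concatMap row row-len (allFin n)))
        (ℕₚ.≤-trans (length-concatMap full full-len bads) (ℕₚ.*-monoˡ-≤ m bads-len)))
      total≤U²)

    pairs-cover : ∀ {v c} → Bad v c → (v , c) ∈ˡ pairs
    pairs-cover {v} {c} B with v ∈? bads in eq
    ... | yes v∈ = Mₚ.∈-++⁺ʳ (concatMap row (allFin n)) (∈-concatMap full v∈ (Mₚ.∈-map⁺ (v ,_) (Mₚ.∈-allFin c)))
    ... | no v∉ = Mₚ.∈-++⁺ˡ (∈-concatMap row (Mₚ.∈-allFin v) in-row)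
      where
      in-row : (v , c) ∈ˡ row v
      in-row with v ∈? bads
      ... | yes v∈ = ⊥-elim (v∉ v∈)
      ... | no v∉′ = Mₚ.∈-map⁺ (v ,_) (Cover.covers (Bad-vertex v∉′) B)

    opaque
      heavyB : ∃ λ (bad : List (Fin m)) → length bad ≤ U ×
        (∀ c → c ∉ˡ bad → ∃ λ (vs : List (Fin n)) → length vs ≤ U × (∀ {v} → (v , c) ∈ˡ pairs → v ∈ˡ vs))
      heavyB with heavy-keys U pairs
      ... | bad , l , h = bad , few 1≤U (ℕₚ.≤-trans l pairs-len) , h

    good : ∀ {a c} → ty c ≢ o → ¬ Bad a c → Good K X (T + 2) a c
    good {a} {c} tc ¬B = record
      { pa = pa ; tc = tc
      ; edge = decidable-stable (_ F.≟ _) λ d → ¬B (tc , inj₂ (inj₂ (inj₂ (inj₁ d))))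
      ; Wa = Cover-mono T≤ id (W-cover a∉) ; Wb = Cover-mono T≤ id (W-cover b∉)
      ; Wc = let vs , l , k = proj₂ (proj₂ heavyC) c λ c∈ → ¬B (tc , inj₂ (inj₂ (inj₁ c∈))) in
          cover vs (ℕₚ.≤-trans l T≤) λ (nv , d) → k (zs-covers nv tc d)
      ; Z = Cover-mono ℕₚ.≤-refl split (Cover-⊎ Z₁ Z₂)
      ; E = Cover-mono s≤ id (X-edge λ p → ¬B (tc , inj₂ (inj₂ (inj₂ (inj₂ (inj₁ p))))))
      ; Va = Cover-mono s≤ id (X-vertex c (bads-special a∉))
      ; Vb = Cover-mono s≤ id (X-vertex c (bads-special b∉)) }
      where
      T≤ : T ≤ T + 2
      T≤ = ℕₚ.m≤m+n T 2
      s≤ : s ≤ T + 2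
      s≤ = ℕₚ.≤-trans s≤T T≤
      a∉ : a ∉ˡ bads
      a∉ a∈ = ¬B (tc , inj₁ a∈)
      b∉ : nb₀ c a ∉ˡ bads
      b∉ b∈ = ¬B (tc , inj₂ (inj₁ b∈))
      pa : pt a ≡ just (proj₁ (part a (bads-∞ a∉)))
      pa = proj₂ (part a (bads-∞ a∉))
      Z₁ : Cover T (λ h → (h , c) ∈ˡ cell a h)
      Z₁ = let hs , l , k = proj₂ (proj₂ (heavyZ a)) c λ c∈ → ¬B (tc , inj₂ (inj₂ (inj₂ (inj₂ (inj₂ c∈))))) in cover hs l k
      -- `cell` says nothing if the corner is special. This happens for at most two `h` and is the
      -- reason for T + 2 instead of T.
      Z₂ : Cover 2 (λ h → ty h ≢ o × nb₀ h a ∈ˡ special)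
      Z₂ = Cover-image (f₀ a) (λ {h} (th , p∈) → nb₀ h a , p∈ , f₀-nb₀ pa th) (Cover-mono special-len id (Cover-list special))
      split : ∀ {h} → ty h ≢ o × ty h ≢ ty c × X (nb₀ h a) (nb₀ h (nb₀ c a)) h → _
      split {h} (th , h≢c , x) with nb₀ h a ∈? special
      ... | yes p∈ = inj₂ (th , p∈)
      ... | no p∉ = inj₁ (cell-covers pa tc th h≢c p∉ x)

    env : Env (T + 2) K X
    env = record
      { X-sym = X-sym ; τ-small = τ-small ; Prot = Prot ; special = special
      ; badV = bads ; badC = proj₁ heavyB
      ; badV-len = ℕₚ.≤-trans bads-len 2T≤U
      ; badC-len = proj₁ (proj₂ heavyB)
      ; badV-∞ = bads-∞ ; badV-special = bads-special
      ; NotGood = Bad ; good = good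
      ; good-vertex = λ tc ¬B a∈ → ¬B (tc , inj₁ a∈)
      ; good-edge-free = λ tc ¬B p → ¬B (tc , inj₂ (inj₂ (inj₂ (inj₂ (inj₁ p)))))
      ; NotGood-vertex = λ a∉ → Cover-mono 6T≤U id (Bad-vertex a∉)
      ; NotGood-colour = λ {c} c∉ → let vs , l , k = proj₂ (proj₂ heavyB) c c∉ in cover vs l λ (_ , B) → k (pairs-cover B)
      ; X-vertex = λ c u∉ → Cover-mono s≤U id (X-vertex c u∉)
      ; X-edge = λ ¬p → Cover-mono s≤U id (X-edge ¬p)
      ; Prot-vertex = λ u∉ → Cover-mono s≤U id (Prot-vertex u∉) }
      where
      s≤U : s ≤ U
      s≤U = ℕₚ.≤-trans s≤T T≤U
      7T≤U : 7 * T ≤ U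
      7T≤U = ℕₚ.≤-trans (ℕₚ.*-monoʳ-≤ 7 (ℕₚ.m≤m+n T 170)) τ≤U
      6T≤U : 6 * T ≤ U
      6T≤U = ℕₚ.≤-trans (ℕₚ.*-monoˡ-≤ T (toWitness {a? = 6 ℕ.≤? 7} tt)) 7T≤U
      2T≤U : 2 * T ≤ U
      2T≤U = ℕₚ.≤-trans (ℕₚ.*-monoˡ-≤ T (toWitness {a? = 2 ℕ.≤? 7} tt)) 7T≤U

  -- Prescribing the colour of an edge

  record Disturbed (K : Col n m) (zs : List (Fin n × Fin m)) : Set where
    constructor disturbed
    field
      lists : ∀ {u c} → pt u ≢ nothing → ty c ≢ o → f K u (nb₀ c u) ≢ c → (u , c) ∈ˡ zs

  as-colours : List (Fin n × Fin n) → List (Fin n × Fin m)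
  as-colours = map (λ (u , v) → u , f₀ u v)

  -- A recoloured pair (u , v) can disturb only one colour at `u`, namely `f₀ u v`.
  Disturbed-step : ∀ {K K′ X ch zs} → Step X ch K K′ → Disturbed K zs → Disturbed K′ (zs ++ as-colours ch)
  Disturbed-step {K} {K′} {ch = ch} {zs} st (disturbed D) = disturbed λ {u} {c} nu tc d → go nu tc d
    where
    go : ∀ {u c} → pt u ≢ nothing → ty c ≢ o → f K′ u (nb₀ c u) ≢ c → (u , c) ∈ˡ zs ++ as-colours ch
    go {u} {c} nu tc d with part u nu
    ... | A , pu with Step.at st u (nb₀ c u) (nb₀-≢ pu tc)
    ...   | inj₁ e = Mₚ.∈-++⁺ˡ (D nu tc λ e′ → d (trans e e′))
    ...   | inj₂ (∈ch , _) = Mₚ.∈-++⁺ʳ zs (subst (λ z → (u , z) ∈ˡ as-colours ch) (f₀-nb₀ pu tc)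
      (Mₚ.∈-map⁺ (λ (u , v) → u , f₀ u v) ∈ch))

  length-as : ∀ zs ch → length (zs ++ as-colours ch) ≡ length zs + length ch
  length-as zs ch = trans (Lₚ.length-++ zs) (cong (length zs +_) (Lₚ.length-map _ ch))

  1190≤U : 1190 ≤ U
  1190≤U = ℕₚ.≤-trans (ℕₚ.*-monoʳ-≤ 7 (ℕₚ.m≤n+m 170 T)) τ≤U

  s≤U : s ≤ U
  s≤U = ℕₚ.≤-trans s≤T T≤U

  empty : ∀ {j b} {P : Set} → ¬ P → Cover {j} b (λ _ → P)
  empty ¬p = cover [] z≤n (⊥-elim ∘ ¬p)

  colour-cover : ∀ (K : Col n m) c u → Cover 2 (λ v → f K u v ≡ c)
  -- The vertex `u` itself is included because the diagonal value of `f` may happen to be `c`.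
  colour-cover K c u = cover (u ∷ nb K c u ∷ []) ℕₚ.≤-refl g
    where
    g : ∀ {v} → f K u v ≡ c → v ∈ˡ u ∷ nb K c u ∷ []
    g {v} e with v F.≟ u
    ... | yes v≡u = here v≡u
    ... | no v≢u = there (here (sym (nb-unique K (v≢u ∘ sym) e)))

  module _ {φ : Fin n → Fin n → Maybe (Fin m)} {r : ℕ} (pre : Pre φ r) (r+4≤s : r + 4 ≤ s) where
    open Pre pre

    Sat : Col n m → Fin n → Fin n → Set
    Sat K u v = ∃ λ c → φ u v ≡ just c × f K u v ≡ c

    Sat-sym : ∀ {K u v} → Sat K u v → Sat K v u
    Sat-sym {K} {u} {v} (c , e , e′) = c , trans (φ-sym v u) e , trans (f-sym K v u) e′

    Sat-vertex : ∀ K u → Cover r (Sat K u)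
    Sat-vertex K u = Cover-mono ℕₚ.≤-refl (λ (c , e , _) z → case trans (sym e) z of λ ()) (φ-vertex u)

    -- Every colour is forbidden on an edge that has its prescribed colour already, so a step cannot
    -- touch it.
    Protect : Col n m → Forbid n m
    Protect K u v _ = Sat K u v

    record Assigned (K : Col n m) (x y : Fin n) (c : Fin m) : Set where
      field
        K⁺ : Col n m
        ch : List (Fin n × Fin n)
        ch-len : length ch ≡ 192
        step : Step (Protect K) ch K K⁺
        xy : f K⁺ x y ≡ c

    record Task (x y : Fin n) (c : Fin m) : Set where
      field
        K : Col n m
        zs : List (Fin n × Fin m)
        D : Disturbed K zs
        len : length zs + 192 ≤ T * T
        x≢y : x ≢ y
        φxy : φ x y ≡ just c
        xy≢c : f K x y ≢ c

    -- The c-edges at x and y are first moved to places xa, yb of free choice, keeping the colour c₀ of xy;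
    -- then x y b a is closed up.
    module Assign {x y : Fin n} {c : Fin m} (task : Task x y c) where
      open Task task

      c₀ : Fin m
      c₀ = f K x y

      a₀ b₀ : Fin n
      a₀ = nb K c x
      b₀ = nb K c y

      r+_≤s : ∀ k → {_ : True (k ℕ.≤? 4)} → r + k ≤ s
      r+_≤s k {k≤4} = ℕₚ.≤-trans (ℕₚ.+-monoʳ-≤ r (toWitness k≤4)) r+4≤s

      c≢c₀ : c ≢ c₀
      c≢c₀ e = xy≢c (sym e)
      φ-xc : ∀ {v} → φ x v ≡ just c → v ≡ y
      φ-xc e = φ-proper e φxy
      φ-yc : ∀ {v} → φ y v ≡ just c → v ≡ x
      φ-yc e = φ-proper e (trans (φ-sym y x) φxy)
      a₀≢y : a₀ ≢ y
      a₀≢y e = xy≢c (subst (λ z → f K x z ≡ c) e (f-nb K c x))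
      b₀≢x : b₀ ≢ x
      b₀≢x e = xy≢c (trans (f-sym K x y) (subst (λ z → f K y z ≡ c) e (f-nb K c y)))

      raw₀ : Raw K (Protect K)
      raw₀ = record
        { X-sym = record { flip = Sat-sym {K} } ; Prot = Sat K ; special = [] ; special-len = z≤n
        ; zs = zs ; zs-len = ℕₚ.≤-trans (ℕₚ.m≤m+n _ 192) len ; zs-covers = Disturbed.lists D
        ; X-vertex = λ _ _ → Cover-mono r≤s id (Sat-vertex K _)
        ; X-edge = empty
        ; Prot-vertex = λ _ → Cover-mono r≤s id (Sat-vertex K _) }
        where
        r≤s : r ≤ s
        r≤s = ℕₚ.≤-trans (ℕₚ.m≤m+n r 4) r+4≤s

      -- The first move must spare the colour `c₀`, whose edges `xy`, `ap`, `bq` are wanted for the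
      -- closing, and the edges at `y`, among them `yb₀`.
      P₁ : Fin n → Fin n → Set
      P₁ u v = Sat K u v ⊎ f K u v ≡ c₀ ⊎ u ≡ y ⊎ v ≡ y

      raw₁ : Raw K (λ u v _ → P₁ u v)
      raw₁ = record
        { X-sym = record { flip = λ
            { (inj₁ z) → inj₁ (Sat-sym {K} z) ; (inj₂ (inj₁ z)) → inj₂ (inj₁ (trans (f-sym K _ _) z))
            ; (inj₂ (inj₂ (inj₁ z))) → inj₂ (inj₂ (inj₂ z)) ; (inj₂ (inj₂ (inj₂ z))) → inj₂ (inj₂ (inj₁ z)) } }
        ; Prot = P₁ ; special = y ∷ [] ; special-len = s≤s z≤n
        ; zs = zs ; zs-len = ℕₚ.≤-trans (ℕₚ.m≤m+n _ 192) len ; zs-covers = Disturbed.lists D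
        ; X-vertex = λ _ → around ; X-edge = empty ; Prot-vertex = around }
        where
        around : ∀ {u} → u ∉ˡ y ∷ [] → Cover s (P₁ u)
        around {u} u∉ = Cover-mono (r+ 3 ≤s)
          (λ { (inj₁ z) → inj₁ z ; (inj₂ (inj₁ z)) → inj₂ (inj₁ z)
             ; (inj₂ (inj₂ (inj₁ z))) → ⊥-elim (u∉ (here z)) ; (inj₂ (inj₂ (inj₂ z))) → inj₂ (inj₂ z) })
          (Cover-⊎ (Sat-vertex K u) (Cover-⊎ (colour-cover K c₀ u) (Cover-≡ y)))

      env₀ : Env (T + 2) K (Protect K)
      env₀ = FromRaw.env raw₀
      env₁ : Env (T + 2) K (λ u v _ → P₁ u v)
      env₁ = FromRaw.env raw₁

      B₀ : List (Fin n)
      B₀ = Env.badV env₀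

      B₀-cover : Cover U (_∈ˡ B₀)
      B₀-cover = Cover-mono (Env.badV-len env₀) id (Cover-list B₀)

      φ-colour′ : ∀ c → Cover U (λ v → ∃ λ w → φ v w ≡ just c)
      φ-colour′ c = Cover-mono (ℕₚ.≤-trans (ℕₚ.m≤m+n r 4) (ℕₚ.≤-trans r+4≤s s≤U)) id (φ-colour c)

      Sat-at : Cover U (λ v → Sat K v (nb K c₀ v))
      Sat-at = Cover-mono ℕₚ.≤-refl (λ {v} (d , e , e′) → nb K c₀ v , trans e (cong just (trans (sym e′) (f-nb K c₀ v)))) (φ-colour′ c₀)

      opaque
        M₁ : Moves.Moved env₁ x a₀ (λ _ → ⊥) (λ _ → ⊥)
          ( (_∈ˡ B₀) ∷ (λ v → nb K c₀ v ∈ˡ B₀) ∷ (λ v → Sat K v (nb K c₀ v)) ∷ (_≡ y) ∷ (_≡ nb K c₀ b₀) ∷ [])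
        M₁ = Moves.move env₁ (nb-≢ K c x ∘ sym) (λ { (here e) → x≢y e }) (λ { (here e) → a₀≢y e })
          (λ { (inj₁ (d , e , e′)) → a₀≢y (φ-xc (trans e (cong just (trans (sym e′) (f-nb K c x)))))
             ; (inj₂ (inj₁ e)) → c≢c₀ (trans (sym (f-nb K c x)) e)
             ; (inj₂ (inj₂ (inj₁ e))) → x≢y e ; (inj₂ (inj₂ (inj₂ e))) → a₀≢y e })
          (subst (λ d → Cover U (λ v → P₁ v (nb K d v))) (sym (f-nb K c x))
            (Cover-mono (ℕₚ.≤-trans (r+ 2 ≤s) s≤U)
              (λ { {v} (inj₁ (d , e , e′)) → inj₁ (nb K c v , trans e (cong just (trans (sym e′) (f-nb K c v))))
                 ; {v} (inj₂ (inj₁ e)) → ⊥-elim (c≢c₀ (trans (sym (f-nb K c v)) e))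
                 ; (inj₂ (inj₂ (inj₁ e))) → inj₂ (inj₁ e)
                 ; {v} (inj₂ (inj₂ (inj₂ e))) → inj₂ (inj₂ e) })
              (Cover-⊎ (φ-colour c) (Cover-⊎ (Cover-≡ y) (nb-cover K c (Cover-≡ y))))))
          Cover-⊥ Cover-⊥
          -- The last condition keeps `p` away from `b₀`: the second move starts at `yb₀`, and there
          -- `p` is frozen.
          (B₀-cover ∷ nb-cover K c₀ B₀-cover ∷ Sat-at ∷ one y ∷ one (nb K c₀ b₀) ∷ [])
          (toWitness {a? = 5 ℕ.≤? 20} tt)

      K₁ : Col n m
      K₁ = Moves.Moved.K⁺ M₁
      ch₁ : List (Fin n × Fin n)
      ch₁ = Moves.Moved.ch M₁
      st₁ : Step (λ u v _ → P₁ u v) ch₁ K K₁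
      st₁ = Moves.Moved.step M₁
      a p : Fin n
      a = Moves.Moved.a M₁
      p = nb K c₀ a
      avoids₁ : AvoidsAll ( (_∈ˡ B₀) ∷ (λ v → nb K c₀ v ∈ˡ B₀) ∷ (λ v → Sat K v (nb K c₀ v)) ∷ (_≡ y) ∷ (_≡ nb K c₀ b₀) ∷ []) a
      avoids₁ = proj₂ (proj₂ (Moves.Moved.avoids M₁))
      a∉ : a ∉ˡ B₀
      a∉ = proj₁ avoids₁
      p∉ : p ∉ˡ B₀
      p∉ = proj₁ (proj₂ avoids₁)
      ¬ap : ¬ Sat K a p
      ¬ap = proj₁ (proj₂ (proj₂ avoids₁))
      a≢y : a ≢ y
      a≢y = proj₁ (proj₂ (proj₂ (proj₂ avoids₁)))
      a≢c₀b₀ : a ≢ nb K c₀ b₀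
      a≢c₀b₀ = proj₁ (proj₂ (proj₂ (proj₂ (proj₂ avoids₁))))
      a≢x : a ≢ x
      a≢x = Moves.Moved.a≢x M₁
      xa₁ : f K₁ x a ≡ c
      xa₁ = trans (Moves.Moved.xa M₁) (f-nb K c x)

      keep₁ : ∀ {u v} → u ≢ v → P₁ u v → f K₁ u v ≡ f K u v
      keep₁ {u} {v} u≢v P = [ id , (λ (_ , ¬P) → ⊥-elim (¬P P)) ]′ (Step.at st₁ u v u≢v)

      L : List (Fin n)
      L = a ∷ p ∷ []

      P₂ : Fin n → Fin n → Set
      P₂ u v = Sat K u v ⊎ f K u v ≡ c₀ ⊎ u ∈ˡ L ⊎ v ∈ˡ L

      zs₁ : List (Fin n × Fin m)
      zs₁ = zs ++ as-colours ch₁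

      raw₂ : Raw K₁ (λ u v _ → P₂ u v)
      raw₂ = record
        { X-sym = record { flip = λ
            { (inj₁ z) → inj₁ (Sat-sym {K} z) ; (inj₂ (inj₁ z)) → inj₂ (inj₁ (trans (f-sym K _ _) z))
            ; (inj₂ (inj₂ (inj₁ z))) → inj₂ (inj₂ (inj₂ z)) ; (inj₂ (inj₂ (inj₂ z))) → inj₂ (inj₂ (inj₁ z)) } }
        ; Prot = P₂ ; special = L ; special-len = ℕₚ.≤-refl
        ; zs = zs₁
        ; zs-len = subst (_≤ T * T) (sym (trans (length-as zs ch₁) (cong (length zs +_) (Moves.Moved.ch-len M₁))))
            (ℕₚ.≤-trans (ℕₚ.+-monoʳ-≤ (length zs) (toWitness {a? = 80 ℕ.≤? 192} tt)) len)
        ; zs-covers = Disturbed.lists (Disturbed-step st₁ D)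
        ; X-vertex = λ _ → around ; X-edge = empty ; Prot-vertex = around }
        where
        around : ∀ {u} → u ∉ˡ L → Cover s (P₂ u)
        around {u} u∉ = Cover-mono r+4≤s
          (λ { (inj₁ z) → inj₁ z ; (inj₂ (inj₁ z)) → inj₂ (inj₁ z)
             ; (inj₂ (inj₂ (inj₁ z))) → ⊥-elim (u∉ z) ; (inj₂ (inj₂ (inj₂ z))) → inj₂ (inj₂ z) })
          (Cover-⊎ (Sat-vertex K u) (Cover-⊎ (colour-cover K c₀ u) (Cover-list L)))

      env₂ : Env (T + 2) K₁ (λ u v _ → P₂ u v)
      env₂ = FromRaw.env raw₂

      pa : pt a ≡ just (proj₁ (part a (Env.badV-∞ env₀ a∉)))
      pa = proj₂ (part a (Env.badV-∞ env₀ a∉))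
      pp : pt p ≡ just (proj₁ (part p (Env.badV-∞ env₀ p∉)))
      pp = proj₂ (part p (Env.badV-∞ env₀ p∉))
      A P : Ty
      A = proj₁ (part a (Env.badV-∞ env₀ a∉))
      P = proj₁ (part p (Env.badV-∞ env₀ p∉))

      -- The first move chose `a` itself and so could not freeze `a` and `p`. With `b` and `q`
      -- outside this list, `ab` and `pq` are as they were before it.
      seconds : List (Fin n)
      seconds = map proj₂ ch₁

      Bs : List (Fin n → Set)
      Bs = (_∈ˡ B₀) ∷ (λ v → nb K c₀ v ∈ˡ B₀)
        ∷ (λ v → ∃ λ B → pt v ≡ just B × B ≢ A × Env.NotGood env₀ a (f₀ a v))
        ∷ (λ v → ∃ λ Q → pt (nb K c₀ v) ≡ just Q × Q ≢ P × Env.NotGood env₀ p (f₀ p (nb K c₀ v)))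
        ∷ (λ v → Sat K v (nb K c₀ v)) ∷ (_≡ p) ∷ (_≡ x) ∷ (_∈ˡ seconds) ∷ (λ v → nb K c₀ v ∈ˡ seconds) ∷ []

      y≢p : y ≢ p
      y≢p e = a≢x (f-inj K (a≢y ∘ sym) (x≢y ∘ sym)
        (trans (trans (cong (λ z → f K z a) e) (trans (f-sym K p a) (f-nb K c₀ a))) (f-sym K x y)))

      yb₀ : f K₁ y b₀ ≡ c
      yb₀ = trans (keep₁ (nb-≢ K c y ∘ sym) (inj₂ (inj₂ (inj₁ refl)))) (f-nb K c y)

      b₀≢a : b₀ ≢ a
      b₀≢a e = x≢y (f-inj K₁ a≢x a≢y (trans (f-sym K₁ a x) (trans xa₁ (sym (trans (f-sym K₁ a y) (subst (λ z → f K₁ y z ≡ c) e yb₀))))))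

      b₀≢p : b₀ ≢ p
      b₀≢p e = a≢c₀b₀ (trans (sym (nb-nb K c₀ a)) (cong (nb K c₀) (sym e)))

      seconds-cover : Cover U (_∈ˡ seconds)
      seconds-cover = Cover-mono (subst (_≤ U) (sym (trans (Lₚ.length-map proj₂ ch₁) (Moves.Moved.ch-len M₁)))
        (ℕₚ.≤-trans (toWitness {a? = 80 ℕ.≤? 1190} tt) 1190≤U)) id (Cover-list seconds)

      opaque
        M₂ : Moves.Moved env₂ y b₀ (λ v → pt v ≡ just A) (λ v → pt (nb K c₀ v) ≡ just P) Bs
        M₂ = Moves.move env₂ (nb-≢ K c y ∘ sym)
          (λ { (here e) → a≢y (sym e) ; (there (here e)) → y≢p e })
          (λ { (here e) → b₀≢a e ; (there (here e)) → b₀≢p e })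
          (λ { (inj₁ (d , e , e′)) → b₀≢x (φ-yc (trans e (cong just (trans (sym e′) (f-nb K c y)))))
             ; (inj₂ (inj₁ e)) → c≢c₀ (trans (sym (f-nb K c y)) e)
             ; (inj₂ (inj₂ (inj₁ (here e)))) → a≢y (sym e) ; (inj₂ (inj₂ (inj₁ (there (here e))))) → y≢p e
             ; (inj₂ (inj₂ (inj₂ (here e)))) → b₀≢a e ; (inj₂ (inj₂ (inj₂ (there (here e))))) → b₀≢p e })
          (subst (λ d → Cover U (λ v → P₂ v (nb K₁ d v))) (sym yb₀)
            (Cover-mono (ℕₚ.≤-trans r+4≤s s≤U)
              (λ { {v} (inj₁ S@(d , e , e′)) → inj₁ (nb K₁ c v , trans e (cong just (trans (sym e′)
                     (trans (sym (keep₁ (nb-≢ K₁ c v ∘ sym) (inj₁ S))) (f-nb K₁ c v)))))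
                 ; {v} (inj₂ (inj₁ e)) → ⊥-elim (c≢c₀ (trans (sym (f-nb K₁ c v))
                     (trans (keep₁ (nb-≢ K₁ c v ∘ sym) (inj₂ (inj₁ e))) e)))
                 ; (inj₂ (inj₂ (inj₁ e))) → inj₂ (inj₁ e)
                 ; {v} (inj₂ (inj₂ (inj₂ e))) → inj₂ (inj₂ e) })
              (Cover-⊎ (φ-colour c) (Cover-⊎ (Cover-list L) (nb-cover K₁ c (Cover-list L))))))
          -- The two big conditions left to the caller: `b` and `a` shall lie in different parts,
          -- and so shall `q` and `p`.
          (pt-cover A) (nb-cover K c₀ (pt-cover P))
          (B₀-cover ∷ nb-cover K c₀ B₀-cover ∷ Moves.good-ends env₀ pa a∉ ∷ nb-cover K c₀ (Moves.good-ends env₀ pp p∉)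
            ∷ Sat-at ∷ one p ∷ one x ∷ seconds-cover ∷ nb-cover K c₀ seconds-cover ∷ [])
          (toWitness {a? = 9 ℕ.≤? 20} tt)

      K₂ : Col n m
      K₂ = Moves.Moved.K⁺ M₂
      ch₂ : List (Fin n × Fin n)
      ch₂ = Moves.Moved.ch M₂
      st₂ : Step (λ u v _ → P₂ u v) ch₂ K₁ K₂
      st₂ = Moves.Moved.step M₂
      b q : Fin n
      b = Moves.Moved.a M₂
      q = nb K c₀ b

      keep₂ : ∀ {u v} → u ≢ v → P₂ u v → f K₂ u v ≡ f K₁ u v
      keep₂ {u} {v} u≢v P = [ id , (λ (_ , ¬P) → ⊥-elim (¬P P)) ]′ (Step.at st₂ u v u≢v)

      keep-Sat : ∀ {u v} → u ≢ v → Sat K u v → f K₂ u v ≡ f K u v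
      keep-Sat u≢v S = trans (keep₂ u≢v (inj₁ S)) (keep₁ u≢v (inj₁ S))

      keep-c₀ : ∀ {u v} → u ≢ v → f K u v ≡ c₀ → f K₂ u v ≡ c₀
      keep-c₀ u≢v e = trans (keep₂ u≢v (inj₂ (inj₁ e))) (trans (keep₁ u≢v (inj₂ (inj₁ e))) e)

      yb : f K₂ y b ≡ c
      yb = trans (Moves.Moved.xa M₂) yb₀
      xa : f K₂ x a ≡ c
      xa = trans (keep₂ (a≢x ∘ sym) (inj₂ (inj₂ (inj₂ (here refl))))) xa₁

      Sat-c : ∀ {u v} → u ≢ v → f K₂ u v ≡ c → Sat K u v → φ u v ≡ just c
      Sat-c u≢v e S@(d , e₁ , e₂) = trans e₁ (cong just (trans (sym e₂) (trans (sym (keep-Sat u≢v S)) e)))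

      record Closing : Set where
        field
          {B Q} : Ty
          pb : pt b ≡ just B
          pq : pt q ≡ just Q
          b∉A : pt b ≢ just A
          q∉P : pt q ≢ just P
          Gab : ¬ (∃ λ B → pt b ≡ just B × B ≢ A × Env.NotGood env₀ a (f₀ a b))
          Gpq : ¬ (∃ λ Q → pt q ≡ just Q × Q ≢ P × Env.NotGood env₀ p (f₀ p q))
          ¬bq : ¬ Sat K b q
          b≢p : b ≢ p
          b≢x : b ≢ x
          b∉s : b ∉ˡ seconds
          q∉s : q ∉ˡ seconds

        B≢A : B ≢ A
        B≢A e = b∉A (trans pb (cong just e))
        Q≢P : Q ≢ P
        Q≢P e = q∉P (trans pq (cong just e))
        e₁ e₂ : Fin m
        e₁ = f₀ a b
        e₂ = f₀ p q
        b≡ : nb₀ e₁ a ≡ b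
        b≡ = nb₀-f₀ pa pb B≢A
        q≡ : nb₀ e₂ p ≡ q
        q≡ = nb₀-f₀ pp pq Q≢P
        te₁ : ty e₁ ≢ o
        te₁ e = B≢A (sym (⊕-self A B (trans (sym (ty-f₀ pa pb B≢A)) e)))
        te₂ : ty e₂ ≢ o
        te₂ e = Q≢P (sym (⊕-self P Q (trans (sym (ty-f₀ pp pq Q≢P)) e)))
        ¬Gab : ¬ Env.NotGood env₀ a e₁
        ¬Gab z = Gab (B , pb , B≢A , z)
        ¬Gpq : ¬ Env.NotGood env₀ p e₂
        ¬Gpq z = Gpq (Q , pq , Q≢P , z)
        ¬ab : ¬ Sat K a b
        ¬ab = subst (λ z → ¬ Sat K a z) b≡ (Env.good-edge-free env₀ te₁ ¬Gab)
        ¬pq : ¬ Sat K p q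
        ¬pq = subst (λ z → ¬ Sat K p z) q≡ (Env.good-edge-free env₀ te₂ ¬Gpq)
        unmoved : ∀ {u v} → u ≢ v → v ∉ˡ seconds → f K₁ u v ≡ f K u v
        unmoved {u} {v} u≢v v∉ = [ id , (λ (∈ch , _) → ⊥-elim (v∉ (Mₚ.∈-map⁺ proj₂ ∈ch))) ]′ (Step.at st₁ u v u≢v)
        -- Goodness is known for the colouring before the moves and survives them, with 80 more
        -- exceptions for each: 2 + 80 + 80 = 162.
        push : ∀ {u e v} → nb₀ e u ≡ v → v ∉ˡ seconds → u ∈ˡ L → Good K (Protect K) (T + 2) u e → Good K₂ (Protect K) (T + 162) u e
        push {u} {e} refl v∉ u∈ G = subst (λ k → Good K₂ (Protect K) k u e)
          (trans (cong₂ (λ i j → T + 2 + i + j) (Moves.Moved.ch-len M₁) (Moves.Moved.ch-len M₂))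
            (trans (ℕₚ.+-assoc (T + 2) 80 80) (ℕₚ.+-assoc T 2 160)))
          (Good-step st₂ G₁ (trans (keep₂ u≢ (inj₂ (inj₂ (inj₁ u∈)))) (Good.edge G₁)))
          where
          u≢ : u ≢ nb₀ e u
          u≢ = nb₀-≢ (Good.pa G) (Good.tc G)
          G₁ : Good K₁ (Protect K) (T + 2 + length ch₁) u e
          G₁ = Good-step st₁ G (trans (unmoved u≢ v∉) (Good.edge G))
        a≢p : a ≢ p
        a≢p = nb-≢ K c₀ a ∘ sym
        b≢q : b ≢ q
        b≢q = nb-≢ K c₀ b ∘ sym
        b≢y : b ≢ y
        b≢y = Moves.Moved.a≢x M₂
        F : Finished K₂ (Protect K) x y a c₀ c
        F = finish (record { flip = Sat-sym {K} }) {τ = T + 162}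
          (ℕₚ.≤-trans (ℕₚ.*-monoʳ-≤ 7 (ℕₚ.+-monoʳ-≤ T (toWitness {a? = 162 ℕ.≤? 170} tt))) τ≤U) record
          { G₁ = push b≡ b∉s (here refl) (Env.good env₀ te₁ ¬Gab)
          ; G₂ = push q≡ q∉s (there (here refl)) (Env.good env₀ te₂ ¬Gpq)
          ; b≡ = b≡ ; q≡ = q≡
          ; x≢y = x≢y ; x≢a = a≢x ∘ sym ; x≢b = b≢x ∘ sym ; y≢a = a≢y ∘ sym ; y≢b = b≢y ∘ sym
          ; a≢p = a≢p ; b≢q = b≢q ; b≢p = b≢p
          ; xy = keep-c₀ x≢y refl ; xa = xa ; yb = yb ; ap = keep-c₀ a≢p (f-nb K c₀ a) ; bq = keep-c₀ b≢q (f-nb K c₀ b)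
          ; Xxy = λ { (d , e , e′) → xy≢c (trans e′ (just-injective (trans (sym e) φxy))) }
          ; Xxa = λ S → a≢y (φ-xc (Sat-c (a≢x ∘ sym) xa S))
          ; Xyb = λ S → b≢x (φ-yc (Sat-c (b≢y ∘ sym) yb S))
          ; Xab = ¬ab ; Xab₀ = ¬ab ; Xpq = ¬pq ; Xap = empty ¬ap ; Xbq = empty ¬bq }

        assigned : Assigned K x y c
        assigned = record
          { K⁺ = Finished.K⁺ F
          ; ch = ch₁ ++ ch₂ ++ Finished.ch F
          ; ch-len = trans (Lₚ.length-++ ch₁) (cong₂ _+_ (Moves.Moved.ch-len M₁)
              (trans (Lₚ.length-++ ch₂) (cong₂ _+_ (Moves.Moved.ch-len M₂) (Finished.ch-len F))))
          ; step = Step-trans (Step-mono inj₁ st₁) (Step-trans (Step-mono inj₁ st₂) (Finished.step F))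
          ; xy = Finished.xy F }

      opaque
        done : Assigned K x y c
        done = close (Moves.Moved.avoids M₂)
          where
          close : pt b ≢ just A × pt q ≢ just P × AvoidsAll Bs b → Assigned K x y c
          close (b∉A , q∉P , b∉ , q∉ , Gab , Gpq , ¬bq , b≢p , b≢x , b∉s , q∉s , _) = Closing.assigned record
            { pb = proj₂ (part b (Env.badV-∞ env₀ b∉)) ; pq = proj₂ (part q (Env.badV-∞ env₀ q∉))
            ; b∉A = b∉A ; q∉P = q∉P ; Gab = Gab ; Gpq = Gpq ; ¬bq = ¬bq ; b≢p = b≢p ; b≢x = b≢x ; b∉s = b∉s ; q∉s = q∉s }

  -- Extending a precoloring and removing conflicts, edge by edge

  module _ {φ : Fin n → Fin n → Maybe (Fin m)} {r : ℕ} (pre : Pre φ r) (r+4≤s : r + 4 ≤ s) where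
    open Pre pre

    loopless : ∀ {u v c} → φ u v ≡ just c → u ≢ v
    loopless {u} e refl with trans (sym e) (φ-loop u)
    ... | ()

    record Satisfied (K : Col n m) (todo : List (Fin n × Fin n)) : Set where
      field
        K⁺ : Col n m
        ch : List (Fin n × Fin n)
        ch-len : length ch ≤ 192 * length todo
        step : Step (Protect pre r+4≤s K) ch K K⁺
        sat : ∀ {u v c} → (u , v) ∈ˡ todo → φ u v ≡ just c → f K⁺ u v ≡ c

    keeps : ∀ {K K⁺ ch u v c} → Step (Protect pre r+4≤s K) ch K K⁺ → φ u v ≡ just c → f K u v ≡ c → f K⁺ u v ≡ c
    keeps {u = u} {v} st e e′ with Step.at st u v (loopless e)
    ... | inj₁ eq = trans eq e′
    ... | inj₂ (_ , ¬P) = ⊥-elim (¬P (_ , e , e′))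

    budget-tail : ∀ {a l} k {b} → a + k * suc l ≤ b → a + k * l ≤ b
    budget-tail {a} {l} k h = ℕₚ.≤-trans (ℕₚ.+-monoʳ-≤ a (ℕₚ.*-monoʳ-≤ k (ℕₚ.n≤1+n l))) h

    budget-head : ∀ {a l} k {b} → a + k * suc l ≤ b → a + k ≤ b
    budget-head {a} {l} k h = ℕₚ.≤-trans (ℕₚ.+-monoʳ-≤ a (subst (k ≤_) (sym (ℕₚ.*-suc k l)) (ℕₚ.m≤m+n k _))) h

    budget-next : ∀ {zs : List (Fin n × Fin m)} {ch l} k {b} → length ch ≡ k → length zs + k * suc l ≤ b → length (zs ++ as-colours ch) + k * l ≤ b
    budget-next {zs} {ch} {l} k {b} e h = subst (λ z → z + k * l ≤ b) (sym (trans (length-as zs ch) (cong (length zs +_) e)))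
      (subst (_≤ b) (trans (cong (length zs +_) (ℕₚ.*-suc k l)) (sym (ℕₚ.+-assoc (length zs) k (k * l)))) h)

    -- Protection is renewed with every edge. What was satisfied at the start stays satisfied, so
    -- the later steps also respect the protection of the initial colouring.
    satisfy : ∀ todo (K : Col n m) zs → Disturbed K zs → length zs + 192 * length todo ≤ T * T → Satisfied K todo
    satisfy [] K zs D l = record { K⁺ = K ; ch = [] ; ch-len = z≤n ; step = Step-refl ; sat = λ () }
    satisfy ((x , y) ∷ todo) K zs D l with φ x y in φxy
    ... | nothing = record
      { K⁺ = K⁺ ; ch = ch ; ch-len = ℕₚ.≤-trans ch-len (ℕₚ.*-monoʳ-≤ 192 (ℕₚ.n≤1+n (length todo))) ; step = step
      ; sat = λ { (here refl) e → case trans (sym e) φxy of λ () ; (there i) e → sat i e } }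
      where open Satisfied (satisfy todo K zs D (budget-tail 192 l))
    ... | just c with f K x y F.≟ c
    ...   | yes xy≡c = record
      { K⁺ = K⁺ ; ch = ch ; ch-len = ℕₚ.≤-trans ch-len (ℕₚ.*-monoʳ-≤ 192 (ℕₚ.n≤1+n (length todo))) ; step = step
      ; sat = λ { (here refl) e → keeps {K} step e (trans xy≡c (just-injective (trans (sym φxy) e))) ; (there i) e → sat i e } }
      where open Satisfied (satisfy todo K zs D (budget-tail 192 l))
    ...   | no xy≢c = record
      { K⁺ = K⁺ ; ch = A.ch ++ ch
      ; ch-len = subst (_≤ 192 * suc (length todo)) (sym (Lₚ.length-++ A.ch))
          (subst (length A.ch + length ch ≤_) (sym (ℕₚ.*-suc 192 (length todo))) (ℕₚ.+-mono-≤ (ℕₚ.≤-reflexive A.ch-len) ch-len))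
      ; step = Step-trans A.step (Step-mono (λ (d , e , e′) → d , e , keeps {K} A.step e e′) step)
      ; sat = λ { (here refl) e → keeps {A.K⁺} step e (trans A.xy (just-injective (trans (sym φxy) e))) ; (there i) e → sat i e } }
      where
      assignment : Assigned pre r+4≤s K x y c
      assignment = Assign.done pre r+4≤s record
        { K = K ; zs = zs ; D = D ; len = budget-head 192 l ; x≢y = loopless φxy ; φxy = φxy ; xy≢c = xy≢c }
      module A = Assigned assignment
      open Satisfied (satisfy todo A.K⁺ (zs ++ as-colours A.ch) (Disturbed-step A.step D) (budget-next {zs} {A.ch} 192 A.ch-len l))

    module _ {L : Forbid n m} {r′ : ℕ} (lists : Lists L r′) (r+r′≤s : r + r′ ≤ s)
      (compatible : ∀ {u v c} → φ u v ≡ just c → ¬ L u v c) where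
      open Lists lists

      Extends : Col n m → Set
      Extends K = ∀ {u v c} → φ u v ≡ just c → f K u v ≡ c

      X : Forbid n m
      X u v c = φ u v ≢ nothing ⊎ (u ≢ v × L u v c)

      raw : ∀ {K : Col n m} {zs} → Disturbed K zs → length zs ≤ T * T → Raw K X
      raw {K} {zs} D l = record
        { X-sym = record { flip = λ
            { {u} {v} (inj₁ z) → inj₁ (λ e → z (trans (φ-sym u v) e))
            ; (inj₂ (d , z)) → inj₂ ((λ e → d (sym e)) , flip L-sym z) } }
        ; Prot = λ u v → φ u v ≢ nothing ; special = [] ; special-len = z≤n
        ; zs = zs ; zs-len = l ; zs-covers = Disturbed.lists D
        ; X-vertex = λ {u} c _ → Cover-mono r+r′≤s id (Cover-⊎ (φ-vertex u) (L-vertex u c))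
        ; X-edge = λ {u} {v} ¬P → edge u v ¬P
        ; Prot-vertex = λ {u} _ → Cover-mono (ℕₚ.≤-trans (ℕₚ.m≤m+n r r′) r+r′≤s) id (φ-vertex u) }
        where
        edge : ∀ u v → ¬ (φ u v ≢ nothing) → Cover s (X u v)
        edge u v ¬P with u F.≟ v
        ... | yes u≡v = empty-at (λ { (inj₁ z) → ¬P z ; (inj₂ (d , _)) → d u≡v })
          where
          empty-at : (∀ {c} → ¬ X u v c) → Cover s (X u v)
          empty-at ¬X = cover [] z≤n (λ x → ⊥-elim (¬X x))
        ... | no u≢v = Cover-mono (ℕₚ.≤-trans (ℕₚ.m≤n+m r′ r) r+r′≤s)
          (λ { (inj₁ z) → ⊥-elim (¬P z) ; (inj₂ (_ , z)) → z }) (L-edge u≢v)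

      Extends-step : ∀ {K K′ ch} → Step X ch K K′ → Extends K → Extends K′
      Extends-step st ext {u} {v} e with Step.at st u v (loopless e)
      ... | inj₁ eq = trans eq (ext e)
      ... | inj₂ (_ , ¬X) = ⊥-elim (¬X (inj₁ λ z → case trans (sym e) z of λ ()))

      -- New colours are allowed ones, so a conflict after the step sits on an edge that kept its
      -- colour and was in conflict before; `xy` did not keep its colour.
      conflicts-step : ∀ {K K′ ch x y todo} → Step X ch K K′ → f K′ x y ≢ f K x y →
        (∀ u v → u ≢ v → L u v (f K u v) → (u , v) ∈ˡ (x , y) ∷ todo) →
        ∀ u v → u ≢ v → L u v (f K′ u v) → (u , v) ∈ˡ todo
      conflicts-step st xy conf u v u≢v z with Step.at st u v u≢v
      ... | inj₂ (_ , ¬X) = ⊥-elim (¬X (inj₂ (u≢v , z)))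
      ... | inj₁ eq with conf u v u≢v (subst (L u v) eq z)
      ...   | there i = i
      ...   | here refl = ⊥-elim (xy eq)

      resolve : ∀ todo (K : Col n m) zs → Disturbed K zs → length zs + 80 * length todo ≤ T * T → Extends K →
        (∀ u v → u ≢ v → L u v (f K u v) → (u , v) ∈ˡ todo) →
        ∃ λ K⁺ → Extends K⁺ × (∀ u v → u ≢ v → ¬ L u v (f K⁺ u v))
      resolve [] K zs D l ext conf = K , ext , λ u v u≢v z → case conf u v u≢v z of λ ()
      resolve ((x , y) ∷ todo) K zs D l ext conf with x F.≟ y
      ... | yes refl = resolve todo K zs D (budget-tail 80 l) ext
        λ u v u≢v z → case conf u v u≢v z of λ { (here refl) → ⊥-elim (u≢v refl) ; (there i) → i }
      ... | no x≢y with L-dec x y (f K x y)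
      ...   | no ok = resolve todo K zs D (budget-tail 80 l) ext
        λ u v u≢v z → case conf u v u≢v z of λ { (here refl) → ⊥-elim (ok z) ; (there i) → i }
      ...   | yes bad = resolve todo M.K⁺ (zs ++ as-colours M.ch) (Disturbed-step M.step D) (budget-next {zs} {M.ch} 80 M.ch-len l)
        (Extends-step M.step ext) (conflicts-step M.step M.xy conf)
        where
        uncoloured : ∀ k → φ x y ≡ k → ¬ (φ x y ≢ nothing)
        uncoloured nothing e ≢n = ≢n e
        uncoloured (just c) e _ = compatible e (subst (L x y) (ext e) bad)
        same-colour : ∀ v k → φ v (nb K (f K x y) v) ≡ k → φ v (nb K (f K x y) v) ≢ nothing →
          ∃ λ w → φ v w ≡ just (f K x y)
        same-colour v nothing e ≢n = ⊥-elim (≢n e)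
        same-colour v (just d) e _ = nb K (f K x y) v , trans e (cong just (trans (sym (ext e)) (f-nb K (f K x y) v)))
        moved : Moves.Moved (FromRaw.env (raw D (ℕₚ.≤-trans (ℕₚ.m≤m+n _ _) l))) x y (λ _ → ⊥) (λ _ → ⊥) []
        moved = Moves.move (FromRaw.env (raw D (ℕₚ.≤-trans (ℕₚ.m≤m+n _ _) l))) x≢y (λ ()) (λ ())
            (λ ≢n → uncoloured (φ x y) refl ≢n)
            (Cover-mono (ℕₚ.≤-trans (ℕₚ.m≤m+n r 4) (ℕₚ.≤-trans r+4≤s s≤U))
              (λ {v} ≢n → same-colour v (φ v (nb K (f K x y) v)) refl ≢n) (φ-colour (f K x y)))
            Cover-⊥ Cover-⊥ [] z≤n
        module M = Moves.Moved moved

-- Construction of the pattern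

injective-onto : ∀ {m} (g : Fin m → Fin m) → (∀ {i j} → g i ≡ g j → i ≡ j) → ∀ c → ∃ λ j → g j ≡ c
injective-onto {suc k} g inj c with Fₚ.any? (λ j → g j F.≟ c)
... | yes e = e
... | no ¬e = ⊥-elim (ℕₚ.<-irrefl refl (Fₚ.injective⇒≤ {f = λ j → F.punchOut {i = c} (λ e → ¬e (j , sym e))}
  λ {i} {j} e → inj (Fₚ.punchOut-injective (λ e → ¬e (i , sym e)) (λ e → ¬e (j , sym e)) e)))

-- With one colour fewer than vertices, injectivity at a vertex forces every colour to occur there.
mkCol : ∀ {m} (f : Fin (suc m) → Fin (suc m) → Fin m) → (∀ u v → f u v ≡ f v u) →
  (∀ {u v w} → u ≢ v → u ≢ w → f u v ≡ f u w → v ≡ w) → Col (suc m) m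
mkCol {m} f f-sym inj = record
  { f = f ; nb = λ c u → F.punchIn u (at u c) ; f-sym = f-sym
  ; f-nb = λ c u → proj₂ (onto u c)
  ; nb-≢ = λ c u → Fₚ.punchInᵢ≢i u (at u c)
  ; nb-f = λ u v u≢v → inj (Fₚ.punchInᵢ≢i u _ ∘ sym) u≢v (proj₂ (onto u (f u v))) }
  where
  onto : ∀ u c → ∃ λ j → f u (F.punchIn u j) ≡ c
  onto u = injective-onto (λ j → f u (F.punchIn u j))
    λ {i} {j} e → Fₚ.punchIn-injective u i j (inj (Fₚ.punchInᵢ≢i u i ∘ sym) (Fₚ.punchInᵢ≢i u j ∘ sym) e)
  at : ∀ u → Fin m → Fin m
  at u c = proj₁ (onto u c)

module Cyclic (k : ℕ) where

  Z : Set
  Z = Fin (suc k)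

  opaque
    residue : ℕ → Z
    residue x = x DM.mod suc k

    toℕ-residue : ∀ x → toℕ (residue x) ≡ x % suc k
    toℕ-residue x = Fₚ.toℕ-fromℕ< (DM.m%n<n x (suc k))

  residue-cong : ∀ {x y} → x % suc k ≡ y % suc k → residue x ≡ residue y
  residue-cong {x} {y} e = Fₚ.toℕ-injective (trans (toℕ-residue x) (trans e (sym (toℕ-residue y))))

  residue-toℕ : ∀ i → residue (toℕ i) ≡ i
  residue-toℕ i = Fₚ.toℕ-injective (trans (toℕ-residue (toℕ i)) (DM.m<n⇒m%n≡m (Fₚ.toℕ<n i)))

  infixl 6 _+ᶻ_
  _+ᶻ_ : Z → Z → Z
  i +ᶻ j = residue (toℕ i + toℕ j)

  neg : Z → Z
  neg i = residue (suc k ∸ toℕ i)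

  residue-+ : ∀ x y → residue x +ᶻ residue y ≡ residue (x + y)
  residue-+ x y = residue-cong (trans (cong₂ (λ i j → (i + j) % suc k) (toℕ-residue x) (toℕ-residue y))
    (sym (DM.%-distribˡ-+ x y (suc k))))

  +ᶻ-comm : ∀ i j → i +ᶻ j ≡ j +ᶻ i
  +ᶻ-comm i j = cong residue (ℕₚ.+-comm (toℕ i) (toℕ j))

  +ᶻ-assoc : ∀ i j l → (i +ᶻ j) +ᶻ l ≡ i +ᶻ (j +ᶻ l)
  +ᶻ-assoc i j l = begin
    (i +ᶻ j) +ᶻ l                               ≡⟨ cong ((i +ᶻ j) +ᶻ_) (residue-toℕ l) ⟨
    residue (toℕ i + toℕ j) +ᶻ residue (toℕ l)  ≡⟨ residue-+ (toℕ i + toℕ j) (toℕ l) ⟩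
    residue (toℕ i + toℕ j + toℕ l)             ≡⟨ cong residue (ℕₚ.+-assoc (toℕ i) (toℕ j) (toℕ l)) ⟩
    residue (toℕ i + (toℕ j + toℕ l))           ≡⟨ residue-+ (toℕ i) (toℕ j + toℕ l) ⟨
    residue (toℕ i) +ᶻ (j +ᶻ l)                 ≡⟨ cong (_+ᶻ (j +ᶻ l)) (residue-toℕ i) ⟩
    i +ᶻ (j +ᶻ l)                               ∎
    where open ≡-Reasoning

  +ᶻ-identityˡ : ∀ i → residue 0 +ᶻ i ≡ i
  +ᶻ-identityˡ i = trans (cong (residue 0 +ᶻ_) (sym (residue-toℕ i))) (trans (residue-+ 0 (toℕ i)) (residue-toℕ i))

  +ᶻ-inverseʳ : ∀ i → i +ᶻ neg i ≡ residue 0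
  +ᶻ-inverseʳ i = begin
    i +ᶻ neg i                                ≡⟨ cong (_+ᶻ neg i) (residue-toℕ i) ⟨
    residue (toℕ i) +ᶻ neg i                  ≡⟨ residue-+ (toℕ i) (suc k ∸ toℕ i) ⟩
    residue (toℕ i + (suc k ∸ toℕ i))         ≡⟨ cong residue (ℕₚ.m+[n∸m]≡n (ℕₚ.<⇒≤ (Fₚ.toℕ<n i))) ⟩
    residue (suc k)                           ≡⟨ residue-cong (DM.n%n≡0 (suc k)) ⟩
    residue 0                                 ∎
    where open ≡-Reasoning

  group : AbelianGroup 0ℓ 0ℓ
  group = record
    { Carrier = Z ; _≈_ = _≡_ ; _∙_ = _+ᶻ_ ; ε = residue 0 ; _⁻¹ = neg
    ; isAbelianGroup = record
      { isGroup = record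
        { isMonoid = record
          { isSemigroup = record
            { isMagma = record { isEquivalence = isEquivalence ; ∙-cong = cong₂ _+ᶻ_ }
            ; assoc = +ᶻ-assoc }
          ; identity = +ᶻ-identityˡ , λ i → trans (+ᶻ-comm i (residue 0)) (+ᶻ-identityˡ i) }
        ; inverse = (λ i → trans (+ᶻ-comm (neg i) i) (+ᶻ-inverseʳ i)) , +ᶻ-inverseʳ
        ; ⁻¹-cong = cong neg }
      ; comm = +ᶻ-comm } }

  open AbGroup group public using () renaming (∙-cancelˡ to +ᶻ-cancelˡ; ⁻¹-involutive to neg-involutive; ⁻¹-∙-comm to neg-+)

  infixl 6 _-ᶻ_
  _-ᶻ_ : Z → Z → Z
  i -ᶻ j = i +ᶻ neg j

  i+[a-i] : ∀ i a → i +ᶻ (a -ᶻ i) ≡ a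
  i+[a-i] i a = begin
    i +ᶻ (a +ᶻ neg i)  ≡⟨ cong (i +ᶻ_) (+ᶻ-comm a (neg i)) ⟩
    i +ᶻ (neg i +ᶻ a)  ≡⟨ +ᶻ-assoc i (neg i) a ⟨
    i -ᶻ i +ᶻ a        ≡⟨ cong (_+ᶻ a) (+ᶻ-inverseʳ i) ⟩
    residue 0 +ᶻ a     ≡⟨ +ᶻ-identityˡ a ⟩
    a                  ∎
    where open ≡-Reasoning

  difference : ∀ {i j a} → i +ᶻ j ≡ a → a -ᶻ i ≡ j
  difference {i} {j} {a} e = +ᶻ-cancelˡ i (a -ᶻ i) j (trans (i+[a-i] i a) (sym e))

  neg-exchange : ∀ a b i → neg b -ᶻ (a -ᶻ i) ≡ neg a -ᶻ (b -ᶻ i)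
  neg-exchange a b i = begin
    neg b -ᶻ (a -ᶻ i)    ≡⟨ neg-+ b (a -ᶻ i) ⟩
    neg (b +ᶻ (a -ᶻ i))  ≡⟨ cong neg swapped ⟩
    neg (a +ᶻ (b -ᶻ i))  ≡⟨ neg-+ a (b -ᶻ i) ⟨
    neg a -ᶻ (b -ᶻ i)    ∎
    where
    open ≡-Reasoning
    swapped : b +ᶻ (a -ᶻ i) ≡ a +ᶻ (b -ᶻ i)
    swapped = begin
      b +ᶻ (a +ᶻ neg i)  ≡⟨ +ᶻ-assoc b a (neg i) ⟨
      b +ᶻ a -ᶻ i        ≡⟨ cong (_-ᶻ i) (+ᶻ-comm b a) ⟩
      a +ᶻ b -ᶻ i        ≡⟨ +ᶻ-assoc a b (neg i) ⟩
      a +ᶻ (b +ᶻ neg i)  ∎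

-- Vertex 0 plays the role of ∞ and 1 + i is the residue i modulo the odd number 2w + 1.
module RoundRobin (w : ℕ) where
  open Cyclic (w + w)

  -- The inverse of 2 modulo 2w + 1 is w + 1.
  double-injective : ∀ {i j} → i +ᶻ i ≡ j +ᶻ j → i ≡ j
  double-injective {i} {j} e = trans (sym (halve i)) (trans (cong half e) (halve j))
    where
    half : Z → Z
    half i = residue (suc w * toℕ i)
    halve : ∀ i → half (i +ᶻ i) ≡ i
    halve i = trans (residue-cong (begin
      (suc w * toℕ (i +ᶻ i)) % M                   ≡⟨ cong (λ z → (suc w * z) % M) (toℕ-residue (toℕ i + toℕ i)) ⟩
      (suc w * ((toℕ i + toℕ i) % M)) % M          ≡⟨ DM.%-distribˡ-* (suc w) ((toℕ i + toℕ i) % M) M ⟩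
      (suc w % M * ((toℕ i + toℕ i) % M % M)) % M  ≡⟨ cong (λ z → (suc w % M * z) % M) (DM.m%n%n≡m%n (toℕ i + toℕ i) M) ⟩
      (suc w % M * ((toℕ i + toℕ i) % M)) % M      ≡⟨ DM.%-distribˡ-* (suc w) (toℕ i + toℕ i) M ⟨
      (suc w * (toℕ i + toℕ i)) % M                ≡⟨ cong (_% M) (regroup w (toℕ i)) ⟩
      (toℕ i + toℕ i * M) % M                      ≡⟨ DM.[m+kn]%n≡m%n (toℕ i) (toℕ i) M ⟩
      toℕ i % M                                    ∎)) (residue-toℕ i)
      where
      open ≡-Reasoning
      M : ℕ
      M = suc (w + w)
      regroup : ∀ w x → suc w * (x + x) ≡ x + x * suc (w + w)
      regroup = solve-∀

  colour : Fin (suc (suc (w + w))) → Fin (suc (suc (w + w))) → Z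
  colour fzero fzero = fzero
  colour fzero (fsuc i) = i +ᶻ i
  colour (fsuc i) fzero = i +ᶻ i
  colour (fsuc i) (fsuc j) = i +ᶻ j

  roundRobin : Col (suc (suc (w + w))) (suc (w + w))
  roundRobin = mkCol colour symmetric proper
    where
    symmetric : ∀ u v → colour u v ≡ colour v u
    symmetric fzero fzero = refl
    symmetric fzero (fsuc _) = refl
    symmetric (fsuc _) fzero = refl
    symmetric (fsuc i) (fsuc j) = +ᶻ-comm i j
    proper : ∀ {u v w} → u ≢ v → u ≢ w → colour u v ≡ colour u w → v ≡ w
    proper {fzero} {fzero} u≢v _ _ = ⊥-elim (u≢v refl)
    proper {fzero} {fsuc _} {fzero} _ u≢w _ = ⊥-elim (u≢w refl)
    proper {fzero} {fsuc i} {fsuc j} _ _ e = cong fsuc (double-injective e)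
    proper {fsuc i} {fzero} {fzero} _ _ _ = refl
    proper {fsuc i} {fzero} {fsuc j} _ u≢w e = ⊥-elim (u≢w (cong fsuc (+ᶻ-cancelˡ i _ _ e)))
    proper {fsuc i} {fsuc j} {fzero} u≢v _ e = ⊥-elim (u≢v (cong fsuc (+ᶻ-cancelˡ i _ _ (sym e))))
    proper {fsuc i} {fsuc j} {fsuc l} _ _ e = cong fsuc (+ᶻ-cancelˡ i _ _ e)

⊕-comm : ∀ A B → A ⊕ B ≡ B ⊕ A
⊕-comm = from-yes (Fₚ.all? λ A → Fₚ.all? λ B → A ⊕ B F.≟ B ⊕ A)

⊕-invˡ : ∀ A x → A ⊕ (A ⊕ x) ≡ x
⊕-invˡ = from-yes (Fₚ.all? λ A → Fₚ.all? λ x → A ⊕ (A ⊕ x) F.≟ x)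

⊕-swap : ∀ A x y → (A ⊕ x) ⊕ y ≡ (A ⊕ y) ⊕ x
⊕-swap = from-yes (Fₚ.all? λ A → Fₚ.all? λ x → Fₚ.all? λ y → (A ⊕ x) ⊕ y F.≟ (A ⊕ y) ⊕ x)

negated : Ty → Ty → Bool
negated p x = does (p F.≟ o) ∨ does (p ⊕ x F.≟ o)

negated-end : ∀ p x → negated (p ⊕ x) x ≡ negated p x
negated-end = from-yes (Fₚ.all? λ p → Fₚ.all? λ x → negated (p ⊕ x) x Boolₚ.≟ negated p x)

negated-other : ∀ p x y → x ≢ o → y ≢ o → y ≢ x → negated (p ⊕ x) y ≡ not (negated p y)
negated-other = from-yes (Fₚ.all? λ p → Fₚ.all? λ (x : Ty) → Fₚ.all? λ (y : Ty) → ¬? (x F.≟ o) →-dec (¬? (y F.≟ o) →-dec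
  (¬? (y F.≟ x) →-dec (negated (p ⊕ x) y Boolₚ.≟ not (negated p y)))))

-- Vertices (p , i) with p in the Klein group and i a residue; an edge between the parts p ≢ q has type p ⊕ q
-- and second colour coordinate i + j, negated if p or q is o: of the two edges of a type, exactly one is negated.
module Blocks (k : ℕ) (I : Col (suc k) k) where
  open Cyclic k

  V′ C′ : Set
  V′ = Ty × Z
  C′ = Fin k ⊎ (Fin 3 × Z)

  signed : Bool → Z → Z
  signed false z = z
  signed true z = neg z

  signed-signed : ∀ b z → signed b (signed b z) ≡ z
  signed-signed false z = refl
  signed-signed true z = neg-involutive z

  signed-not : ∀ b z → signed (not b) z ≡ neg (signed b z)
  signed-not false z = refl
  signed-not true z = sym (neg-involutive z)

  cell : Ty → Z → Z → Ty → C′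
  cell p i j o = inj₁ (f I i j)
  cell p i j (fsuc r) = inj₂ (r , signed (negated p (fsuc r)) (i +ᶻ j))

  f′ : V′ → V′ → C′
  f′ (p , i) (q , j) = cell p i j (p ⊕ q)

  across : Fin 3 → Z → V′ → V′
  across r z (p , i) = p ⊕ fsuc r , signed (negated p (fsuc r)) z -ᶻ i

  nb′ : C′ → V′ → V′
  nb′ (inj₁ c) (p , i) = p , nb I c i
  nb′ (inj₂ (r , z)) v = across r z v

  type : C′ → Ty
  type (inj₁ _) = o
  type (inj₂ (r , _)) = fsuc r

  ⊕-self-o : ∀ p → p ⊕ p ≡ o
  ⊕-self-o = from-yes (Fₚ.all? λ p → p ⊕ p F.≟ o)

  f′-sym : ∀ u v → f′ u v ≡ f′ v u
  f′-sym (p , i) (q , j) = trans (flipped (p ⊕ q) refl) (cong (cell q j i) (⊕-comm p q))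
    where
    flipped : ∀ x → p ⊕ q ≡ x → cell p i j x ≡ cell q j i x
    flipped o e = cong inj₁ (f-sym I i j)
    flipped (fsuc r) e = cong₂ (λ b z → inj₂ (r , signed b z))
      (trans (sym (negated-end p (fsuc r))) (cong (λ y → negated y (fsuc r)) (sym (⊕-shift p q _ e)))) (+ᶻ-comm i j)

  f′-nb′ : ∀ c u → f′ u (nb′ c u) ≡ c
  f′-nb′ (inj₁ c) (p , i) = trans (cong (cell p i (nb I c i)) (⊕-self-o p)) (cong inj₁ (f-nb I c i))
  f′-nb′ (inj₂ (r , z)) (p , i) = trans (cong (cell p i _) (⊕-invˡ p (fsuc r)))
    (cong (λ y → inj₂ (r , y)) (trans (cong (signed b) (i+[a-i] i (signed b z))) (signed-signed b z)))
    where
    b : Bool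
    b = negated p (fsuc r)

  nb′-≢ : ∀ c u → nb′ c u ≢ u
  nb′-≢ (inj₁ c) (p , i) e = nb-≢ I c i (cong proj₂ e)
  nb′-≢ (inj₂ (r , z)) (p , i) e with ⊕-fixed p (fsuc r) (cong proj₁ e)
  ... | ()

  nb′-f′ : ∀ u v → u ≢ v → nb′ (f′ u v) u ≡ v
  nb′-f′ (p , i) (q , j) u≢v = back (p ⊕ q) refl
    where
    back : ∀ x → p ⊕ q ≡ x → nb′ (cell p i j x) (p , i) ≡ (q , j)
    back o e = cong₂ _,_ p≡q (nb-f I i j λ i≡j → u≢v (cong₂ _,_ p≡q i≡j))
      where
      p≡q : p ≡ q
      p≡q = ⊕-self p q e
    back (fsuc r) e = cong₂ _,_ (sym (⊕-shift p q _ e)) (trans (cong (_-ᶻ i) (signed-signed (negated p (fsuc r)) (i +ᶻ j))) (difference refl))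

  -- Without signs, going from i to z - i and on to z′ - (z - i) is a translation by z′ - z, while
  -- the other order translates by z - z′. By `negated-other` the first crossing flips the sign of
  -- the second colour; both orders then give the same expression, symmetric in the two colours.
  across-comm : ∀ r z r′ z′ u → r ≢ r′ → across r′ z′ (across r z u) ≡ across r z (across r′ z′ u)
  across-comm r z r′ z′ (p , i) r≢r′ = cong₂ _,_ (⊕-swap p (fsuc r) (fsuc r′)) (begin
    signed (negated (p ⊕ fsuc r) (fsuc r′)) z′ -ᶻ (signed b z -ᶻ i)  ≡⟨ cong (_-ᶻ (signed b z -ᶻ i)) (flipped r r′ z′ r≢r′) ⟩
    neg (signed b′ z′) -ᶻ (signed b z -ᶻ i)                          ≡⟨ neg-exchange (signed b z) (signed b′ z′) i ⟩
    neg (signed b z) -ᶻ (signed b′ z′ -ᶻ i)                          ≡⟨ cong (_-ᶻ (signed b′ z′ -ᶻ i)) (flipped r′ r z (r≢r′ ∘ sym)) ⟨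
    signed (negated (p ⊕ fsuc r′) (fsuc r)) z -ᶻ (signed b′ z′ -ᶻ i)  ∎)
    where
    open ≡-Reasoning
    b b′ : Bool
    b = negated p (fsuc r)
    b′ = negated p (fsuc r′)
    flipped : ∀ r r′ z′ → r ≢ r′ → signed (negated (p ⊕ fsuc r) (fsuc r′)) z′ ≡ neg (signed (negated p (fsuc r′)) z′)
    flipped r r′ z′ d = trans (cong (λ y → signed y z′)
      (negated-other p (fsuc r) (fsuc r′) (λ ()) (λ ()) (λ e → d (sym (Fₚ.suc-injective e))))) (signed-not (negated p (fsuc r′)) z′)

  n m : ℕ
  n = 4 * suc k
  m = k + 3 * suc k

  opaque
    decV : Fin n → V′
    decV = F.remQuot (suc k)

    encV : V′ → Fin n
    encV (p , i) = F.combine p i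

    decV-encV : ∀ v → decV (encV v) ≡ v
    decV-encV (p , i) = Fₚ.remQuot-combine p i

    encV-decV : ∀ v → encV (decV v) ≡ v
    encV-decV v = Fₚ.combine-remQuot {4} (suc k) v

    decC : Fin m → C′
    decC c = [ inj₁ , (λ y → inj₂ (F.remQuot (suc k) y)) ]′ (F.splitAt k c)

    encC : C′ → Fin m
    encC (inj₁ c) = F.join k (3 * suc k) (inj₁ c)
    encC (inj₂ (r , z)) = F.join k (3 * suc k) (inj₂ (F.combine r z))

    decC-encC : ∀ c → decC (encC c) ≡ c
    decC-encC (inj₁ c) = cong [ inj₁ , (λ y → inj₂ (F.remQuot (suc k) y)) ]′ (Fₚ.splitAt-join k (3 * suc k) (inj₁ c))
    decC-encC (inj₂ (r , z)) = trans (cong [ inj₁ , (λ y → inj₂ (F.remQuot (suc k) y)) ]′ (Fₚ.splitAt-join k (3 * suc k) (inj₂ (F.combine r z))))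
      (cong inj₂ (Fₚ.remQuot-combine r z))

    encC-decC : ∀ c → encC (decC c) ≡ c
    encC-decC c = trans (via (F.splitAt k c)) (Fₚ.join-splitAt k (3 * suc k) c)
      where
      via : ∀ y → encC ([ inj₁ , (λ y → inj₂ (F.remQuot (suc k) y)) ]′ y) ≡ F.join k (3 * suc k) y
      via (inj₁ _) = refl
      via (inj₂ y) = cong (λ z → F.join k (3 * suc k) (inj₂ z)) (Fₚ.combine-remQuot {3} (suc k) y)

  col : Col n m
  col = record
    { f = λ u v → encC (f′ (decV u) (decV v))
    ; nb = λ c u → encV (nb′ (decC c) (decV u))
    ; f-sym = λ u v → cong encC (f′-sym (decV u) (decV v))
    ; f-nb = λ c u → trans (cong (λ z → encC (f′ (decV u) z)) (decV-encV _))
        (trans (cong encC (f′-nb′ (decC c) (decV u))) (encC-decC c))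
    ; nb-≢ = λ c u e → nb′-≢ (decC c) (decV u) (trans (sym (decV-encV _)) (cong decV e))
    ; nb-f = λ u v u≢v → trans (cong (λ z → encV (nb′ z (decV u))) (decC-encC _))
        (trans (cong encV (nb′-f′ (decV u) (decV v) λ e → u≢v (trans (sym (encV-decV u)) (trans (cong encV e) (encV-decV v))))) (encV-decV v)) }

  pt : Fin n → Maybe Ty
  pt v = just (proj₁ (decV v))

  ty : Fin m → Ty
  ty c = type (decC c)

  typed : ∀ c → ty c ≢ o → ∃ λ r → ∃ λ z → decC c ≡ inj₂ (r , z)
  typed c tc with decC c
  ... | inj₁ _ = ⊥-elim (tc refl)
  ... | inj₂ (r , z) = r , z , refl

  private
    part-of : ∀ {v A} → pt v ≡ just A → proj₁ (decV v) ≡ A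
    part-of refl = refl

  parts-differ : ∀ {a b A B} → pt a ≡ just A → pt b ≡ just B → B ≢ A → a ≢ b
  parts-differ pa pb B≢A refl = B≢A (trans (sym (part-of pb)) (part-of pa))

  type-f′ : ∀ u v → type (f′ u v) ≡ proj₁ u ⊕ proj₁ v
  type-f′ (p , i) (q , j) = of-cell (p ⊕ q)
    where
    of-cell : ∀ x → type (cell p i j x) ≡ x
    of-cell o = refl
    of-cell (fsuc r) = refl

  ref : Ref n m (suc k) 0
  ref = record
    { pt = pt ; ty = ty ; nb₀ = nb col ; f₀ = f col
    ; pt-nb₀ = λ {a} {A} {c} pa tc → cong just (pt-nb a c (part-of pa) (typed c tc))
    ; nb₀-nb₀ = λ {a} {A} {c} _ _ → nb-nb col c a
    ; nb₀-comm = λ {a} {A} {c} {h} _ tc th h≢c → comm a c h (typed c tc) (typed h th) h≢c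
    ; nb₀-f₀ = λ {a} {b} pa pb B≢A → nb-f col a b (parts-differ pa pb B≢A)
    ; ty-f₀ = λ {a} {b} pa pb _ → trans (cong type (decC-encC _)) (trans (type-f′ (decV a) (decV b)) (cong₂ _⊕_ (part-of pa) (part-of pb)))
    ; f₀-nb₀ = λ {a} {A} {c} _ _ → f-nb col c a
    ; pt-cover = λ A → cover (map (λ i → encV (A , i)) (allFin (suc k))) (ℕₚ.≤-reflexive (trans (Lₚ.length-map _ (allFin (suc k))) (length-allFin (suc k))))
        λ {v} pv → subst (_∈ˡ _) (trans (cong (λ z → encV (z , proj₂ (decV v))) (sym (part-of pv))) (encV-decV v))
          (Mₚ.∈-map⁺ (λ i → encV (A , i)) (Mₚ.∈-allFin (proj₂ (decV v))))
    ; ∞-cover = cover [] z≤n (λ ())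
    ; ty-cover = λ { o → cover (map (λ c → encC (inj₁ c)) (allFin k))
                       (ℕₚ.≤-trans (ℕₚ.≤-reflexive (trans (Lₚ.length-map _ (allFin k)) (length-allFin k))) (ℕₚ.n≤1+n k)) untyped
                   ; (fsuc r) → cover (map (λ z → encC (inj₂ (r , z))) (allFin (suc k)))
                       (ℕₚ.≤-reflexive (trans (Lₚ.length-map _ (allFin (suc k))) (length-allFin (suc k)))) (of-type r) } }
    where
    pt-nb : ∀ a c {A} → proj₁ (decV a) ≡ A → (∃ λ r → ∃ λ z → decC c ≡ inj₂ (r , z)) → proj₁ (decV (nb col c a)) ≡ A ⊕ ty c
    pt-nb a c refl (r , z , e) = trans (cong proj₁ (decV-encV _))
      (trans (cong (λ y → proj₁ (nb′ y (decV a))) e) (cong (λ y → proj₁ (decV a) ⊕ type y) (sym e)))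
    comm : ∀ a c h → (∃ λ r → ∃ λ z → decC c ≡ inj₂ (r , z)) → (∃ λ r → ∃ λ z → decC h ≡ inj₂ (r , z)) →
      ty h ≢ ty c → nb col h (nb col c a) ≡ nb col c (nb col h a)
    comm a c h (r , z , e) (r′ , z′ , e′) h≢c = cong encV (begin
      nb′ (decC h) (decV (encV (nb′ (decC c) (decV a))))  ≡⟨ cong (nb′ (decC h)) (decV-encV _) ⟩
      nb′ (decC h) (nb′ (decC c) (decV a))                ≡⟨ cong₂ (λ x y → nb′ x (nb′ y (decV a))) e′ e ⟩
      across r′ z′ (across r z (decV a))                  ≡⟨ across-comm r z r′ z′ (decV a) r≢r′ ⟩
      across r z (across r′ z′ (decV a))                  ≡⟨ cong₂ (λ x y → nb′ x (nb′ y (decV a))) e e′ ⟨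
      nb′ (decC c) (nb′ (decC h) (decV a))                ≡⟨ cong (nb′ (decC c)) (decV-encV _) ⟨
      nb′ (decC c) (decV (encV (nb′ (decC h) (decV a))))  ∎)
      where
      open ≡-Reasoning
      r≢r′ : r ≢ r′
      r≢r′ r≡r′ = h≢c (trans (cong type e′) (trans (cong fsuc (sym r≡r′)) (cong type (sym e))))
    untyped : ∀ {c} → ty c ≡ o → c ∈ˡ map (λ c → encC (inj₁ c)) (allFin k)
    untyped {c} tc = subst (_∈ˡ _) (encC-decC c) (go (decC c) tc)
      where
      go : ∀ y → type y ≡ o → encC y ∈ˡ map (λ c → encC (inj₁ c)) (allFin k)
      go (inj₁ x) _ = Mₚ.∈-map⁺ (λ c → encC (inj₁ c)) (Mₚ.∈-allFin x)
    of-type : ∀ r {c} → ty c ≡ fsuc r → c ∈ˡ map (λ z → encC (inj₂ (r , z))) (allFin (suc k))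
    of-type r {c} tc = subst (_∈ˡ _) (encC-decC c) (go (decC c) tc)
      where
      go : ∀ y → type y ≡ fsuc r → encC y ∈ˡ map (λ z → encC (inj₂ (r , z))) (allFin (suc k))
      go (inj₂ (r , z)) refl = Mₚ.∈-map⁺ (λ z → encC (inj₂ (r , z))) (Mₚ.∈-allFin z)

-- Adding two vertices

Cover-unique : ∀ {n} {P : Fin n → Set} → (∀ i → Dec (P i)) → (∀ {i j} → P i → P j → i ≡ j) → Cover 1 P
Cover-unique P? unique with Fₚ.any? P?
... | yes (i , p) = cover (i ∷ []) ℕₚ.≤-refl (λ q → here (unique q p))
... | no ¬p = cover [] z≤n (λ q → ⊥-elim (¬p (_ , q)))

start : ∀ {m} → Fin (suc m) → Maybe (Fin (suc m))
start fzero = just fzero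
start (fsuc _) = nothing

-- The rainbow Hamiltonian path 0, 1, ..., m with colour c on the edge from c to c + 1, in the form
-- of a precoloring so that `satisfy` can realise it.
path : ∀ {m} → Fin (suc m) → Fin (suc m) → Maybe (Fin m)
path {zero} _ _ = nothing
path {suc m} fzero fzero = nothing
path {suc m} fzero (fsuc v) = start v
path {suc m} (fsuc u) fzero = start u
path {suc m} (fsuc u) (fsuc v) = Maybe.map fsuc (path u v)

path-edge : ∀ {m} (c : Fin m) → path (F.inject₁ c) (fsuc c) ≡ just c
path-edge fzero = refl
path-edge (fsuc c) rewrite path-edge c = refl

path-sym : ∀ {m} (u v : Fin (suc m)) → path u v ≡ path v u
path-sym {zero} _ _ = refl
path-sym {suc m} fzero fzero = refl
path-sym {suc m} fzero (fsuc _) = refl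
path-sym {suc m} (fsuc _) fzero = refl
path-sym {suc m} (fsuc u) (fsuc v) rewrite path-sym u v = refl

path-loop : ∀ {m} (u : Fin (suc m)) → path u u ≡ nothing
path-loop {zero} _ = refl
path-loop {suc m} fzero = refl
path-loop {suc m} (fsuc u) rewrite path-loop u = refl

record Consecutive {m} (c : Fin m) (u v : Fin (suc m)) : Set where
  constructor ends
  field
    lower : u ≡ F.inject₁ c
    upper : v ≡ fsuc c

path-ends : ∀ {m} (u v : Fin (suc m)) {c} → path u v ≡ just c → Consecutive c u v ⊎ Consecutive c v u
path-ends {suc m} fzero (fsuc fzero) refl = inj₁ (ends refl refl)
path-ends {suc m} (fsuc fzero) fzero refl = inj₂ (ends refl refl)
path-ends {suc m} (fsuc u) (fsuc v) e with path u v in eq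
path-ends {suc m} (fsuc u) (fsuc v) refl | just c with path-ends u v eq
... | inj₁ (ends refl refl) = inj₁ (ends refl refl)
... | inj₂ (ends refl refl) = inj₂ (ends refl refl)

inject₁≢suc : ∀ {m} {c : Fin m} → F.inject₁ c ≢ fsuc c
inject₁≢suc {c = c} e = ℕₚ.1+n≢n (sym (trans (sym (Fₚ.toℕ-inject₁ c)) (cong toℕ e)))

path-proper : ∀ {m} {u v w : Fin (suc m)} {c} → path u v ≡ just c → path u w ≡ just c → v ≡ w
path-proper {u = u} {v} {w} e e′ with path-ends u v e | path-ends u w e′
... | inj₁ (ends _ ev) | inj₁ (ends _ ew) = trans ev (sym ew)
... | inj₁ (ends eu _) | inj₂ (ends _ eu′) = ⊥-elim (inject₁≢suc (trans (sym eu) eu′))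
... | inj₂ (ends _ eu) | inj₁ (ends eu′ _) = ⊥-elim (inject₁≢suc (trans (sym eu′) eu))
... | inj₂ (ends ev _) | inj₂ (ends ew _) = trans ev (sym ew)

path-vertex : ∀ {m} (u : Fin (suc m)) → Cover 2 (λ v → path u v ≢ nothing)
path-vertex {m} u = Cover-mono ℕₚ.≤-refl split (Cover-⊎
  (Cover-unique {P = λ v → toℕ v ≡ suc (toℕ u)} (λ v → _ ℕ.≟ _) (λ e e′ → Fₚ.toℕ-injective (trans e (sym e′))))
  (Cover-unique {P = λ v → toℕ u ≡ suc (toℕ v)} (λ v → _ ℕ.≟ _) (λ e e′ → Fₚ.toℕ-injective (ℕₚ.suc-injective (trans (sym e) e′)))))
  where
  step : ∀ {c u v} → Consecutive {m} c u v → toℕ v ≡ suc (toℕ u)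
  step {c} (ends refl refl) = cong suc (sym (Fₚ.toℕ-inject₁ c))
  split : ∀ {v} → path u v ≢ nothing → toℕ v ≡ suc (toℕ u) ⊎ toℕ u ≡ suc (toℕ v)
  split {v} d with path u v in eq
  ... | nothing = ⊥-elim (d refl)
  ... | just c with path-ends u v eq
  ...   | inj₁ s = inj₁ (step s)
  ...   | inj₂ s = inj₂ (step s)

path-colour : ∀ {m} (c : Fin m) → Cover 2 (λ v → ∃ λ w → path v w ≡ just c)
path-colour c = Cover-mono ℕₚ.≤-refl
  (λ { {v} (w , e) → case path-ends v w e of λ { (inj₁ (ends ev _)) → inj₁ ev ; (inj₂ (ends _ ev)) → inj₂ ev } })
  (Cover-⊎ (Cover-≡ (F.inject₁ c)) (Cover-≡ (fsuc c)))

-- The colour of the path edge that goes up from a vertex; there is none at the last vertex.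
rise : ∀ {m} → Fin (suc m) → Maybe (Fin m)
rise {zero} fzero = nothing
rise {suc m} fzero = just fzero
rise {suc m} (fsuc v) = Maybe.map fsuc (rise v)

rise-just : ∀ {m} (v : Fin (suc m)) {c} → rise v ≡ just c → v ≡ F.inject₁ c
rise-just {suc m} fzero refl = refl
rise-just {suc m} (fsuc v) e with rise v in eq
rise-just {suc m} (fsuc v) refl | just c = cong fsuc (rise-just v eq)

rise-nothing : ∀ {m} (v : Fin (suc m)) → rise v ≡ nothing → toℕ v ≡ m
rise-nothing {zero} fzero e = refl
rise-nothing {suc m} (fsuc v) e with rise v in eq
... | nothing = cong suc (rise-nothing v eq)

-- A 1-factorization containing the rainbow path above is enlarged by two vertices: the path is recoloured
-- alternately with two new colours, which frees colour c at c and c + 1 for the edges to the new vertices.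
module Prolong (w : ℕ) (K : Col (suc (suc (w + w))) (suc (w + w)))
  (on-path : ∀ c → Col.f K (F.inject₁ c) (fsuc c) ≡ c) where

  m : ℕ
  m = suc (w + w)

  odd : ℕ → Bool
  odd zero = false
  odd (suc k) = not (odd k)

  odd-double : ∀ k → odd (k + k) ≡ false
  odd-double zero = refl
  odd-double (suc k) rewrite ℕₚ.+-suc k k | odd-double k = refl

  fresh : Bool → Fin (2 + m)
  fresh false = fzero
  fresh true = fsuc fzero

  old : Fin m → Fin (2 + m)
  old c = fsuc (fsuc c)

  keep : Fin (suc m) → Fin (suc (2 + m))
  keep v = fsuc (fsuc v)

  recolour : Maybe (Fin m) → Fin m → Fin (2 + m)
  recolour (just c) _ = fresh (odd (toℕ c))
  recolour nothing d = old d

  -- The first new vertex takes over the colour of the path edge above each old vertex, the second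
  -- one that of the path edge below. At an end of the path, where that edge is missing, a fresh
  -- colour is used.
  from-first : Maybe (Fin m) → Fin (2 + m)
  from-first (just c) = old c
  from-first nothing = fresh true

  from-second : Fin (suc m) → Fin (2 + m)
  from-second fzero = fresh true
  from-second (fsuc c) = old c

  colour : Fin (suc (2 + m)) → Fin (suc (2 + m)) → Fin (2 + m)
  colour fzero fzero = fresh false
  colour fzero (fsuc fzero) = fresh false
  colour fzero (fsuc (fsuc v)) = from-first (rise v)
  colour (fsuc fzero) fzero = fresh false
  colour (fsuc fzero) (fsuc fzero) = fresh false
  colour (fsuc fzero) (fsuc (fsuc v)) = from-second v
  colour (fsuc (fsuc u)) fzero = from-first (rise u)
  colour (fsuc (fsuc u)) (fsuc fzero) = from-second u
  colour (fsuc (fsuc u)) (fsuc (fsuc v)) = recolour (path u v) (f K u v)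

  colour-sym : ∀ u v → colour u v ≡ colour v u
  colour-sym fzero fzero = refl
  colour-sym fzero (fsuc fzero) = refl
  colour-sym fzero (fsuc (fsuc v)) = refl
  colour-sym (fsuc fzero) fzero = refl
  colour-sym (fsuc fzero) (fsuc fzero) = refl
  colour-sym (fsuc fzero) (fsuc (fsuc v)) = refl
  colour-sym (fsuc (fsuc u)) fzero = refl
  colour-sym (fsuc (fsuc u)) (fsuc fzero) = refl
  colour-sym (fsuc (fsuc u)) (fsuc (fsuc v)) = cong₂ recolour (path-sym u v) (f-sym K u v)

  -- `Old` and `New` enumerate the ways in which a colour can reach the old vertex `x`; properness
  -- there means that no two of them occur together.
  data Old (x : Fin (suc m)) (c : Fin m) : Fin (suc (2 + m)) → Set where
    first : x ≡ F.inject₁ c → Old x c fzero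
    second : x ≡ fsuc c → Old x c (fsuc fzero)
    kept : ∀ {y} → x ≢ y → path x y ≡ nothing → f K x y ≡ c → Old x c (keep y)

  data New (x : Fin (suc m)) (b : Bool) : Fin (suc (2 + m)) → Set where
    last : toℕ x ≡ m → b ≡ true → New x b fzero
    zeroth : x ≡ fzero → b ≡ true → New x b (fsuc fzero)
    forward : ∀ {y} c → Consecutive c x y → b ≡ odd (toℕ c) → New x b (keep y)
    backward : ∀ {y} c → Consecutive c y x → b ≡ odd (toℕ c) → New x b (keep y)

  Colour : Fin (suc m) → Fin (suc (2 + m)) → Fin (2 + m) → Set
  Colour x v d = (∃ λ c → d ≡ old c × Old x c v) ⊎ (∃ λ b → d ≡ fresh b × New x b v)

  classify : ∀ x v → keep x ≢ v → Colour x v (colour (keep x) v)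
  classify x fzero _ with rise x in eq
  ... | just c = inj₁ (c , refl , first (rise-just x eq))
  ... | nothing = inj₂ (true , refl , last (rise-nothing x eq) refl)
  classify fzero (fsuc fzero) _ = inj₂ (true , refl , zeroth refl refl)
  classify (fsuc c) (fsuc fzero) _ = inj₁ (c , refl , second refl)
  classify x (fsuc (fsuc y)) d with path x y in eq
  ... | nothing = inj₁ (f K x y , refl , kept (λ e → d (cong keep e)) eq refl)
  ... | just c with path-ends x y eq
  ...   | inj₁ s = inj₂ (_ , refl , forward c s refl)
  ...   | inj₂ s = inj₂ (_ , refl , backward c s refl)

  on-path′ : ∀ c → f K (fsuc c) (F.inject₁ c) ≡ c
  on-path′ c = trans (f-sym K _ _) (on-path c)

  not-kept : ∀ {x y z c} → x ≢ y → path x y ≡ nothing → f K x y ≡ c → x ≢ z → f K x z ≡ c → path x z ≡ just c → ⊥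
  not-kept {x} x≢y no-path e x≢z e′ is-path with f-inj K x≢y x≢z (trans e (sym e′))
  ... | refl with trans (sym no-path) is-path
  ...   | ()

  first-kept : ∀ {x y c} → x ≡ F.inject₁ c → x ≢ y → path x y ≡ nothing → f K x y ≡ c → ⊥
  first-kept {c = c} refl x≢y np e = not-kept x≢y np e inject₁≢suc (on-path c) (path-edge c)

  second-kept : ∀ {x y c} → x ≡ fsuc c → x ≢ y → path x y ≡ nothing → f K x y ≡ c → ⊥
  second-kept {c = c} refl x≢y np e = not-kept x≢y np e (inject₁≢suc ∘ sym) (on-path′ c)
    (trans (path-sym (fsuc c) (F.inject₁ c)) (path-edge c))

  Old-unique : ∀ {x c v w} → Old x c v → Old x c w → v ≡ w
  Old-unique (first _) (first _) = refl
  Old-unique (first e) (second e′) = ⊥-elim (inject₁≢suc (trans (sym e) e′))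
  Old-unique (first e) (kept d np e′) = ⊥-elim (first-kept e d np e′)
  Old-unique (second e) (first e′) = ⊥-elim (inject₁≢suc (trans (sym e′) e))
  Old-unique (second _) (second _) = refl
  Old-unique (second e) (kept d np e′) = ⊥-elim (second-kept e d np e′)
  Old-unique (kept d np e′) (first e) = ⊥-elim (first-kept e d np e′)
  Old-unique (kept d np e′) (second e) = ⊥-elim (second-kept e d np e′)
  Old-unique (kept d _ e) (kept d′ _ e′) = cong keep (f-inj K d d′ (trans e (sym e′)))

  zeroth-last : ∀ {x : Fin (suc m)} → x ≡ fzero → toℕ x ≡ m → ⊥
  zeroth-last refl ()

  last-forward : ∀ {x y : Fin (suc m)} {c : Fin m} → toℕ x ≡ m → Consecutive c x y → ⊥
  last-forward {c = c} e (ends refl _) = ℕₚ.<-irrefl (trans (sym (Fₚ.toℕ-inject₁ c)) e) (Fₚ.toℕ<n c)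

  -- The path edge into the last vertex has index 2w. This is even, so its fresh colour is not the
  -- one used from the last vertex to the first new vertex.
  last-backward : ∀ {x y : Fin (suc m)} {c : Fin m} {b} → toℕ x ≡ m → b ≡ true → Consecutive c y x → b ≡ odd (toℕ c) → ⊥
  last-backward {c = c} e refl (ends _ refl) eb with trans eb (trans (cong odd (ℕₚ.suc-injective e)) (odd-double w))
  ... | ()

  zeroth-forward : ∀ {x y : Fin (suc m)} {c : Fin m} {b} → x ≡ fzero → b ≡ true → Consecutive c x y → b ≡ odd (toℕ c) → ⊥
  zeroth-forward {c = fzero} _ refl _ ()
  zeroth-forward {c = fsuc _} refl _ (ends () _) _

  zeroth-backward : ∀ {x y : Fin (suc m)} {c : Fin m} → x ≡ fzero → Consecutive c y x → ⊥
  zeroth-backward refl (ends _ ())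

  forward-backward : ∀ {x y z : Fin (suc m)} {c d : Fin m} {b} → Consecutive c x y → b ≡ odd (toℕ c) → Consecutive d z x → b ≡ odd (toℕ d) → ⊥
  forward-backward {c = c} {d} (ends e _) eb (ends _ e′) eb′ = Boolₚ.not-¬ {odd (toℕ d)} refl
    (trans (sym eb′) (trans eb (cong odd (trans (sym (Fₚ.toℕ-inject₁ c)) (cong toℕ (trans (sym e) e′))))))

  New-unique : ∀ {x b v w} → New x b v → New x b w → v ≡ w
  New-unique (last _ _) (last _ _) = refl
  New-unique (last e _) (zeroth e′ _) = ⊥-elim (zeroth-last e′ e)
  New-unique (last e _) (forward _ s _) = ⊥-elim (last-forward e s)
  New-unique (last e t) (backward _ s p) = ⊥-elim (last-backward e t s p)
  New-unique (zeroth e _) (last e′ _) = ⊥-elim (zeroth-last e e′)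
  New-unique (zeroth _ _) (zeroth _ _) = refl
  New-unique (zeroth e t) (forward _ s p) = ⊥-elim (zeroth-forward e t s p)
  New-unique (zeroth e _) (backward _ s _) = ⊥-elim (zeroth-backward e s)
  New-unique (forward _ s _) (last e _) = ⊥-elim (last-forward e s)
  New-unique (forward _ s p) (zeroth e t) = ⊥-elim (zeroth-forward e t s p)
  New-unique (forward _ (ends e ey) _) (forward _ (ends e′ ez) _) =
    cong keep (trans ey (trans (cong fsuc (Fₚ.inject₁-injective (trans (sym e) e′))) (sym ez)))
  New-unique (forward _ s p) (backward _ s′ p′) = ⊥-elim (forward-backward s p s′ p′)
  New-unique (backward _ s p) (last e t) = ⊥-elim (last-backward e t s p)
  New-unique (backward _ s _) (zeroth e _) = ⊥-elim (zeroth-backward e s)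
  New-unique (backward _ s p) (forward _ s′ p′) = ⊥-elim (forward-backward s′ p′ s p)
  New-unique (backward _ (ends ey e) _) (backward _ (ends ez e′) _) =
    cong keep (trans ey (trans (cong F.inject₁ (Fₚ.suc-injective (trans (sym e) e′))) (sym ez)))

  old≢fresh : ∀ {c b} → old c ≢ fresh b
  old≢fresh {b = false} ()
  old≢fresh {b = true} ()

  fresh-injective : ∀ {b b′} → fresh b ≡ fresh b′ → b ≡ b′
  fresh-injective {false} {false} _ = refl
  fresh-injective {true} {true} _ = refl

  Colour-unique : ∀ {x v w d} → Colour x v d → Colour x w d → v ≡ w
  Colour-unique (inj₁ (c , refl , s)) (inj₁ (_ , refl , s′)) = Old-unique s s′
  Colour-unique (inj₁ (c , refl , _)) (inj₂ (b , e , _)) = ⊥-elim (old≢fresh e)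
  Colour-unique (inj₂ (b , refl , _)) (inj₁ (c , e , _)) = ⊥-elim (old≢fresh (sym e))
  Colour-unique (inj₂ (b , refl , s)) (inj₂ (b′ , e , s′)) with fresh-injective {b} {b′} e
  ... | refl = New-unique s s′

  from-first-injective : ∀ u v → from-first (rise u) ≡ from-first (rise v) → u ≡ v
  from-first-injective u v e with rise u in eu | rise v in ev
  ... | just c | just d = trans (rise-just u eu)
    (trans (cong F.inject₁ (Fₚ.suc-injective (Fₚ.suc-injective e))) (sym (rise-just v ev)))
  ... | nothing | nothing = Fₚ.toℕ-injective (trans (rise-nothing u eu) (sym (rise-nothing v ev)))

  from-first≢ : ∀ u → from-first u ≢ fresh false
  from-first≢ (just c) ()
  from-first≢ nothing ()

  from-second≢ : ∀ u → from-second u ≢ fresh false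
  from-second≢ fzero ()
  from-second≢ (fsuc _) ()

  from-second-injective : ∀ {u v} → from-second u ≡ from-second v → u ≡ v
  from-second-injective {fzero} {fzero} _ = refl
  from-second-injective {fsuc _} {fsuc _} e = Fₚ.suc-injective e

  proper : ∀ {u v w} → u ≢ v → u ≢ w → colour u v ≡ colour u w → v ≡ w
  proper {fzero} {fzero} u≢v _ _ = ⊥-elim (u≢v refl)
  proper {fzero} {fsuc _} {fzero} _ u≢w _ = ⊥-elim (u≢w refl)
  proper {fzero} {fsuc fzero} {fsuc fzero} _ _ _ = refl
  proper {fzero} {fsuc fzero} {fsuc (fsuc w)} _ _ e = ⊥-elim (from-first≢ (rise w) (sym e))
  proper {fzero} {fsuc (fsuc v)} {fsuc fzero} _ _ e = ⊥-elim (from-first≢ (rise v) e)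
  proper {fzero} {fsuc (fsuc v)} {fsuc (fsuc w)} _ _ e = cong keep (from-first-injective v w e)
  proper {fsuc fzero} {fsuc fzero} u≢v _ _ = ⊥-elim (u≢v refl)
  proper {fsuc fzero} {fzero} {fsuc fzero} _ u≢w _ = ⊥-elim (u≢w refl)
  proper {fsuc fzero} {fsuc (fsuc _)} {fsuc fzero} _ u≢w _ = ⊥-elim (u≢w refl)
  proper {fsuc fzero} {fzero} {fzero} _ _ _ = refl
  proper {fsuc fzero} {fzero} {fsuc (fsuc w)} _ _ e = ⊥-elim (from-second≢ w (sym e))
  proper {fsuc fzero} {fsuc (fsuc v)} {fzero} _ _ e = ⊥-elim (from-second≢ v e)
  proper {fsuc fzero} {fsuc (fsuc v)} {fsuc (fsuc w)} _ _ e = cong keep (from-second-injective e)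
  proper {fsuc (fsuc u)} {v} {w} u≢v u≢w e =
    Colour-unique (subst (Colour u v) e (classify u v u≢v)) (classify u w u≢w)

  prolonged : Col (suc (2 + m)) (2 + m)
  prolonged = mkCol colour colour-sym proper

  module _ {κ ε : ℕ} (R : Ref (suc m) m κ ε) where
    open Ref R

    pt⁺ : Fin (suc (2 + m)) → Maybe Ty
    pt⁺ fzero = nothing
    pt⁺ (fsuc fzero) = nothing
    pt⁺ (fsuc (fsuc v)) = pt v

    ty⁺ : Fin (2 + m) → Ty
    ty⁺ fzero = o
    ty⁺ (fsuc fzero) = o
    ty⁺ (fsuc (fsuc c)) = ty c

    nb⁺ : Fin (2 + m) → Fin (suc (2 + m)) → Fin (suc (2 + m))
    nb⁺ (fsuc (fsuc c)) (fsuc (fsuc v)) = keep (nb₀ c v)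
    nb⁺ _ v = v

    f⁺ : Fin (suc (2 + m)) → Fin (suc (2 + m)) → Fin (2 + m)
    f⁺ (fsuc (fsuc u)) (fsuc (fsuc v)) = old (f₀ u v)
    f⁺ _ _ = fzero

    shifted : ∀ {j b} {P : Fin j → Set} → Cover b P → Cover b (λ i → ∃ λ h → i ≡ fsuc (fsuc h) × P h)
    shifted = Cover-image (λ i → fsuc (fsuc i)) (λ { (h , refl , p) → h , p , refl })

    first-two : ∀ {j} → Cover 2 (λ (i : Fin (2 + j)) → i ≡ fzero ⊎ i ≡ fsuc fzero)
    first-two = Cover-⊎ (Cover-≡ _) (Cover-≡ _)

    ref⁺ : Ref (suc (2 + m)) (2 + m) (2 + κ) (2 + ε)
    ref⁺ = record
      { pt = pt⁺ ; ty = ty⁺ ; nb₀ = nb⁺ ; f₀ = f⁺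
      ; pt-nb₀ = λ {a} {A} {c} → pt-nb⁺ a c
      ; nb₀-nb₀ = λ {a} {A} {c} → nb-nb⁺ a c
      ; nb₀-comm = λ {a} {A} {c} {h} → nb-comm⁺ a c h
      ; nb₀-f₀ = λ {a} {b} → nb-f⁺ a b
      ; ty-f₀ = λ {a} {b} → ty-f⁺ a b
      ; f₀-nb₀ = λ {a} {A} {c} → f-nb⁺ a c
      ; pt-cover = λ A → Cover-mono (ℕₚ.m≤n+m κ 2) (λ { {fzero} () ; {fsuc fzero} () ; {fsuc (fsuc v)} e → v , refl , e }) (shifted (pt-cover A))
      ; ∞-cover = Cover-mono ℕₚ.≤-refl (λ { {fzero} _ → inj₁ (inj₁ refl) ; {fsuc fzero} _ → inj₁ (inj₂ refl) ; {fsuc (fsuc v)} e → inj₂ (v , refl , e) })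
          (Cover-⊎ first-two (shifted ∞-cover))
      ; ty-cover = λ r → Cover-mono ℕₚ.≤-refl (λ { {fzero} _ → inj₁ (inj₁ refl) ; {fsuc fzero} _ → inj₁ (inj₂ refl) ; {fsuc (fsuc c)} e → inj₂ (c , refl , e) })
          (Cover-⊎ first-two (shifted (ty-cover r))) }
      where
      pt-nb⁺ : ∀ a c {A} → pt⁺ a ≡ just A → ty⁺ c ≢ o → pt⁺ (nb⁺ c a) ≡ just (A ⊕ ty⁺ c)
      pt-nb⁺ (fsuc (fsuc a)) fzero _ tc = ⊥-elim (tc refl)
      pt-nb⁺ (fsuc (fsuc a)) (fsuc fzero) _ tc = ⊥-elim (tc refl)
      pt-nb⁺ (fsuc (fsuc a)) (fsuc (fsuc c)) pa tc = pt-nb₀ pa tc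
      nb-nb⁺ : ∀ a c {A} → pt⁺ a ≡ just A → ty⁺ c ≢ o → nb⁺ c (nb⁺ c a) ≡ a
      nb-nb⁺ (fsuc (fsuc a)) fzero _ tc = ⊥-elim (tc refl)
      nb-nb⁺ (fsuc (fsuc a)) (fsuc fzero) _ tc = ⊥-elim (tc refl)
      nb-nb⁺ (fsuc (fsuc a)) (fsuc (fsuc c)) pa tc = cong keep (nb₀-nb₀ pa tc)
      nb-comm⁺ : ∀ a c h {A} → pt⁺ a ≡ just A → ty⁺ c ≢ o → ty⁺ h ≢ o → ty⁺ h ≢ ty⁺ c → nb⁺ h (nb⁺ c a) ≡ nb⁺ c (nb⁺ h a)
      nb-comm⁺ (fsuc (fsuc a)) fzero h _ tc _ _ = ⊥-elim (tc refl)
      nb-comm⁺ (fsuc (fsuc a)) (fsuc fzero) h _ tc _ _ = ⊥-elim (tc refl)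
      nb-comm⁺ (fsuc (fsuc a)) (fsuc (fsuc c)) fzero _ _ th _ = ⊥-elim (th refl)
      nb-comm⁺ (fsuc (fsuc a)) (fsuc (fsuc c)) (fsuc fzero) _ _ th _ = ⊥-elim (th refl)
      nb-comm⁺ (fsuc (fsuc a)) (fsuc (fsuc c)) (fsuc (fsuc h)) pa tc th d = cong keep (nb₀-comm pa tc th d)
      nb-f⁺ : ∀ a b {A B} → pt⁺ a ≡ just A → pt⁺ b ≡ just B → B ≢ A → nb⁺ (f⁺ a b) a ≡ b
      nb-f⁺ (fsuc (fsuc a)) (fsuc (fsuc b)) pa pb d = cong keep (nb₀-f₀ pa pb d)
      ty-f⁺ : ∀ a b {A B} → pt⁺ a ≡ just A → pt⁺ b ≡ just B → B ≢ A → ty⁺ (f⁺ a b) ≡ A ⊕ B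
      ty-f⁺ (fsuc (fsuc a)) (fsuc (fsuc b)) pa pb d = ty-f₀ pa pb d
      f-nb⁺ : ∀ a c {A} → pt⁺ a ≡ just A → ty⁺ c ≢ o → f⁺ a (nb⁺ c a) ≡ c
      f-nb⁺ (fsuc (fsuc a)) fzero _ tc = ⊥-elim (tc refl)
      f-nb⁺ (fsuc (fsuc a)) (fsuc fzero) _ tc = ⊥-elim (tc refl)
      f-nb⁺ (fsuc (fsuc a)) (fsuc (fsuc c)) pa tc = cong old (f₀-nb₀ pa tc)

    module _ (zs : List (Fin (suc m) × Fin m))
      (lists : ∀ {u c} → pt u ≢ nothing → ty c ≢ o → f K u (nb₀ c u) ≢ c → (u , c) ∈ˡ zs) where

      forwards backwards zs⁺ : List (Fin (suc (2 + m)) × Fin (2 + m))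
      forwards = map (λ c → keep (F.inject₁ c) , old (f₀ (F.inject₁ c) (fsuc c))) (allFin m)
      backwards = map (λ c → keep (fsuc c) , old (f₀ (fsuc c) (F.inject₁ c))) (allFin m)
      zs⁺ = map (λ (u , c) → keep u , old c) zs ++ forwards ++ backwards

      length-zs⁺ : length zs⁺ ≡ length zs + (m + m)
      length-zs⁺ = trans (Lₚ.length-++ (map _ zs)) (cong₂ _+_ (Lₚ.length-map _ zs)
        (trans (Lₚ.length-++ forwards) (cong₂ _+_ (trans (Lₚ.length-map _ (allFin m)) (length-allFin m))
          (trans (Lₚ.length-map _ (allFin m)) (length-allFin m)))))

      lists⁺ : ∀ {u c} → pt⁺ u ≢ nothing → ty⁺ c ≢ o → f prolonged u (nb⁺ c u) ≢ c → (u , c) ∈ˡ zs⁺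
      lists⁺ {fzero} nu = ⊥-elim (nu refl)
      lists⁺ {fsuc fzero} nu = ⊥-elim (nu refl)
      lists⁺ {fsuc (fsuc u)} {fzero} _ tc = ⊥-elim (tc refl)
      lists⁺ {fsuc (fsuc u)} {fsuc fzero} _ tc = ⊥-elim (tc refl)
      lists⁺ {fsuc (fsuc u)} {fsuc (fsuc c)} nu tc d with path u (nb₀ c u) in eq
      ... | nothing = Mₚ.∈-++⁺ˡ (Mₚ.∈-map⁺ (λ (u , c) → keep u , old c) (lists nu tc λ e → d (cong old e)))
      ... | just e with path-ends u (nb₀ c u) eq
      ...   | inj₁ (ends refl v≡) = Mₚ.∈-++⁺ʳ (map _ zs) (Mₚ.∈-++⁺ˡ (subst (λ z → (keep u , old z) ∈ˡ forwards)
                (trans (cong (f₀ u) (sym v≡)) (f₀-nb₀ (proj₂ (part u nu)) tc)) (Mₚ.∈-map⁺ _ (Mₚ.∈-allFin e))))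
      ...   | inj₂ (ends v≡ refl) = Mₚ.∈-++⁺ʳ (map _ zs) (Mₚ.∈-++⁺ʳ forwards (subst (λ z → (keep u , old z) ∈ˡ backwards)
                (trans (cong (f₀ u) (sym v≡)) (f₀-nb₀ (proj₂ (part u nu)) tc)) (Mₚ.∈-map⁺ _ (Mₚ.∈-allFin e))))

-- Extension and avoidance in a structured 1-factorization

record State (m κ ε D : ℕ) : Set where
  field
    R : Ref (suc m) m κ ε
    K : Col (suc m) m
    zs : List (Fin (suc m) × Fin m)
    len : length zs ≤ D
    lists : ∀ {u c} → Ref.pt R u ≢ nothing → Ref.ty R c ≢ o → f K u (Ref.nb₀ R c u) ≢ c → (u , c) ∈ˡ zs

-- A part has 2w + 2 vertices, an even number, so that a round robin fits inside; the order is 8(w +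
-- 1). Nothing is disturbed yet.
blocks-state : ∀ w → State (suc (w + w) + 3 * suc (suc (w + w))) (suc (suc (w + w))) 0 0
blocks-state w = record
  { R = Blocks.ref k inner ; K = Blocks.col k inner ; zs = [] ; len = z≤n
  ; lists = λ {u} {c} _ _ d → ⊥-elim (d (f-nb (Blocks.col k inner) c u)) }
  where
  k : ℕ
  k = suc (w + w)
  inner : Col (suc k) k
  inner = RoundRobin.roundRobin w

path-pre : ∀ m → Pre (path {m}) 2
path-pre m = record
  { φ-sym = path-sym ; φ-loop = path-loop ; φ-proper = path-proper ; φ-vertex = path-vertex ; φ-colour = path-colour }

-- Placing the path costs 192 pairs for each of its edges, and giving it the fresh colours disturbs
-- two more: 194 in all. The 6 is 2 + 4, as the path precoloring has bound 2.
prolong-state : ∀ {w κ ε D U T s} → Numbers (suc (suc (w + w))) (suc (w + w)) κ ε U T s → 6 ≤ s →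
  D + 192 * suc (w + w) ≤ T * T → State (suc (w + w)) κ ε D →
  State (suc (suc w + suc w)) (2 + κ) (2 + ε) (D + 194 * suc (w + w))
prolong-state {w} {κ} {ε} {D} {U} {T} ν 6≤s budget state =
  subst (λ z → State (suc (suc z)) (2 + κ) (2 + ε) (D + 194 * m)) (sym (ℕₚ.+-suc w w)) record
    { R = Prolong.ref⁺ w K⁺ on-path R
    ; K = Prolong.prolonged w K⁺ on-path
    ; zs = Prolong.zs⁺ w K⁺ on-path R zs₁ lists₁
    ; len = subst (_≤ D + 194 * m) (sym (trans (Prolong.length-zs⁺ w K⁺ on-path R zs₁ lists₁) (cong (_+ (m + m)) (length-as zs ch))))
        (ℕₚ.≤-trans (ℕₚ.+-monoˡ-≤ (m + m) (ℕₚ.+-mono-≤ len ch-len′)) (ℕₚ.≤-reflexive (regroup D m)))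
    ; lists = λ {u} {c} → Prolong.lists⁺ w K⁺ on-path R zs₁ lists₁ {u} {c} }
  where
  m : ℕ
  m = suc (w + w)
  open State state
  open Phases R ν
  todo : List (Fin (suc m) × Fin (suc m))
  todo = map (λ c → F.inject₁ c , fsuc c) (allFin m)
  todo-len : length todo ≡ m
  todo-len = trans (Lₚ.length-map _ (allFin m)) (length-allFin m)
  done : Satisfied (path-pre m) 6≤s K todo
  done = satisfy (path-pre m) 6≤s todo K zs (disturbed lists)
    (subst (λ z → length zs + 192 * z ≤ T * T) (sym todo-len) (ℕₚ.≤-trans (ℕₚ.+-monoˡ-≤ (192 * m) len) budget))
  open Satisfied done using (K⁺; ch; ch-len; step; sat)
  ch-len′ : length ch ≤ 192 * m
  ch-len′ = subst (λ z → length ch ≤ 192 * z) todo-len ch-len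
  on-path : ∀ c → f K⁺ (F.inject₁ c) (fsuc c) ≡ c
  on-path c = sat (Mₚ.∈-map⁺ (λ c → F.inject₁ c , fsuc c) (Mₚ.∈-allFin c)) (path-edge c)
  zs₁ : List (Fin (suc m) × Fin m)
  zs₁ = zs ++ as-colours ch
  lists₁ : ∀ {u c} → Ref.pt R u ≢ nothing → Ref.ty R c ≢ o → f K⁺ u (Ref.nb₀ R c u) ≢ c → (u , c) ∈ˡ zs₁
  lists₁ = Disturbed.lists (Disturbed-step step (disturbed lists))
  regroup : ∀ D m → D + 192 * m + (m + m) ≡ D + 194 * m
  regroup D m = trans (ℕₚ.+-assoc D (192 * m) (m + m)) (cong (D +_) (trans
    (cong (λ z → 192 * m + (m + z)) (sym (ℕₚ.+-identityʳ m))) (sym (ℕₚ.*-distribʳ-+ m 192 2))))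

module Solve {m κ ε D U T s : ℕ} (state : State (suc m) κ ε D) (ν : Numbers (suc (suc m)) (suc m) κ ε U T s)
  {φ : Fin (suc (suc m)) → Fin (suc (suc m)) → Maybe (Fin (suc m))} {r : ℕ} (pre : Pre φ r)
  {L : Forbid (suc (suc m)) (suc m)} (lists : Lists L r) (1≤r : 1 ≤ r)
  (compatible : ∀ {u v c} → φ u v ≡ just c → ¬ L u v c)
  (r+4≤s : r + 4 ≤ s) (r+r≤s : r + r ≤ s)
  (budget : D + 16000 * (suc (suc m) * r) ≤ T * T) where

  n C : ℕ
  n = suc (suc m)
  C = suc m

  open Cyclic m
  open State state renaming (lists to zs-lists)
  open Pre pre
  open Lists lists

  from : Fin n → List (Fin n × Fin n)
  from u = map (u ,_) (allFin n)

  V² : List (Fin n × Fin n)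
  V² = concatMap from (allFin n)

  V²-len : length V² ≤ n * n
  V²-len = subst (λ z → length V² ≤ z * n) (length-allFin n)
    (length-concatMap from (λ u → ℕₚ.≤-reflexive (trans (Lₚ.length-map (u ,_) (allFin n)) (length-allFin n))) (allFin n))

  V²-all : ∀ u v → (u , v) ∈ˡ V²
  V²-all u v = ∈-concatMap from (Mₚ.∈-allFin u) (Mₚ.∈-map⁺ (u ,_) (Mₚ.∈-allFin v))

  shift-to : Fin n → Fin n → Fin C → (Fin n × Fin n) × Fin C
  shift-to u v c = (u , v) , c -ᶻ f K u v

  bad-shifts′ : ∀ u v → Dec (u ≡ v) → List ((Fin n × Fin n) × Fin C)
  bad-shifts′ u v (yes _) = []
  bad-shifts′ u v (no u≢v) = map (shift-to u v) (Cover.elems (L-edge u≢v))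

  bad-shifts : Fin n × Fin n → List ((Fin n × Fin n) × Fin C)
  bad-shifts (u , v) = bad-shifts′ u v (u F.≟ v)

  bad-shifts-len : ∀ p → length (bad-shifts p) ≤ r
  bad-shifts-len (u , v) = bound (u F.≟ v)
    where
    bound : ∀ d → length (bad-shifts′ u v d) ≤ r
    bound (yes _) = z≤n
    bound (no u≢v) = subst (_≤ r) (sym (Lₚ.length-map (shift-to u v) (Cover.elems (L-edge u≢v)))) (Cover.bound (L-edge u≢v))

  bad-shifts-cover : ∀ {u v s} → u ≢ v → L u v (f K u v +ᶻ s) → ((u , v) , s) ∈ˡ bad-shifts (u , v)
  bad-shifts-cover {u} {v} {s} u≢v l = covered (u F.≟ v)
    where
    covered : ∀ d → ((u , v) , s) ∈ˡ bad-shifts′ u v d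
    covered (yes u≡v) = ⊥-elim (u≢v u≡v)
    covered (no u≢v′) = subst (λ z → ((u , v) , z) ∈ˡ map (shift-to u v) (Cover.elems (L-edge u≢v′))) (difference {f K u v} {s} refl)
      (Mₚ.∈-map⁺ (shift-to u v) (Cover.covers (L-edge u≢v′) l))

  Q : ℕ
  Q = 4 * (n * r)

  -- Averaging over the cyclic shifts of the colours: some shift of K has few forbidden edges.
  opaque
    good-shift : ∃ λ s → ∃ λ (ps : List (Fin n × Fin n)) → length ps ≤ Q ×
      (∀ {u v} → u ≢ v → L u v (f K u v +ᶻ s) → (u , v) ∈ˡ ps)
    good-shift with heavy-keys Q (concatMap bad-shifts V²)
    ... | bad , l , h with missing bad few-bad
      where
      total : length bad * Q ≤ n * n * r
      total = ℕₚ.≤-trans l (ℕₚ.≤-trans (length-concatMap bad-shifts bad-shifts-len V²) (ℕₚ.*-monoˡ-≤ r V²-len))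
      few-bad : length bad < C
      few-bad = ℕₚ.*-cancelʳ-< Q (length bad) C (ℕₚ.≤-<-trans total n²r<)
        where
        0<nr : 0 < n * r
        0<nr = ℕₚ.≤-trans 1≤r (ℕₚ.m≤n*m r n)
        shape : ∀ m x → suc m * (4 * x) ≡ suc (suc m) * x + (3 * m + 2) * x
        shape = solve-∀
        -- The shifts share a weight of at most `n * n * r`; since n < 4(n - 1), not all n - 1 of
        -- them can reach the threshold `Q`.
        n²r< : n * n * r < C * Q
        n²r< = subst₂ _<_ (sym (ℕₚ.*-assoc n n r)) (sym (shape m (n * r)))
          (ℕₚ.m<m+n (n * (n * r)) (ℕₚ.≤-trans 0<nr (ℕₚ.m≤n*m (n * r) (3 * m + 2) {{ℕ.>-nonZero (ℕₚ.≤-trans (s≤s z≤n) (ℕₚ.m≤n+m 2 (3 * m)))}})))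
    ...   | s , s∉ = let ps , lp , hp = h s s∉ in s , ps , lp
      , λ {u} {v} u≢v z → hp (∈-concatMap bad-shifts (V²-all u v) (bad-shifts-cover u≢v z))

  σ : Fin C
  σ = proj₁ good-shift

  unshift-shift : ∀ c → (c +ᶻ σ) -ᶻ σ ≡ c
  unshift-shift c = difference (+ᶻ-comm σ c)

  shift-unshift : ∀ c → (c -ᶻ σ) +ᶻ σ ≡ c
  shift-unshift c = trans (+ᶻ-comm (c -ᶻ σ) σ) (i+[a-i] σ c)

  -- Instead of shifting the 1-factorization and its pattern, the precoloring and the lists are
  -- shifted the opposite way; `solution` undoes this.
  φ′ : Fin n → Fin n → Maybe (Fin C)
  φ′ u v = Maybe.map (_-ᶻ σ) (φ u v)

  φ′-just : ∀ {u v c} → φ′ u v ≡ just c → φ u v ≡ just (c +ᶻ σ)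
  φ′-just {u} {v} e with φ u v
  φ′-just refl | just d = cong just (sym (shift-unshift d))

  pre′ : Pre φ′ r
  pre′ = record
    { φ-sym = λ u v → cong (Maybe.map (_-ᶻ σ)) (φ-sym u v)
    ; φ-loop = λ u → cong (Maybe.map (_-ᶻ σ)) (φ-loop u)
    ; φ-proper = λ {u} {v} {w} e e′ → φ-proper {u} (φ′-just {u} {v} e) (φ′-just {u} {w} e′)
    ; φ-vertex = λ u → Cover-mono ℕₚ.≤-refl (λ {v} d e → d (cong (Maybe.map (_-ᶻ σ)) e)) (φ-vertex u)
    ; φ-colour = λ c → Cover-mono ℕₚ.≤-refl (λ {v} (w , e) → w , φ′-just {v} {w} e) (φ-colour (c +ᶻ σ)) }

  L′ : Forbid n C
  L′ u v c = L u v (c +ᶻ σ)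

  lists′ : Lists L′ r
  lists′ = record
    { L-sym = record { flip = flip L-sym }
    ; L-dec = λ u v c → L-dec u v (c +ᶻ σ)
    ; L-vertex = λ u c → L-vertex u (c +ᶻ σ)
    ; L-edge = λ u≢v → Cover-image (_-ᶻ σ) (λ {c} l → c +ᶻ σ , l , unshift-shift c) (L-edge u≢v) }

  open Phases R ν

  coloured : Fin n → List (Fin n × Fin n)
  coloured u = map (u ,_) (Cover.elems (Pre.φ-vertex pre′ u))

  todo : List (Fin n × Fin n)
  todo = concatMap coloured (allFin n)

  todo-len : length todo ≤ n * r
  todo-len = subst (λ z → length todo ≤ z * r) (length-allFin n)
    (length-concatMap coloured (λ u → ℕₚ.≤-trans (ℕₚ.≤-reflexive (Lₚ.length-map _ (Cover.elems (Pre.φ-vertex pre′ u)))) (Cover.bound (Pre.φ-vertex pre′ u))) (allFin n))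

  opaque
    budget₁ : length zs + 192 * length todo ≤ T * T
    budget₁ = ℕₚ.≤-trans (ℕₚ.+-mono-≤ len (ℕₚ.*-mono-≤ (toWitness {a? = 192 ℕ.≤? 16000} tt) todo-len)) budget

  opaque
    first : Satisfied pre′ r+4≤s K todo
    first = satisfy pre′ r+4≤s todo K zs (disturbed zs-lists) budget₁

  open Satisfied first using (K⁺; ch; ch-len; step; sat)

  all-satisfied : ∀ {u v c} → φ′ u v ≡ just c → f K⁺ u v ≡ c
  all-satisfied {u} {v} e = sat (∈-concatMap coloured (Mₚ.∈-allFin u)
    (Mₚ.∈-map⁺ (u ,_) (Cover.covers (Pre.φ-vertex pre′ u) λ n → case trans (sym e) n of λ ()))) e

  ch-len′ : length ch ≤ 192 * (n * r)
  ch-len′ = ℕₚ.≤-trans ch-len (ℕₚ.*-monoʳ-≤ 192 todo-len)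

  -- The extension phase pays no regard to the lists, so every pair it recoloured is counted as a
  -- possible conflict.
  conflicts : List (Fin n × Fin n)
  conflicts = proj₁ (proj₂ good-shift) ++ ch

  conflicts-len : length conflicts ≤ Q + 192 * (n * r)
  conflicts-len = subst (_≤ Q + 192 * (n * r)) (sym (Lₚ.length-++ (proj₁ (proj₂ good-shift))))
    (ℕₚ.+-mono-≤ (proj₁ (proj₂ (proj₂ good-shift))) ch-len′)

  opaque
    budget₂ : length (zs ++ as-colours ch) + 80 * length conflicts ≤ T * T
    budget₂ = subst (λ z → z + 80 * length conflicts ≤ T * T) (sym (length-as zs ch))
      (ℕₚ.≤-trans (ℕₚ.+-mono-≤ (ℕₚ.+-mono-≤ len ch-len′) (ℕₚ.*-monoʳ-≤ 80 conflicts-len))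
      (ℕₚ.≤-trans (ℕₚ.≤-reflexive (regroup D (n * r)))
      (ℕₚ.≤-trans (ℕₚ.+-monoʳ-≤ D (ℕₚ.*-monoˡ-≤ (n * r) (toWitness {a? = 15872 ℕ.≤? 16000} tt))) budget)))
      where
      regroup : ∀ D x → D + 192 * x + 80 * (4 * x + 192 * x) ≡ D + 15872 * x
      regroup D x = trans (ℕₚ.+-assoc D (192 * x) _) (cong (D +_) (trans
        (cong (192 * x +_) (trans (cong (80 *_) (sym (ℕₚ.*-distribʳ-+ x 4 192))) (sym (ℕₚ.*-assoc 80 196 x))))
        (sym (ℕₚ.*-distribʳ-+ x 192 15680))))

  conflicts-all : ∀ u v → u ≢ v → L′ u v (f K⁺ u v) → (u , v) ∈ˡ conflicts
  conflicts-all u v u≢v z with Step.at step u v u≢v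
  ... | inj₁ e = Mₚ.∈-++⁺ˡ (proj₂ (proj₂ (proj₂ good-shift)) u≢v (subst (L′ u v) e z))
  ... | inj₂ (∈ch , _) = Mₚ.∈-++⁺ʳ (proj₁ (proj₂ good-shift)) ∈ch

  opaque
    second : ∃ λ K₂ → (∀ {u v c} → φ′ u v ≡ just c → f K₂ u v ≡ c) × (∀ u v → u ≢ v → ¬ L′ u v (f K₂ u v))
    second = resolve pre′ r+4≤s lists′ r+r≤s (λ {u} {v} e → compatible {u} {v} (φ′-just {u} {v} e)) conflicts K⁺
      (zs ++ as-colours ch) (Disturbed-step step (disturbed zs-lists)) budget₂ all-satisfied conflicts-all

  solution : ∃ λ (g : Fin n → Fin n → Fin C) →
    (∀ u v → g u v ≡ g v u) × (∀ {u v w} → u ≢ v → u ≢ w → g u v ≡ g u w → v ≡ w) ×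
    (∀ u v c → φ u v ≡ just c → g u v ≡ c) × (∀ u v → u ≢ v → ¬ L u v (g u v))
  solution = let K₂ , ext , free = second in
    (λ u v → f K₂ u v +ᶻ σ)
    , (λ u v → cong (_+ᶻ σ) (f-sym K₂ u v))
    , (λ {u} u≢v u≢w e → f-inj K₂ u≢v u≢w (+ᶻ-cancelˡ σ _ _ (trans (+ᶻ-comm σ _) (trans e (+ᶻ-comm _ σ)))))
    , (λ u v c e → trans (cong (_+ᶻ σ) (ext {u} {v} (cong (Maybe.map (_-ᶻ σ)) e))) (shift-unshift c))
    , free

-- Choice of the constants

-- In terms of r = ⌊m / B⌋ the numbers T = t₁ r and U = t₂ r must satisfy n r ≪ T² and n T ≪ U² ≪ n² for n ≈ B r,
-- hence t₁² ≫ B ≈ β⁴, t₂² ≫ t₁ B ≈ β⁶ and t₂ ≪ B.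
module Constants where
  opaque
    β B t₁ t₂ A E : ℕ
    β = 20000
    B = β * β * (β * β)
    t₁ = 300 * (β * β)
    t₂ = 70 * (β * (β * β))
    -- `A` and `E` are multiples of n r. `E` pays for three prolongations; extension and removal of
    -- conflicts take 16000 · 2, as the bounds there are 2 r.
    A = 33000
    E = 582

    0<B : 0 < B
    0<B = toWitness {a? = 0 ℕ.<? B} tt

    -- Up to powers of `β` this is 66000 ≤ 300², `total-ok` is 16 · 300 ≤ 70², and `size-ok` is 240
    -- · 70 < 20000 with room for the constant term.
    budget-ok : A * 2 * B ≤ t₁ * t₁
    budget-ok = toWitness {a? = A * 2 * B ℕ.≤? t₁ * t₁} tt

    total-ok : 16 * (t₁ * B) ≤ t₂ * t₂
    total-ok = toWitness {a? = 16 * (t₁ * B) ℕ.≤? t₂ * t₂} tt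

    τ-ok : 7 * (t₁ + 170) ≤ t₂
    τ-ok = toWitness {a? = 7 * (t₁ + 170) ℕ.≤? t₂} tt

    size-ok : 62 + 4 * 60 * t₂ ≤ B
    size-ok = toWitness {a? = 62 + 4 * 60 * t₂ ℕ.≤? B} tt

    A-big : 8 ≤ A
    A-big = toWitness {a? = 8 ℕ.≤? A} tt

    E-big : 3 * 194 ≤ E
    E-big = toWitness {a? = 3 * 194 ℕ.≤? E} tt

    prolong-ok : E + 192 ≤ A
    prolong-ok = toWitness {a? = E + 192 ℕ.≤? A} tt

    solve-ok : E + 16000 * 2 ≤ A
    solve-ok = toWitness {a? = E + 16000 * 2 ℕ.≤? A} tt

    t₁-big : 8 ≤ t₁
    t₁-big = toWitness {a? = 8 ℕ.≤? t₁} tt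

open Constants public

Solution : ∀ {n m : ℕ} → (Fin n → Fin n → Maybe (Fin m)) → Forbid n m → Set
Solution {n} {m} φ L = ∃ λ (g : Fin n → Fin n → Fin m) →
  (∀ u v → g u v ≡ g v u) × (∀ {u v w} → u ≢ v → u ≢ w → g u v ≡ g u w → v ≡ w) ×
  (∀ u v c → φ u v ≡ just c → g u v ≡ c) × (∀ u v → u ≢ v → ¬ L u v (g u v))

-- Inequalities between the thresholds

≤-scale : ∀ {a b} x {y} → a ≤ b → b * x ≤ y → a * x ≤ y
≤-scale x a≤b l = ℕₚ.≤-trans (ℕₚ.*-monoˡ-≤ x a≤b) l

≤-combine : ∀ {a b c} x {y z w} → a + b ≤ c → c * x ≤ w → y ≤ a * x → z ≤ b * x → y + z ≤ w
≤-combine {a} {b} x ab≤c l y≤ z≤ = ℕₚ.≤-trans (ℕₚ.+-mono-≤ y≤ z≤)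
  (ℕₚ.≤-trans (ℕₚ.≤-reflexive (sym (ℕₚ.*-distribʳ-+ x a b))) (≤-scale x ab≤c l))

≤-square : ∀ a {b t n r} → n ≤ 2 * (b * r) → a * 2 * b ≤ t * t → a * (n * r) ≤ t * r * (t * r)
≤-square a {b} {t} {n} {r} n≤ l = begin
  a * (n * r)            ≤⟨ ℕₚ.*-monoʳ-≤ a (ℕₚ.*-monoˡ-≤ r n≤) ⟩
  a * (2 * (b * r) * r)  ≡⟨ shape₁ a b r ⟩
  a * 2 * b * (r * r)    ≤⟨ ℕₚ.*-monoˡ-≤ (r * r) l ⟩
  t * t * (r * r)        ≡⟨ shape₂ t r ⟩
  t * r * (t * r)        ∎
  where
  open ℕₚ.≤-Reasoning
  shape₁ : ∀ a b r → a * (2 * (b * r) * r) ≡ a * 2 * b * (r * r)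
  shape₁ = solve-∀
  shape₂ : ∀ t r → t * t * (r * r) ≡ t * r * (t * r)
  shape₂ = solve-∀

≤-rescale : ∀ {a b c r B x} → a + b * c ≤ B → 1 ≤ r → B * r ≤ x → a + b * (c * r) ≤ x
≤-rescale {a} {b} {c} {r} {B} {x} l 1≤r u = begin
  a + b * (c * r)    ≡⟨ cong (a +_) (ℕₚ.*-assoc b c r) ⟨
  a + b * c * r      ≤⟨ ℕₚ.+-monoˡ-≤ (b * c * r) (ℕₚ.m≤m*n a r {{ℕ.>-nonZero 1≤r}}) ⟩
  a * r + b * c * r  ≡⟨ ℕₚ.*-distribʳ-+ r a (b * c) ⟨
  (a + b * c) * r    ≤⟨ ℕₚ.*-monoˡ-≤ r l ⟩
  B * r              ≤⟨ u ⟩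
  x                  ∎
  where open ℕₚ.≤-Reasoning

≤-triple : ∀ a {c i n r} → i ≤ 3 → 1 ≤ r → 3 * a ≤ c → i * (a * n) ≤ c * (n * r)
≤-triple a {c} {i} {n} {r} i≤3 1≤r l = begin
  i * (a * n)  ≤⟨ ℕₚ.*-monoˡ-≤ (a * n) i≤3 ⟩
  3 * (a * n)  ≡⟨ ℕₚ.*-assoc 3 a n ⟨
  3 * a * n    ≤⟨ ℕₚ.*-mono-≤ l (ℕₚ.m≤m*n n r {{ℕ.>-nonZero 1≤r}}) ⟩
  c * (n * r)  ∎
  where open ℕₚ.≤-Reasoning

≤-regroup : ∀ a {m n r y} → m ≤ n → a * (n * r) ≤ y → m * (a * r) ≤ y
≤-regroup a {m} {n} {r} m≤n l = ℕₚ.≤-trans (ℕₚ.*-monoˡ-≤ (a * r) m≤n) (ℕₚ.≤-trans (ℕₚ.≤-reflexive (shape n a r)) l)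
  where
  shape : ∀ n a r → n * (a * r) ≡ a * (n * r)
  shape = solve-∀

≤-double : ∀ a n r → a * (n * (2 * r)) ≤ a * 2 * (n * r)
≤-double a n r = ℕₚ.≤-reflexive (shape a n r)
  where
  shape : ∀ a n r → a * (n * (2 * r)) ≡ a * 2 * (n * r)
  shape = solve-∀

≤-total : ∀ {t u b r m n} → m ≤ n → n ≤ 2 * (b * r) → 16 * (t * b) ≤ u * u →
  n * (6 * (t * r)) + 2 * (t * r) * m ≤ u * r * (u * r)
≤-total {t} {u} {b} {r} {m} {n} m≤n n≤ l = begin
  n * (6 * (t * r)) + 2 * (t * r) * m  ≤⟨ ℕₚ.+-monoʳ-≤ (n * (6 * (t * r))) (ℕₚ.*-monoʳ-≤ (2 * (t * r)) m≤n) ⟩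
  n * (6 * (t * r)) + 2 * (t * r) * n  ≡⟨ shape₁ n t r ⟩
  8 * (t * r) * n                      ≤⟨ ℕₚ.*-monoʳ-≤ (8 * (t * r)) n≤ ⟩
  8 * (t * r) * (2 * (b * r))          ≡⟨ shape₂ t b r ⟩
  16 * (t * b) * (r * r)               ≤⟨ ℕₚ.*-monoˡ-≤ (r * r) l ⟩
  u * u * (r * r)                      ≡⟨ shape₃ u r ⟩
  u * r * (u * r)                      ∎
  where
  open ℕₚ.≤-Reasoning
  shape₁ : ∀ n t r → n * (6 * (t * r)) + 2 * (t * r) * n ≡ 8 * (t * r) * n
  shape₁ = solve-∀
  shape₂ : ∀ t b r → 8 * (t * r) * (2 * (b * r)) ≡ 16 * (t * b) * (r * r)
  shape₂ = solve-∀
  shape₃ : ∀ u r → u * u * (r * r) ≡ u * r * (u * r)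
  shape₃ = solve-∀

≤-affine : ∀ c k {t u r} → 1 ≤ r → c * (t + k) ≤ u → c * (t * r + k) ≤ u * r
≤-affine c k {t} {u} {r} 1≤r l = begin
  c * (t * r + k)      ≤⟨ ℕₚ.*-monoʳ-≤ c (ℕₚ.+-monoʳ-≤ (t * r) (ℕₚ.m≤m*n k r {{ℕ.>-nonZero 1≤r}})) ⟩
  c * (t * r + k * r)  ≡⟨ cong (c *_) (ℕₚ.*-distribʳ-+ r t k) ⟨
  c * ((t + k) * r)    ≡⟨ ℕₚ.*-assoc c (t + k) r ⟨
  c * (t + k) * r      ≤⟨ ℕₚ.*-monoˡ-≤ r l ⟩
  u * r                ∎
  where open ℕₚ.≤-Reasoning

-- Three parts take about 6w of the 8w colours. The remaining 2w have to hold the small exceptions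
-- and the growth 4i ≤ 12 due to prolongation.
m-room : ∀ {i w κ x} → i ≤ 3 → κ ≡ 2 * i + (2 + 2 * w) → 12 + x ≤ 2 * w → 3 * κ + x < suc (i + (3 + 4 * w) + (i + (3 + 4 * w)))
m-room {i} {w} {κ} {x} i≤3 refl room = begin-strict
  3 * (2 * i + (2 + 2 * w)) + x                 ≡⟨ shape₁ i w x ⟩
  2 * i + 6 * w + 6 + (4 * i + x)               ≤⟨ ℕₚ.+-monoʳ-≤ (2 * i + 6 * w + 6) (ℕₚ.+-monoˡ-≤ x (ℕₚ.*-monoʳ-≤ 4 i≤3)) ⟩
  2 * i + 6 * w + 6 + (12 + x)                  ≤⟨ ℕₚ.+-monoʳ-≤ (2 * i + 6 * w + 6) room ⟩
  2 * i + 6 * w + 6 + 2 * w                     <⟨ ℕₚ.n<1+n _ ⟩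
  suc (2 * i + 6 * w + 6 + 2 * w)               ≡⟨ shape₂ i w ⟩
  suc (i + (3 + 4 * w) + (i + (3 + 4 * w)))     ∎
  where
  open ℕₚ.≤-Reasoning
  shape₁ : ∀ i w x → 3 * (2 * i + (2 + 2 * w)) + x ≡ 2 * i + 6 * w + 6 + (4 * i + x)
  shape₁ = solve-∀
  shape₂ : ∀ i w → suc (2 * i + 6 * w + 6 + 2 * w) ≡ suc (i + (3 + 4 * w) + (i + (3 + 4 * w)))
  shape₂ = solve-∀

order-shape : ∀ j w → suc (suc (j + (3 + 4 * w) + (j + (3 + 4 * w)))) ≡ 8 + 2 * j + 4 * (2 * w)
order-shape = solve-∀

blocks-shape : ∀ w → suc (w + w) + 3 * suc (suc (w + w)) ≡ suc (3 + 4 * w + (3 + 4 * w))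
blocks-shape = solve-∀

-- Order 8(w₀ + 1) + 2j, reached by at most three prolongations

module Large (w₀ j r : ℕ) (j≤3 : j ≤ 3) (1≤r : 1 ≤ r)
  (lower : B * r ≤ suc (suc (j + (3 + 4 * w₀) + (j + (3 + 4 * w₀)))))
  (upper : suc (suc (j + (3 + 4 * w₀) + (j + (3 + 4 * w₀)))) ≤ 2 * (B * r)) where

  w₁ T U : ℕ
  w₁ = 3 + 4 * w₀
  T = t₁ * r
  U = t₂ * r

  order-mono : ∀ {i} → i ≤ j → (suc (suc (i + w₁ + (i + w₁)))) ≤ (suc (suc (j + w₁ + (j + w₁))))
  order-mono i≤j = s≤s (s≤s (ℕₚ.+-mono-≤ (ℕₚ.+-monoˡ-≤ w₁ i≤j) (ℕₚ.+-monoˡ-≤ w₁ i≤j)))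

  order≤ : ∀ {i} → i ≤ j → (suc (suc (i + w₁ + (i + w₁)))) ≤ 2 * (B * r)
  order≤ i≤j = ℕₚ.≤-trans (order-mono i≤j) upper

  roomy : 12 + 60 * U ≤ 2 * w₀
  roomy = ℕₚ.*-cancelˡ-≤ 4 (ℕₚ.+-cancelˡ-≤ 14 _ _ (ℕₚ.≤-trans (ℕₚ.≤-reflexive (spread (60 * U)))
    (ℕₚ.≤-trans (ℕₚ.≤-trans (ℕₚ.+-monoʳ-≤ 62 (ℕₚ.≤-reflexive (sym (ℕₚ.*-assoc 4 60 U)))) (≤-rescale {62} {4 * 60} {t₂} {r} {B} size-ok 1≤r lower))
      (ℕₚ.≤-trans (ℕₚ.≤-reflexive (order-shape j w₀)) (ℕₚ.+-monoˡ-≤ (4 * (2 * w₀)) (ℕₚ.+-monoʳ-≤ 8 (ℕₚ.*-monoʳ-≤ 2 j≤3)))))))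
    where
    spread : ∀ x → 14 + 4 * (12 + x) ≡ 62 + 4 * x
    spread x = cong (14 +_) (ℕₚ.*-distribˡ-+ 4 12 x)

  nr-bound : ∀ {i} → i ≤ j → A * ((suc (suc (i + w₁ + (i + w₁)))) * r) ≤ T * T
  nr-bound {i} i≤j = ≤-square A {B} {t₁} {suc (suc (i + w₁ + (i + w₁)))} {r} (order≤ {i} i≤j) budget-ok

  κ ε D : ℕ → ℕ
  κ zero = suc (suc (w₀ + w₀))
  κ (suc i) = 2 + κ i
  ε zero = 0
  ε (suc i) = 2 + ε i
  D zero = 0
  D (suc i) = D i + 194 * suc (i + w₁ + (i + w₁))

  κ-value : ∀ i → κ i ≡ 2 * i + (2 + 2 * w₀)
  κ-value zero = cong (λ z → suc (suc (w₀ + z))) (sym (ℕₚ.+-identityʳ w₀))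
  κ-value (suc i) = trans (cong (2 +_) (κ-value i)) (cong (_+ (2 + 2 * w₀)) (sym (ℕₚ.*-suc 2 i)))

  ε-value : ∀ i → ε i ≡ 2 * i
  ε-value zero = refl
  ε-value (suc i) = trans (cong (2 +_) (ε-value i)) (sym (ℕₚ.*-suc 2 i))

  D≤ : ∀ {i} → i ≤ j → D i ≤ i * (194 * (suc (suc (j + w₁ + (j + w₁)))))
  D≤ {zero} _ = z≤n
  D≤ {suc i} i<j = ℕₚ.≤-trans
    (ℕₚ.+-mono-≤ (D≤ (ℕₚ.<⇒≤ i<j)) (ℕₚ.*-monoʳ-≤ 194 (ℕₚ.≤-trans (ℕₚ.n≤1+n _) (order-mono (ℕₚ.<⇒≤ i<j)))))
    (ℕₚ.≤-reflexive (ℕₚ.+-comm (i * (194 * (suc (suc (j + w₁ + (j + w₁)))))) (194 * (suc (suc (j + w₁ + (j + w₁)))))))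

  D-bound : ∀ {i} → i ≤ j → D i ≤ E * ((suc (suc (j + w₁ + (j + w₁)))) * r)
  D-bound {i} i≤j = ℕₚ.≤-trans (D≤ i≤j) (≤-triple 194 {E} {i} {suc (suc (j + w₁ + (j + w₁)))} {r} (ℕₚ.≤-trans i≤j j≤3) 1≤r E-big)

  room : ∀ {i} → i ≤ j → 3 * κ i + 60 * U < suc (i + w₁ + (i + w₁))
  room {i} i≤j = m-room {i} {w₀} {κ i} {60 * U} (ℕₚ.≤-trans i≤j j≤3) (κ-value i) roomy

  n-big′ : ∀ {i} → i ≤ j → 3 * κ i + 60 * U < suc (suc (i + w₁ + (i + w₁)))
  n-big′ {i} i≤j = ℕₚ.<-trans (room i≤j) (ℕₚ.n<1+n _)

  m-big′ : ∀ {i} → i ≤ j → 3 * κ i + 60 * U < suc (i + w₁ + (i + w₁))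
  m-big′ {i} i≤j = (room i≤j)

  1≤T′ : ∀ {i} → i ≤ j → 1 ≤ T
  1≤T′ {i} i≤j = ℕₚ.*-mono-≤ (ℕₚ.≤-trans (s≤s z≤n) t₁-big) 1≤r

  s≤T′ : ∀ {i} → i ≤ j → 8 * r ≤ T
  s≤T′ {i} i≤j = ℕₚ.*-monoˡ-≤ r t₁-big

  ε+2≤T′ : ∀ {i} → i ≤ j → ε i + 2 ≤ T
  ε+2≤T′ {i} i≤j = subst (λ z → z + 2 ≤ T) (sym (ε-value i)) (ℕₚ.≤-trans (ℕₚ.+-monoˡ-≤ 2 (ℕₚ.*-monoʳ-≤ 2 (ℕₚ.≤-trans i≤j j≤3)))
        (ℕₚ.≤-trans t₁-big (ℕₚ.m≤m*n t₁ r {{ℕ.>-nonZero 1≤r}})))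

  ms≤T²′ : ∀ {i} → i ≤ j → suc (i + w₁ + (i + w₁)) * (8 * r) ≤ T * T
  ms≤T²′ {i} i≤j = ≤-regroup 8 {suc (i + w₁ + (i + w₁))} {suc (suc (i + w₁ + (i + w₁)))} {r} (ℕₚ.n≤1+n _) (≤-scale {8} {A} ((suc (suc (i + w₁ + (i + w₁)))) * r) A-big (nr-bound {i} i≤j))

  total≤U²′ : ∀ {i} → i ≤ j → suc (suc (i + w₁ + (i + w₁))) * (6 * T) + (2 * T) * suc (i + w₁ + (i + w₁)) ≤ U * U
  total≤U²′ {i} i≤j = ≤-total {t₁} {t₂} {B} {r} {suc (i + w₁ + (i + w₁))} {suc (suc (i + w₁ + (i + w₁)))} (ℕₚ.n≤1+n _) (order≤ {i} i≤j) total-ok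

  τ≤U′ : ∀ {i} → i ≤ j → 7 * (T + 170) ≤ U
  τ≤U′ {i} i≤j = ≤-affine 7 170 {t₁} {t₂} {r} 1≤r τ-ok

  -- With 2 r as bound for precoloring and lists, `s` has to be at least 2 r + 4, 4 r and, for the
  -- path, 6; 8 r is enough.
  numbers : ∀ {i} → i ≤ j → Numbers (suc (suc (i + w₁ + (i + w₁)))) (suc (i + w₁ + (i + w₁))) (κ i) (ε i) U T (8 * r)
  numbers i≤j = record
    { n-big = n-big′ i≤j
    ; m-big = m-big′ i≤j
    ; 1≤T = 1≤T′ i≤j
    ; s≤T = s≤T′ i≤j
    ; ε+2≤T = ε+2≤T′ i≤j
    ; ms≤T² = ms≤T²′ i≤j
    ; total≤U² = total≤U²′ i≤j
    ; τ≤U = τ≤U′ i≤j }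

  ≤8r : ∀ k → {_ : True (k ℕ.≤? 8)} → k * r ≤ 8 * r
  ≤8r k {k≤8} = ℕₚ.*-monoˡ-≤ r (toWitness k≤8)

  state : ∀ i → i ≤ j → State (suc (i + w₁ + (i + w₁))) (κ i) (ε i) (D i)
  state zero _ = subst (λ z → State z (κ 0) 0 0) (blocks-shape w₀) (blocks-state w₀)
  state (suc i) i<j = prolong-state (numbers i≤j)
    (ℕₚ.≤-trans (ℕₚ.m≤m*n 6 r {{ℕ.>-nonZero 1≤r}}) (≤8r 6))
    (≤-combine {E} {192} {A} ((suc (suc (j + w₁ + (j + w₁)))) * r) prolong-ok (nr-bound {j} ℕₚ.≤-refl) (D-bound {i} i≤j)
      (ℕₚ.*-monoʳ-≤ 192 (ℕₚ.≤-trans (ℕₚ.n≤1+n _) (ℕₚ.≤-trans (order-mono {i} i≤j) (ℕₚ.m≤m*n (suc (suc (j + w₁ + (j + w₁)))) r {{ℕ.>-nonZero 1≤r}})))))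
    (state i i≤j)
    where
    i≤j : i ≤ j
    i≤j = ℕₚ.<⇒≤ i<j

  solve : ∀ {φ : Fin (suc (suc (j + w₁ + (j + w₁)))) → Fin (suc (suc (j + w₁ + (j + w₁)))) → Maybe (Fin (suc (j + w₁ + (j + w₁))))} {L} → Pre φ (2 * r) → Lists L (2 * r) →
    (∀ {u v c} → φ u v ≡ just c → ¬ L u v c) → Solution φ L
  solve pre lists compatible = Solve.solution (state j ℕₚ.≤-refl) (numbers ℕₚ.≤-refl) pre lists
    (ℕₚ.≤-trans 1≤r (ℕₚ.m≤n*m r 2)) compatible
    (ℕₚ.≤-trans (ℕₚ.+-monoʳ-≤ (2 * r) (ℕₚ.m≤m*n 4 r {{ℕ.>-nonZero 1≤r}})) (ℕₚ.≤-trans (ℕₚ.≤-reflexive (sym (ℕₚ.*-distribʳ-+ r 2 4))) (≤8r 6)))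
    (ℕₚ.≤-trans (ℕₚ.≤-reflexive (sym (ℕₚ.*-distribʳ-+ r 2 2))) (≤8r 4))
    (≤-combine {E} {16000 * 2} {A} ((suc (suc (j + w₁ + (j + w₁)))) * r) solve-ok (nr-bound {j} ℕₚ.≤-refl)
      (D-bound {j} ℕₚ.≤-refl) (≤-double 16000 (suc (suc (j + w₁ + (j + w₁)))) r))

-- For r = 0 the bounds leave neither a precoloured edge nor a forbidden colour, and any
-- 1-factorization will do; this settles the small orders. For r ≥ 1 the order is at least `B`, so w
-- ≥ 3, and division of w - 3 by 4 gives `j` and `w₀`.
factorize : ∀ w r {φ : Fin (suc (suc (w + w))) → Fin (suc (suc (w + w))) → Maybe (Fin (suc (w + w)))} {L} →
  B * r ≤ suc (suc (w + w)) → (1 ≤ r → suc (suc (w + w)) ≤ 2 * (B * r)) → Pre φ (2 * r) → Lists L (2 * r) →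
  (∀ {u v c} → φ u v ≡ just c → ¬ L u v c) → Solution φ L
factorize w zero {φ} _ _ pre lists _ =
  f K , f-sym K , f-inj K
  , (λ u v c e → ⊥-elim (none (Pre.φ-vertex pre u) (λ n → case trans (sym e) n of λ ())))
  , (λ u v u≢v l → none (Lists.L-edge lists u≢v) l)
  where
  K : Col (suc (suc (w + w))) (suc (w + w))
  K = RoundRobin.roundRobin w
  none : ∀ {j} {P : Fin j → Set} → Cover 0 P → ∀ {i} → ¬ P i
  none (cover [] _ c) p with c p
  ... | ()
factorize w r@(suc _) {φ} {L} lower upper pre lists compatible = at w w≡ lower upper pre lists compatible
  where
  j w₀ : ℕ
  j = (w ∸ 3) % 4
  w₀ = (w ∸ 3) / 4
  3≤w : 3 ≤ w
  3≤w = ℕₚ.≮⇒≥ λ w<3 → ℕₚ.<⇒≱ (s≤s (s≤s (s≤s (ℕₚ.+-mono-≤ (ℕₚ.<⇒≤pred w<3) (ℕₚ.<⇒≤pred w<3)))))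
    (ℕₚ.≤-trans (ℕₚ.≤-trans (toWitness {a? = 7 ℕ.≤? 62} tt) (ℕₚ.m≤m+n 62 (4 * 60 * t₂))) (ℕₚ.≤-trans size-ok (ℕₚ.≤-trans (ℕₚ.m≤m*n B r) lower)))
  w≡ : w ≡ j + (3 + 4 * w₀)
  w≡ = begin
    w                      ≡⟨ ℕₚ.m+[n∸m]≡n 3≤w ⟨
    3 + (w ∸ 3)            ≡⟨ cong (3 +_) (DM.m≡m%n+[m/n]*n (w ∸ 3) 4) ⟩
    3 + (j + w₀ * 4)       ≡⟨ shape j w₀ ⟩
    j + (3 + 4 * w₀)       ∎
    where
    open ≡-Reasoning
    shape : ∀ j w → 3 + (j + w * 4) ≡ j + (3 + 4 * w)
    shape = solve-∀
  at : ∀ w → w ≡ j + (3 + 4 * w₀) → {φ : Fin (suc (suc (w + w))) → Fin (suc (suc (w + w))) → Maybe (Fin (suc (w + w)))} {L : Forbid (suc (suc (w + w))) (suc (w + w))} →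
    B * r ≤ suc (suc (w + w)) → (1 ≤ r → suc (suc (w + w)) ≤ 2 * (B * r)) → Pre φ (2 * r) → Lists L (2 * r) →
    (∀ {u v c} → φ u v ≡ just c → ¬ L u v c) → Solution φ L
  at _ refl lower upper = Large.solve w₀ j r (ℕₚ.<⇒≤pred (DM.m%n<n (w ∸ 3) 4)) (s≤s z≤n) lower (upper (s≤s z≤n))

-- Counting

isYes-true : ∀ {A : Set} (d : Dec A) → A → ⌊ d ⌋ ≡ true
isYes-true (yes _) _ = refl
isYes-true (no ¬a) a = ⊥-elim (¬a a)

isYes-false : ∀ {A : Set} (d : Dec A) → ¬ A → ⌊ d ⌋ ≡ false
isYes-false (yes a) ¬a = ⊥-elim (¬a a)
isYes-false (no _) _ = refl

trues : ∀ {k} → (Fin k → Bool) → List (Fin k)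
trues {zero} p = []
trues {suc k} p = (if p fzero then fzero ∷ [] else []) ++ map fsuc (trues (p ∘ fsuc))

length-trues : ∀ {k} (p : Fin k → Bool) → length (trues p) ≡ count p
length-trues {zero} p = refl
length-trues {suc k} p with p fzero
... | true = cong suc (trans (Lₚ.length-map fsuc (trues (p ∘ fsuc))) (length-trues (p ∘ fsuc)))
... | false = trans (Lₚ.length-map fsuc (trues (p ∘ fsuc))) (length-trues (p ∘ fsuc))

∈-trues : ∀ {k} (p : Fin k → Bool) {i} → p i ≡ true → i ∈ˡ trues p
∈-trues p {fzero} e rewrite e = here refl
∈-trues p {fsuc i} e = Mₚ.∈-++⁺ʳ (if p fzero then fzero ∷ [] else []) (Mₚ.∈-map⁺ fsuc (∈-trues (p ∘ fsuc) e))

count-cover : ∀ {k b} {P : Fin k → Set} (p : Fin k → Bool) → (∀ {i} → P i → p i ≡ true) → count p ≤ b → Cover b P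
count-cover {b = b} p P⇒p l = cover (trues p) (subst (_≤ b) (sym (length-trues p)) l) (∈-trues p ∘ P⇒p)

members : ∀ {k} → Subset k → List (Fin k)
members Vec.[] = []
members (true Vec.∷ S) = fzero ∷ map fsuc (members S)
members (false Vec.∷ S) = map fsuc (members S)

length-members : ∀ {k} (S : Subset k) → length (members S) ≡ ∣ S ∣
length-members Vec.[] = refl
length-members (true Vec.∷ S) = cong suc (trans (Lₚ.length-map fsuc (members S)) (length-members S))
length-members (false Vec.∷ S) = trans (Lₚ.length-map fsuc (members S)) (length-members S)

∈-members : ∀ {k} {S : Subset k} {i} → i ∈ˢ S → i ∈ˡ members S
∈-members Vec.here = here refl
∈-members {S = true Vec.∷ S} (Vec.there i∈) = there (Mₚ.∈-map⁺ fsuc (∈-members i∈))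
∈-members {S = false Vec.∷ S} (Vec.there i∈) = Mₚ.∈-map⁺ fsuc (∈-members i∈)

edges-above : ∀ {N m} → PartialColoring N m → Fin m → Fin N → Fin N → Bool
edges-above φ c u v = ⌊ toℕ u ℕ.<? toℕ v ⌋ ∧ ⌊ φ u v ≟M just c ⌋

-- colorCount sums with a function local to its where block; the two metavariables below are solved
-- by that function, which makes it available under a name.
mutual
  colourSum : ∀ {N m} → PartialColoring N m → Fin m → (Fin N → ℕ) → ℕ
  colourSum φ c w = _

  colorCount≡ : ∀ {N m} (φ : PartialColoring N m) (c : Fin m) →
    colorCount φ c ≡ colourSum φ c (λ u → count (edges-above φ c u))
  colorCount≡ φ c with (λ u → count (edges-above φ c u))
  ... | w = refl

mutual
  partialSum : ∀ {n k m} → PartialColoring n m → Fin m → (Fin k → ℕ) → ℕ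
  partialSum φ c w = _

  colourSum-suc : ∀ {N m} (φ : PartialColoring (suc N) m) (c : Fin m) (w : Fin (suc N) → ℕ) →
    colourSum φ c w ≡ w fzero + partialSum φ c (λ i → w (fsuc i))
  colourSum-suc {N} φ c w with suc N | φ | (λ i → w (fsuc i))
  ... | n | φ′ | g = refl

module _ {A : Set} where

  -- `ρ` remembers the original first coordinate, so that the recursion runs in step with the sum in
  -- `colorCount`.
  true-pairs : ∀ {k n} → (Fin k → A) → (Fin k → Fin n → Bool) → List (A × Fin n)
  true-pairs {zero} ρ p = []
  true-pairs {suc k} ρ p = map (ρ fzero ,_) (trues (p fzero)) ++ true-pairs (ρ ∘ fsuc) (p ∘ fsuc)

  ∈-true-pairs : ∀ {k n} (ρ : Fin k → A) (p : Fin k → Fin n → Bool) {i j} → p i j ≡ true → (ρ i , j) ∈ˡ true-pairs ρ p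
  ∈-true-pairs ρ p {fzero} e = Mₚ.∈-++⁺ˡ (Mₚ.∈-map⁺ (ρ fzero ,_) (∈-trues (p fzero) e))
  ∈-true-pairs ρ p {fsuc i} e = Mₚ.∈-++⁺ʳ (map (ρ fzero ,_) (trues (p fzero))) (∈-true-pairs (ρ ∘ fsuc) (p ∘ fsuc) e)

  length-true-pairs : ∀ {n′ m} (φ : PartialColoring n′ m) c {k n} (ρ : Fin k → A) (p : Fin k → Fin n → Bool) →
    length (true-pairs ρ p) ≡ partialSum φ c (λ i → count (p i))
  length-true-pairs φ c {zero} ρ p = refl
  length-true-pairs φ c {suc k} ρ p = trans (Lₚ.length-++ (map (ρ fzero ,_) (trues (p fzero))))
    (cong₂ _+_ (trans (Lₚ.length-map (ρ fzero ,_) (trues (p fzero))) (length-trues (p fzero)))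
      (length-true-pairs φ c (ρ ∘ fsuc) (p ∘ fsuc)))

coloured-pairs : ∀ {N m} → PartialColoring N m → Fin m → List (Fin N × Fin N)
coloured-pairs φ c = true-pairs id (edges-above φ c)

length-coloured-pairs : ∀ {N m} (φ : PartialColoring N m) c → length (coloured-pairs φ c) ≡ colorCount φ c
length-coloured-pairs {zero} φ c = refl
length-coloured-pairs {suc N} φ c = trans (length-true-pairs φ c id (edges-above φ c))
  (sym (trans (colorCount≡ φ c) (colourSum-suc φ c (λ u → count (edges-above φ c u)))))

-- From density and sparsity to covers, and the two numbers of colours

IsCompatible : ∀ {N m} → PartialColoring N m → ListAssignment N m → Set
IsCompatible φ L = ∀ u v col → φ u v ≡ just col → col ∉ L u v

Solvable : ℕ → ℕ → Set
Solvable N m = (φ : PartialColoring N m) (L : ListAssignment N m) →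
  IsPrecoloring φ → IsDense 1 B φ → IsListAssignment L → IsSparse 1 B L → IsCompatible φ L →
  ∃[ f ] (IsProperColoring f × (∀ u v col → φ u v ≡ just col → f u v ≡ col) × (∀ u v → u ≢ v → f u v ∉ L u v))

module Instance {N m : ℕ} (φ : PartialColoring N m) (L : ListAssignment N m) (precoloring : IsPrecoloring φ)
  (dense : IsDense 1 B φ) (symmetric : IsListAssignment L) (sparse : IsSparse 1 B L) where

  instance
    B-nonZero : NonZero B
    B-nonZero = ℕ.>-nonZero 0<B

  r : ℕ
  r = m / B

  Br≤m : B * r ≤ m
  Br≤m = subst (_≤ m) (ℕₚ.*-comm r B) (DM.m/n*n≤m m B)

  m<Br+B : m < B * r + B
  m<Br+B = begin-strict
    m                ≡⟨ DM.m≡m%n+[m/n]*n m B ⟩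
    m % B + r * B    <⟨ ℕₚ.+-monoˡ-< (r * B) (DM.m%n<n m B) ⟩
    B + r * B        ≡⟨ ℕₚ.+-comm B (r * B) ⟩
    r * B + B        ≡⟨ cong (_+ B) (ℕₚ.*-comm r B) ⟩
    B * r + B        ∎
    where open ℕₚ.≤-Reasoning

  suc-m≤2Br : 1 ≤ r → suc m ≤ 2 * (B * r)
  suc-m≤2Br 1≤r = ℕₚ.≤-trans m<Br+B (ℕₚ.+-monoʳ-≤ (B * r)
    (ℕₚ.≤-trans (ℕₚ.m≤m*n B r {{ℕ.>-nonZero 1≤r}}) (ℕₚ.≤-reflexive (sym (ℕₚ.+-identityʳ (B * r))))))

  at-most : ∀ {x} → B * x ≤ 1 * m → x ≤ r
  at-most {x} l = ℕₚ.<⇒≤pred (ℕₚ.*-cancelˡ-< B x (suc r) (ℕₚ.≤-<-trans l (subst₂ _<_ (sym (ℕₚ.+-identityʳ m))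
    (trans (ℕₚ.+-comm (B * r) B) (sym (ℕₚ.*-suc B r))) m<Br+B)))

  r≤2r : r ≤ 2 * r
  r≤2r = ℕₚ.m≤m+n r (r + 0)

  φ-sym : ∀ u v → φ u v ≡ φ v u
  φ-sym = proj₁ precoloring

  φ-loop : ∀ u → φ u u ≡ nothing
  φ-loop = proj₁ (proj₂ precoloring)

  φ-proper : ∀ {u v w c} → φ u v ≡ just c → φ u w ≡ just c → v ≡ w
  φ-proper {u} {v} {w} {c} e e′ = decidable-stable (v F.≟ w) λ d → proj₂ (proj₂ precoloring) u v w c d e e′

  φ-vertex : ∀ u → Cover (2 * r) (λ v → φ u v ≢ nothing)
  φ-vertex u = Cover-mono r≤2r id (count-cover (λ v → not ⌊ φ u v ≟M nothing ⌋)
    (λ d → cong not (isYes-false (_ ≟M nothing) d)) (at-most (proj₂ dense u)))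

  -- At most r edges have the colour, and each has two ends. This is the origin of the bound 2 r.
  φ-colour : ∀ c → Cover (2 * r) (λ v → ∃ λ w → φ v w ≡ just c)
  φ-colour c = Cover-mono (ℕₚ.≤-reflexive (cong (r +_) (sym (ℕₚ.+-identityʳ r)))) split
    (Cover-⊎ (side-cover proj₁) (side-cover proj₂))
    where
    side-cover : (side : Fin N × Fin N → Fin N) → Cover r (_∈ˡ map side (coloured-pairs φ c))
    side-cover side = Cover-mono (subst (_≤ r) (sym (trans (Lₚ.length-map side (coloured-pairs φ c)) (length-coloured-pairs φ c)))
      (at-most (proj₁ dense c))) id (Cover-list (map side (coloured-pairs φ c)))
    listed : ∀ {u v} → toℕ u < toℕ v → φ u v ≡ just c → (u , v) ∈ˡ coloured-pairs φ c
    listed {u} {v} u<v e = ∈-true-pairs id (edges-above φ c)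
      (cong₂ _∧_ (isYes-true (toℕ u ℕ.<? toℕ v) u<v) (isYes-true (φ u v ≟M just c) e))
    split : ∀ {v} → (∃ λ w → φ v w ≡ just c) → v ∈ˡ map proj₁ (coloured-pairs φ c) ⊎ v ∈ˡ map proj₂ (coloured-pairs φ c)
    split {v} (w , e) with ℕₚ.<-cmp (toℕ v) (toℕ w)
    ... | tri< v<w _ _ = inj₁ (Mₚ.∈-map⁺ proj₁ (listed v<w e))
    ... | tri> _ _ w<v = inj₂ (Mₚ.∈-map⁺ proj₂ (listed w<v (trans (φ-sym w v) e)))
    ... | tri≈ _ v≡w _ with Fₚ.toℕ-injective v≡w
    ...   | refl = case trans (sym e) (φ-loop v) of λ ()

  L-sym : ∀ {u v c} → c ∈ˢ L u v → c ∈ˢ L v u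
  L-sym {u} {v} {c} = subst (c ∈ˢ_) (symmetric u v)

  L-vertex : ∀ u c → Cover (2 * r) (λ v → u ≢ v × c ∈ˢ L u v)
  L-vertex u c = Cover-mono r≤2r id (count-cover (λ v → not ⌊ v F.≟ u ⌋ ∧ ⌊ c Sₚ.∈? L u v ⌋)
    (λ {v} (u≢v , c∈) → cong₂ _∧_ (cong not (isYes-false (v F.≟ u) (u≢v ∘ sym))) (isYes-true (c Sₚ.∈? L u v) c∈))
    (at-most (proj₂ sparse u c)))

  L-edge : ∀ {u v} → u ≢ v → Cover (2 * r) (_∈ˢ L u v)
  L-edge {u} {v} u≢v = cover (members (L u v))
    (subst (_≤ 2 * r) (sym (length-members (L u v))) (ℕₚ.≤-trans (at-most (proj₁ sparse u v u≢v)) r≤2r)) ∈-members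

module _ (w : ℕ) where

  private
    m N : ℕ
    m = suc (w + w)
    N = suc m

  solvable-even : Solvable N m
  solvable-even φ L precoloring dense symmetric sparse compatible =
    let g , g-sym , g-proper , extends , avoids = factorize w r (ℕₚ.≤-trans Br≤m (ℕₚ.n≤1+n m)) suc-m≤2Br
          (record { φ-sym = φ-sym ; φ-loop = φ-loop ; φ-proper = φ-proper ; φ-vertex = φ-vertex ; φ-colour = φ-colour })
          (record { L-sym = record { flip = L-sym } ; L-dec = λ u v c → c Sₚ.∈? L u v ; L-vertex = L-vertex ; L-edge = L-edge })
          (λ {u} {v} {c} e → compatible u v c e)
    in g , (g-sym , λ u v w u≢v u≢w v≢w e → v≢w (g-proper u≢v u≢w e)) , extends , avoids
    where open Instance φ L precoloring dense symmetric sparse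

  -- One colour, here 0, is left out of the factorization and used on the edges precoloured with it only.
  solvable-odd : Solvable N N
  solvable-odd φ L precoloring dense symmetric sparse compatible = extend
    (factorize w r Br≤m (λ 1≤r → ℕₚ.≤-trans (ℕₚ.n≤1+n N) (suc-m≤2Br 1≤r)) pre lists (λ {u} {v} {c} → free {u} {v} {c}))
    where
    open Instance φ L precoloring dense symmetric sparse
    lower : Maybe (Fin N) → Maybe (Fin m)
    lower (just (fsuc c)) = just c
    lower _ = nothing
    φ⁻ : PartialColoring N m
    φ⁻ u v = lower (φ u v)
    raise : ∀ k {c} → lower k ≡ just c → k ≡ just (fsuc c)
    raise (just (fsuc c)) refl = refl
    L⁻ : Forbid N m
    L⁻ u v c = φ u v ≢ just fzero × fsuc c ∈ˢ L u v
    pre : Pre φ⁻ (2 * r)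
    pre = record
      { φ-sym = λ u v → cong lower (φ-sym u v)
      ; φ-loop = λ u → cong lower (φ-loop u)
      ; φ-proper = λ {u} {v} {w} e e′ → φ-proper (raise (φ u v) e) (raise (φ u w) e′)
      ; φ-vertex = λ u → Cover-mono ℕₚ.≤-refl (λ d e → d (cong lower e)) (φ-vertex u)
      ; φ-colour = λ c → Cover-mono ℕₚ.≤-refl (λ {v} (w , e) → w , raise (φ v w) e) (φ-colour (fsuc c)) }
    lists : Lists L⁻ (2 * r)
    lists = record
      { L-sym = record { flip = λ {u} {v} (d , c∈) → (λ e → d (trans (φ-sym u v) e)) , L-sym c∈ }
      ; L-dec = λ u v c → ¬? (φ u v ≟M just fzero) ×-dec (fsuc c Sₚ.∈? L u v)
      ; L-vertex = λ u c → Cover-mono ℕₚ.≤-refl (λ (u≢v , _ , c∈) → u≢v , c∈) (L-vertex u (fsuc c))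
      ; L-edge = λ {u} {v} u≢v → Cover-image down (λ {c} (_ , c∈) → fsuc c , c∈ , refl) (L-edge u≢v) }
      where
      down : Fin N → Fin m
      down fzero = fzero
      down (fsuc c) = c
    free : ∀ {u v c} → φ⁻ u v ≡ just c → ¬ L⁻ u v c
    free {u} {v} {c} e (_ , c∈) = compatible u v (fsuc c) (raise (φ u v) e) c∈
    extend : Solution φ⁻ L⁻ → ∃[ f ] (IsProperColoring f × (∀ u v col → φ u v ≡ just col → f u v ≡ col) × (∀ u v → u ≢ v → f u v ∉ L u v))
    extend (g , g-sym , g-proper , extends , avoids) = h , (h-sym , h-proper) , h-extends , h-avoids
      where
      pick : ∀ {k : Maybe (Fin N)} → Dec (k ≡ just fzero) → Fin m → Fin N
      pick (yes _) _ = fzero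
      pick (no _) c = fsuc c
      -- Overwriting keeps the colouring proper: the edges precoloured 0 form a matching, and all
      -- others carry successors.
      h : Fin N → Fin N → Fin N
      h u v = pick (φ u v ≟M just fzero) (g u v)
      h-sym : ∀ u v → h u v ≡ h v u
      h-sym u v = cong₂ (λ k c → pick (k ≟M just fzero) c) (φ-sym u v) (g-sym u v)
      h-proper : ∀ u v w → u ≢ v → u ≢ w → v ≢ w → h u v ≢ h u w
      h-proper u v w u≢v u≢w v≢w = go (φ u v ≟M just fzero) (φ u w ≟M just fzero)
        where
        go : ∀ (d : Dec (φ u v ≡ just fzero)) (d′ : Dec (φ u w ≡ just fzero)) → pick d (g u v) ≢ pick d′ (g u w)
        go (yes e) (yes e′) _ = v≢w (φ-proper e e′)
        go (no _) (no _) e = v≢w (g-proper u≢v u≢w (Fₚ.suc-injective e))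
      h-extends : ∀ u v col → φ u v ≡ just col → h u v ≡ col
      h-extends u v col e = go (φ u v ≟M just fzero) col e
        where
        go : ∀ (d : Dec (φ u v ≡ just fzero)) col → φ u v ≡ just col → pick d (g u v) ≡ col
        go (yes e) col e′ = just-injective (trans (sym e) e′)
        go (no d) fzero e = ⊥-elim (d e)
        go (no d) (fsuc c) e = cong fsuc (extends u v c (cong lower e))
      h-avoids : ∀ u v → u ≢ v → h u v ∉ L u v
      h-avoids u v u≢v = go (φ u v ≟M just fzero)
        where
        go : ∀ (d : Dec (φ u v ≡ just fzero)) → pick d (g u v) ∉ L u v
        go (yes e) = compatible u v fzero e
        go (no d) c∈ = avoids u v u≢v (d , c∈)

numColors-cases : ∀ n → numColors n ≡ 2 * n ∸ 1 ⊎ numColors n ≡ 2 * n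
numColors-cases n with n % 2
... | zero = inj₁ refl
... | suc _ = inj₂ refl

doubled : ∀ w → 2 * suc w ≡ suc (suc (w + w))
doubled = solve-∀

-- Both 2n - 1 and 2n colours are treated for every n, so it is enough to know which of the two
-- values `numColors` takes.
solvable : ∀ n → 0 < n → Solvable (2 * n) (numColors n)
solvable (suc w) _ with numColors-cases (suc w)
... | inj₁ e = subst₂ Solvable (sym (doubled w)) (sym (trans e (cong (_∸ 1) (doubled w)))) (solvable-even w)
... | inj₂ e = subst₂ Solvable (sym (doubled w)) (sym (trans e (doubled w))) (solvable-odd w)

theorem1p1 : ∃[ a ] ∃[ b ] ∃[ c ] ∃[ d ]
    (0 < a × 0 < b × 0 < c × 0 < d ×
    (∀ (n : ℕ) → 0 < n →
    (φ : PartialColoring (2 * n) (numColors n)) →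
    (L : ListAssignment (2 * n) (numColors n)) →
    IsPrecoloring φ → IsDense a b φ →
    IsListAssignment L → IsSparse c d L →
    (∀ u v col → φ u v ≡ just col → col ∉ L u v) →
    ∃[ f ] (IsProperColoring f ×
    (∀ u v col → φ u v ≡ just col → f u v ≡ col) ×
    (∀ u v → u ≢ v → f u v ∉ L u v))))
theorem1p1 = 1 , B , 1 , B , s≤s z≤n , 0<B , s≤s z≤n , 0<B , solvable
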